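{- Let $(G_n)_{n\ge 0}$ be the sequence of graphs defined in the context, and let $T_n(x,y)=T(G_n;x,y)$ be the Tutte polynomial of $G_n$. For every $n\ge 0$: (i) the number of acyclic root-connected orientations of $G_n$ is given by $$T_n(1,0)=\prod_{i=0}^{n}(i+1)^{2\cdot 4^{\,n-i}};$$ (ii) the number of indegree sequences of strongly connected orientations of $G_n$ is given by $$T_n(0,1)=\frac{n}{2}\prod_{i=0}^{n}(i+1)^{2\cdot 4^{\,n-i}}.$$
   Context: Tutte polynomial: for a graph $G$ with vertex set $V(G)$, edge set $E(G)$ and $k(G)$ connected components, put $r(G)=|V(G)|-k(G)$ and $n(G)=|E(G)|-|V(G)|+k(G)$. Then $T(G;x,y)=\sum_{H\subseteq G}(x-1)^{r(G)-r(H)}(y-1)^{n(H)}$, where the sum runs over all spanning subgraphs $H$ of $G$ (subgraphs with $V(H)=V(G)$ and arbitrary $E(H)\subseteq E(G)$). The graphs $G_n$: $G_0$ is the complete graph $K_2$ with its two vertices denoted $X_0,Y_0$. For $n\ge 0$, given $G_n$ with two special vertices $X_n,Y_n$, take four disjoint copies $G_n^1,G_n^2,G_n^3,G_n^4$ of $G_n$, with special vertices $X_n^i,Y_n^i$. Identify $X_n^1$ with $X_n^2$ to form the special vertex $X_{n+1}$ of $G_{n+1}$; identify $Y_n^3$ with $Y_n^4$ to form the special vertex $Y_{n+1}$ of $G_{n+1}$; identify $Y_n^1$ with $X_n^3$ to form a vertex $a$, and $Y_n^2$ with $X_n^4$ to form a vertex $b$; finally add a new edge $e_n$ joining $a$ and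 $b$. The result is $G_{n+1}$. Orientations: an orientation of a graph is the digraph obtained by choosing a direction for every edge. It is acyclic if it has no directed cycle. It is root-connected, with respect to an arbitrarily fixed root vertex, if every vertex can be reached from the root by a directed path. It is strongly connected if every vertex can be reached from every other vertex by a directed path. The indegree sequence of an orientation is the function assigning to each (labelled) vertex the number of edges directed into it; item (ii) counts distinct indegree sequences that arise from strongly connected orientations. Facts recalled in the paper for a connected graph $G$: $T(G;1,0)$ is the number of acyclic root-connected orientations of $G$ (for any fixed root), and $T(G;0,1)$ is the number of indegree sequences of strongly connected orientations of $G$. -}

module Defs where

open import Data.Nat.Base using (ℕ; zero; suc; _+_; _*_; _∸_)
import Data.Nat.Properties as ℕ
open import Data.Integer.Base as ℤ using (ℤ; 0ℤ; 1ℤ)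
open import Data.Fin.Base using (Fin; zero; suc; combine)
import Data.Fin.Properties as Fin
open import Data.List.Base
  using (List; []; _∷_; _++_; map; concatMap; filter; deduplicate; foldr;
         length; allFin; upTo)
open import Data.Nat.ListAction using (product)
open import Data.List.Membership.Propositional using (_∈_)
open import Data.List.Membership.Propositional.Properties using (∈-allFin)
open import Data.List.Relation.Unary.Any using (here; there)
import Data.List.Membership.DecPropositional as DecMembership
open import Data.Product.Base using (_×_; _,_; proj₂; ∃)
import Data.Product.Properties as ×
open import Data.Sum.Base using (_⊎_; inj₁; inj₂)
open import Data.Vec.Base using (Vec; tabulate)
import Data.Vec.Properties as Vec
open import Level using (0ℓ)
open import Relation.Binary.Core using (Rel)
open import Relation.Binary.Definitions using (Decidable)
open import Relation.Binary.Construct.Closure.ReflexiveTransitive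
  using (Star; ε; _◅_; _◅◅_)
open import Relation.Binary.Construct.Closure.Symmetric using (SymClosure; fwd; bwd)
open import Relation.Binary.Construct.Closure.Transitive using (TransClosure; [_]; _∷_)
open import Relation.Binary.Construct.Closure.Equivalence using (EqClosure)
open import Relation.Binary.PropositionalEquality using (_≡_; refl)
open import Relation.Nullary using (¬_; Dec; ¬?; _×-dec_; _⊎-dec_)
open import Relation.Nullary.Decidable using (map′)
import Relation.Unary as U

-- Decidability of reachability on Fin v (Warshall's algorithm): Via ws x y
-- says that y can be reached from x with all intermediate vertices in ws.

module Reachability {v : ℕ} {R : Rel (Fin v) 0ℓ} (R? : Decidable R) where

  Via : List (Fin v) → Rel (Fin v) 0ℓ
  Via []       x y = x ≡ y ⊎ R x y
  Via (w ∷ ws) x y = Via ws x y ⊎ (Via ws x w × Via ws w y)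

  via? : ∀ ws → Decidable (Via ws)
  via? []       x y = (x Fin.≟ y) ⊎-dec R? x y
  via? (w ∷ ws) x y = via? ws x y ⊎-dec (via? ws x w ×-dec via? ws w y)

  via⇒star : ∀ ws {x y} → Via ws x y → Star R x y
  via⇒star []       (inj₁ refl)    = ε
  via⇒star []       (inj₂ r)       = r ◅ ε
  via⇒star (w ∷ ws) (inj₁ p)       = via⇒star ws p
  via⇒star (w ∷ ws) (inj₂ (p , q)) = via⇒star ws p ◅◅ via⇒star ws q

  via-refl : ∀ ws {x} → Via ws x x
  via-refl []       = inj₁ refl
  via-refl (w ∷ ws) = inj₁ (via-refl ws)

  via-step : ∀ ws {x y} → R x y → Via ws x y
  via-step []       r = inj₂ r
  via-step (w ∷ ws) r = inj₁ (via-step ws r)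

  via-trans : ∀ ws {x y z} → y ∈ ws → Via ws x y → Via ws y z → Via ws x z
  via-trans (w ∷ ws) (here refl) p q = inj₂ (into p , out q)
    where
    into : ∀ {x} → Via (w ∷ ws) x w → Via ws x w
    into (inj₁ p)       = p
    into (inj₂ (p , _)) = p
    out : ∀ {z} → Via (w ∷ ws) w z → Via ws w z
    out (inj₁ q)       = q
    out (inj₂ (_ , q)) = q
  via-trans (w ∷ ws) (there m) (inj₁ p)       (inj₁ q)       = inj₁ (via-trans ws m p q)
  via-trans (w ∷ ws) (there m) (inj₁ p)       (inj₂ (q , s)) = inj₂ (via-trans ws m p q , s)
  via-trans (w ∷ ws) (there m) (inj₂ (p , s)) (inj₁ q)       = inj₂ (p , via-trans ws m s q)
  via-trans (w ∷ ws) (there m) (inj₂ (p , _)) (inj₂ (_ , s)) = inj₂ (p , s)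

  star⇒via : ∀ {x y} → Star R x y → Via (allFin v) x y
  star⇒via ε        = via-refl (allFin v)
  star⇒via (r ◅ rs) =
    via-trans (allFin v) (∈-allFin _) (via-step (allFin v) r) (star⇒via rs)

  star? : Decidable (Star R)
  star? x y = map′ (via⇒star (allFin v)) star⇒via (via? (allFin v) x y)

  plus? : Decidable (TransClosure R)
  plus? x y = map′ (λ (_ , r , rs) → to r rs) from
                   (Fin.any? λ w → R? x w ×-dec star? w y)
    where
    to : ∀ {x w y} → R x w → Star R w y → TransClosure R x y
    to r ε        = [ r ]
    to r (s ◅ rs) = r ∷ to s rs
    weaken : ∀ {x y} → TransClosure R x y → Star R x y
    weaken [ r ]    = r ◅ ε
    weaken (r ∷ rs) = r ◅ weaken rs
    from : ∀ {x y} → TransClosure R x y → ∃ λ w → R x w × Star R w y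
    from [ r ]    = _ , r , ε
    from (r ∷ rs) = _ , r , weaken rs

-- Graphs and digraphs on the vertex set Fin v. In a Graph the pair (x , y)
-- stands for the unordered edge xy; in a Digraph it is the arc from x to y.
-- The lists are families: a repeated entry is a parallel edge.

Graph : ℕ → Set
Graph v = List (Fin v × Fin v)

Digraph : ℕ → Set
Digraph v = List (Fin v × Fin v)

module _ {v : ℕ} where
  open DecMembership (×.≡-dec (Fin._≟_ {v}) (Fin._≟_ {v})) using (_∈?_)

  Connected : Graph v → Rel (Fin v) 0ℓ
  Connected G = EqClosure (λ x y → (x , y) ∈ G)

  connected? : (G : Graph v) → Decidable (Connected G)
  connected? G = Reachability.star? adjacent?
    where
    adjacent? : Decidable (SymClosure (λ x y → (x , y) ∈ G))
    adjacent? x y = map′ (λ { (inj₁ e) → fwd e ; (inj₂ e) → bwd e })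
                         (λ { (fwd e) → inj₁ e ; (bwd e) → inj₂ e })
                         (((x , y) ∈? G) ⊎-dec ((y , x) ∈? G))

  -- deduplicate keeps one vertex from each class of Connected G.
  components : Graph v → ℕ
  components G = length (deduplicate (connected? G) (allFin v))

  rank : Graph v → ℕ
  rank G = v ∸ components G

  -- |E| - |V| + k, summed in this order so that the truncated subtraction is
  -- exact: |V| ≤ |E| + k in every graph.
  nullity : Graph v → ℕ
  nullity G = (length G + components G) ∸ v

  -- One entry for each subset of the edges.
  spanningSubgraphs : Graph v → List (Graph v)
  spanningSubgraphs []      = [] ∷ []
  spanningSubgraphs (e ∷ G) = map (e ∷_) (spanningSubgraphs G) ++ spanningSubgraphs G

  -- The integer power has i ℤ.^ 0 = 1ℤ for all i, including 0ℤ, as required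
  -- for evaluating the polynomial at x = 1 or y = 1. rank H ≤ rank G for every
  -- spanning subgraph H, so the subtraction in the exponent is exact.
  tutte : Graph v → ℤ → ℤ → ℤ
  tutte G x y = foldr ℤ._+_ 0ℤ (map term (spanningSubgraphs G))
    where
    term : Graph v → ℤ
    term H = ((x ℤ.- 1ℤ) ℤ.^ (rank G ∸ rank H)) ℤ.* ((y ℤ.- 1ℤ) ℤ.^ nullity H)

  -- One entry for each choice of a direction for every edge.
  orientations : Graph v → List (Digraph v)
  orientations []            = [] ∷ []
  orientations ((x , y) ∷ G) =
    map ((x , y) ∷_) (orientations G) ++ map ((y , x) ∷_) (orientations G)

  Arc : Digraph v → Rel (Fin v) 0ℓ
  Arc D x y = (x , y) ∈ D

  arc? : (D : Digraph v) → Decidable (Arc D)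
  arc? D x y = (x , y) ∈? D

  Reaches : Digraph v → Rel (Fin v) 0ℓ
  Reaches D = Star (Arc D)

  reaches? : (D : Digraph v) → Decidable (Reaches D)
  reaches? D = Reachability.star? (arc? D)

  -- TransClosure (Arc D) x x: a nonempty closed directed walk through x. Such
  -- a walk contains a directed cycle, and a directed cycle is such a walk.
  Acyclic : Digraph v → Set
  Acyclic D = ∀ x → ¬ TransClosure (Arc D) x x

  acyclic? : U.Decidable Acyclic
  acyclic? D = Fin.all? λ x → ¬? (Reachability.plus? (arc? D) x x)

  RootConnected : Fin v → Digraph v → Set
  RootConnected r D = ∀ x → Reaches D r x

  rootConnected? : ∀ r → U.Decidable (RootConnected r)
  rootConnected? r D = Fin.all? (reaches? D r)

  StronglyConnected : Digraph v → Set
  StronglyConnected D = ∀ x y → Reaches D x y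

  stronglyConnected? : U.Decidable StronglyConnected
  stronglyConnected? D = Fin.all? λ x → Fin.all? (reaches? D x)

  indegree : Digraph v → Fin v → ℕ
  indegree D x = length (filter (λ arc → proj₂ arc Fin.≟ x) D)

  indegreeSequence : Digraph v → Vec ℕ v
  indegreeSequence D = tabulate (indegree D)

  #acyclicRootConnected : Graph v → Fin v → ℕ
  #acyclicRootConnected G r =
    length (filter (λ D → acyclic? D ×-dec rootConnected? r D) (orientations G))

  #stronglyConnectedIndegreeSequences : Graph v → ℕ
  #stronglyConnectedIndegreeSequences G =
    length (deduplicate (Vec.≡-dec ℕ._≟_)
      (map indegreeSequence (filter stronglyConnected? (orientations G))))

-- The number of vertices of Gₙ other than Xₙ and Yₙ: those of Gₙ₊₁ are a, b
-- and, for each of the four copies of Gₙ, the vertices of that copy other than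
-- its two special ones.
inner : ℕ → ℕ
inner zero    = 0
inner (suc n) = 2 + 4 * inner n

Vertex : ℕ → Set
Vertex n = Fin (2 + inner n)

pattern X = zero
pattern Y = suc zero
pattern a = suc (suc zero)
pattern b = suc (suc (suc zero))
pattern other w = suc (suc (suc (suc w)))

pattern copy₁ = zero
pattern copy₂ = suc zero
pattern copy₃ = suc (suc zero)
pattern copy₄ = suc (suc (suc zero))

-- The map sending each vertex of the i-th copy of Gₙ to its image in Gₙ₊₁
-- after the identifications.
glue : ∀ n → Fin 4 → Vertex n → Vertex (suc n)
glue n copy₁ X = X
glue n copy₁ Y = a
glue n copy₂ X = X
glue n copy₂ Y = b
glue n copy₃ X = a
glue n copy₃ Y = Y
glue n copy₄ X = b
glue n copy₄ Y = Y
glue n i (suc (suc w)) = other (combine i w)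

G : ∀ n → Graph (2 + inner n)
G zero    = (X , Y) ∷ []
G (suc n) =
  (a , b) ∷ concatMap (λ i → map (λ (x , y) → glue n i x , glue n i y) (G n)) (allFin 4)

-- The product of f 0, …, f n.
∏[0≤i≤_] : ℕ → (ℕ → ℕ) → ℕ
∏[0≤i≤ n ] f = product (map f (upTo (suc n)))

-- Acyclic root-connected orientations satisfy the deletion–contraction recurrence
-- orientation by orientation, so their number is, up to sign, the sum of (-1)^|H| over
-- the connected spanning subgraphs H. Among the strongly connected orientations with a
-- given indegree sequence exactly one directs the least edge of every directed cycle as
-- in a reference orientation; the orientations with this property satisfy the same
-- recurrence, deleting the greatest edge first, and are counted by the corresponding
-- sum over spanning forests.
--
-- Gₙ₊₁ is the diamond X a b Y, with chord ab, whose four other edges are replaced by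
-- copies of Gₙ. Splitting each of the two sums according to whether H joins X to Y gives
-- c′ = -4c²d², d′ = 2c²d² - 4cd³ for the connected subgraphs (d: two components, one
-- containing X and one Y), and the same recurrence up to sign, with the two parts
-- exchanged, for the forests. In both cases the ratio of the two parts is
-- -(n + 2) / 2, and the products follow.

module Submission where

open import Defs
open import Data.Bool.Base using (Bool; true; false; if_then_else_; not; _∧_; _∨_)
import Data.Bool.Properties as Bool
open import Data.Empty using (⊥)
open import Data.Fin.Base using (Fin; zero; suc; combine; _↑ˡ_)
import Data.Fin.Properties as Fin
open import Data.Integer.Base as ℤ using (ℤ; +_; -_; 0ℤ; 1ℤ; -1ℤ; _+_; _*_; _-_; _^_)
import Data.Integer.Properties as ℤ
open import Algebra.Properties.AbelianGroup ℤ.+-0-abelianGroup using (∙-cancelˡ)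
open import Data.Integer.Solver using (module +-*-Solver)
open import Data.Integer.Tactic.RingSolver using (solve-∀)
open import Data.List.Base
  using (List; []; _∷_; _++_; _∷ʳ_; map; filter; foldr; length; deduplicate; allFin; upTo)
open import Data.List.Membership.Propositional using (_∈_)
open import Data.List.Membership.Propositional.Properties
  using (∈-++⁺ˡ; ∈-++⁺ʳ; ∈-++⁻; ∈-map⁺; ∈-map⁻; ∈-filter⁺; ∈-filter⁻; ∈-allFin; ∈-upTo⁻;
         ∈-deduplicate⁺; ∈-deduplicate⁻)
open import Data.List.Properties
  using (++-assoc; ++-identityʳ; map-++; map-∘; filter-++; filter-none; length-++; length-map;
         length-removeAt′; length-tabulate; upTo-∷ʳ; ∷-injectiveˡ; ∷-injectiveʳ)
import Data.List.Relation.Binary.Pointwise as Pointwise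
open import Data.List.Relation.Binary.Pointwise.Base using (Pointwise; []; _∷_)
open import Data.List.Relation.Unary.All as All using (All; []; _∷_)
import Data.List.Relation.Unary.All.Properties as All
open import Data.List.Relation.Unary.AllPairs as AllPairs using (AllPairs; []; _∷_)
open import Data.List.Relation.Unary.Any as Any using (Any; here; there; _─_)
import Data.List.Relation.Unary.Any.Properties as Any
import Data.List.Relation.Unary.Unique.DecSetoid.Properties as Unique
open import Data.List.Relation.Unary.Unique.Propositional using (Unique)
import Data.List.Relation.Unary.Unique.Propositional.Properties as Unique
open import Data.List.Reverse using (Reverse; []; _∶_∶ʳ_; reverseView)
open import Data.Nat.Base as ℕ using (ℕ; zero; suc; _≤_; _∸_; _≡ᵇ_; z≤n; s≤s)
open import Data.Nat.ListAction using (product)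
open import Data.Nat.ListAction.Properties using (product-++)
import Data.Nat.Properties as ℕ
open import Data.Nat.Tactic.RingSolver using () renaming (solve-∀ to solve-∀ᴺ)
open import Data.Product.Base using (_×_; _,_; proj₁; proj₂; ∃; swap)
import Data.Product.Properties as ×
open import Data.Rational.Base as ℚ using (_/_)
import Data.Rational.Properties as ℚ
open import Data.Rational.Unnormalised.Base as ℚᵘ using (mkℚᵘ; *≡*)
import Data.Rational.Unnormalised.Properties as ℚᵘ
open import Data.Sum.Base as Sum using (_⊎_; inj₁; inj₂; [_,_]′)
open import Data.Unit.Base using (⊤; tt)
open import Data.Vec.Base using (Vec; lookup)
open import Data.Vec.Properties using (tabulate-cong; lookup∘tabulate; ≡-dec)
open import Function.Base using (_∘_; id)
open import Level using (0ℓ)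
open import Relation.Binary.Bundles using (DecSetoid)
import Relation.Binary.Construct.Closure.Equivalence as Eq
open import Relation.Binary.Construct.Closure.ReflexiveTransitive as Star
  using (ε; _◅_; _◅◅_)
open import Relation.Binary.Construct.Closure.Symmetric as Sym using (SymClosure; fwd; bwd)
open import Relation.Binary.Construct.Closure.Transitive using (TransClosure; [_]; _∷_)
open import Relation.Binary.Core using (Rel)
open import Relation.Binary.Definitions using (Decidable; DecidableEquality)
open import Relation.Binary.PropositionalEquality
  using (_≡_; _≢_; refl; sym; trans; cong; cong₂; subst; subst₂; isEquivalence; module ≡-Reasoning)
open import Relation.Binary.Structures using (IsEquivalence)
open import Relation.Nullary
  using (¬_; Dec; yes; no; does; contradiction; ¬?; _×-dec_; _⊎-dec_; _→-dec_)
open import Relation.Nullary.Decidable using (dec-true; dec-false; does-≡)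
import Relation.Unary as U

-- Transversals of an equivalence relation

-- Contraction is done without quotients: the vertex set stays fixed, and the contracted edges are
-- kept in a list `C` whose edges may be traversed both ways. An edge is then a loop when `C`
-- already connects its ends. Statements proved by deletion and contraction are therefore made for
-- general `C`, or relative to an ambient digraph `A`, and used at the end for empty `C`. The
-- greatest edge goes first because it can be the least edge of a cycle only if it is a loop;
-- otherwise its own direction is free. The recursion along Gₙ needs quantities that add up over the
-- four copies. The number of components does not, since the components of the special vertices
-- merge, but the number of components avoiding both special vertices does, and so does the nullity.
-- Zero raised to such a quantity is multiplicative, and the fourfold sum over subgraphs of the
-- copies factors. As `components` is the output of an algorithm, its properties are all drawn from
-- the fact that any two transversals of an equivalence relation have the same length.

module _ {A : Set} where

  ─-Any : ∀ {P Q : A → Set} {T} (p : Any P T) → (∀ {t} → P t → ¬ Q t) →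
          Any Q T → Any Q (T ─ p)
  ─-Any (here pt) disj (here qt) = contradiction qt (disj pt)
  ─-Any (here _)  disj (there q) = q
  ─-Any (there p) disj (here qt) = here qt
  ─-Any (there p) disj (there q) = there (─-Any p disj q)

  ─-All : ∀ {P : A → Set} {Q : A → Set} {T} (p : Any Q T) → All P T → All P (T ─ p)
  ─-All (here _)  (_ ∷ ps)  = ps
  ─-All (there q) (px ∷ ps) = px ∷ ─-All q ps

  ─-AllPairs : ∀ {R : Rel A 0ℓ} {Q : A → Set} {T} (p : Any Q T) → AllPairs R T → AllPairs R (T ─ p)
  ─-AllPairs (here _)  (_ ∷ ps)  = ps
  ─-AllPairs (there q) (px ∷ ps) = ─-All q px ∷ ─-AllPairs q ps

module _ {A : Set} {R : Rel A 0ℓ} (R-equiv : IsEquivalence R) where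
  private module R = IsEquivalence R-equiv

  Independent : List A → Set
  Independent = AllPairs (λ x y → ¬ R x y)

  apart : ∀ {x y t} → ¬ R x y → R x t → ¬ R y t
  apart x≁y xt yt = x≁y (R.trans xt (R.sym yt))

  -- A member of `T` cannot be related to two independent members of `S`. So the one matched with
  -- the head of `S` can be removed, and what is left still covers the tail.
  independent≤covering : ∀ {S T} → Independent S → All (λ s → Any (R s) T) S →
                         length S ≤ length T
  independent≤covering []           []           = z≤n
  independent≤covering {T = T} (s≁ ∷ ind) (p ∷ cov) =
    subst (_ ≤_) (sym (length-removeAt′ T (Any.index p)))
      (s≤s (independent≤covering {T = T ─ p} ind
        (All.zipWith (λ (s≁x , q) → ─-Any p (apart s≁x) q) (s≁ , cov))))

  removed-apart : ∀ {x T} → Independent T → (p : Any (R x) T) →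
                  All (λ t → ¬ R x t) (T ─ p)
  removed-apart (t≁ ∷ ind) (here xt) = All.map (λ t≁y xy → t≁y (R.trans (R.sym xt) xy)) t≁
  removed-apart (t≁ ∷ ind) (there p) =
    (λ xt → All.lookupAny t≁ p .proj₁ (R.trans (R.sym xt) (All.lookupAny t≁ p .proj₂)))
      ∷ removed-apart ind p

  deduplicate-independent : (R? : Decidable R) → ∀ xs → Independent (deduplicate R? xs)
  deduplicate-independent R? = Unique.deduplicate-! D
    where
    D : DecSetoid 0ℓ 0ℓ
    D = record { isDecEquivalence = record { isEquivalence = R-equiv ; _≟_ = R? } }

  deduplicate-covers : (R? : Decidable R) → ∀ {x xs} → x ∈ xs → Any (R x) (deduplicate R? xs)
  deduplicate-covers R? x∈xs =
    Any.deduplicate⁺ R? (λ y∼z xz → R.trans xz (R.sym y∼z))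
      (Any.map R.reflexive x∈xs)

-- Reachability, connectivity and the number of components

module _ {v : ℕ} where

  private variable
    A B C H : Graph v
    p q x y z w : Fin v

  both : Graph v → Digraph v
  both []            = []
  both ((x , y) ∷ C) = (x , y) ∷ (y , x) ∷ both C

  _⊆_ : Graph v → Graph v → Set
  A ⊆ B = ∀ {x y} → (x , y) ∈ A → (x , y) ∈ B

  reach-mono : A ⊆ B → Reaches A x y → Reaches B x y
  reach-mono A⊆B = Star.map A⊆B

  reach-there : ∀ {e} → Reaches A x y → Reaches (e ∷ A) x y
  reach-there = reach-mono there

  reach-here : Reaches A x p → Reaches A q y → Reaches ((p , q) ∷ A) x y
  reach-here xp qy = reach-there xp ◅◅ here refl ◅ reach-there qy

  -- The walk is cut before its first and after its last use of the arc (p , q).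
  reach-∷⁻ : Reaches ((p , q) ∷ A) x y →
             Reaches A x y ⊎ (Reaches A x p × Reaches A q y)
  reach-∷⁻ ε = inj₁ ε
  reach-∷⁻ (here refl ◅ rs) with reach-∷⁻ rs
  ... | inj₁ qy       = inj₂ (ε , qy)
  ... | inj₂ (_ , qy) = inj₂ (ε , qy)
  reach-∷⁻ (there r ◅ rs) with reach-∷⁻ rs
  ... | inj₁ zy        = inj₁ (r ◅ zy)
  ... | inj₂ (zp , qy) = inj₂ (r ◅ zp , qy)

  reach-to-tail : Reaches ((p , q) ∷ A) x p → Reaches A x p
  reach-to-tail r = [ id , proj₁ ]′ (reach-∷⁻ r)

  reach-from-head : Reaches ((p , q) ∷ A) q y → Reaches A q y
  reach-from-head r = [ id , proj₂ ]′ (reach-∷⁻ r)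

  -- Again the walk is cut at the first and last use. If these have opposite directions, the walk
  -- has returned to the same vertex, and the detour is dropped.
  reach-both⁻ : Reaches ((p , q) ∷ (q , p) ∷ A) x y →
    Reaches A x y ⊎ (Reaches A x p × Reaches A q y) ⊎ (Reaches A x q × Reaches A p y)
  reach-both⁻ ε = inj₁ ε
  reach-both⁻ (here refl ◅ rs) with reach-both⁻ rs
  ... | inj₁ qy              = inj₂ (inj₁ (ε , qy))
  ... | inj₂ (inj₁ (_ , qy)) = inj₂ (inj₁ (ε , qy))
  ... | inj₂ (inj₂ (_ , py)) = inj₁ py
  reach-both⁻ (there (here refl) ◅ rs) with reach-both⁻ rs
  ... | inj₁ py              = inj₂ (inj₂ (ε , py))
  ... | inj₂ (inj₁ (_ , qy)) = inj₁ qy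
  ... | inj₂ (inj₂ (_ , py)) = inj₂ (inj₂ (ε , py))
  reach-both⁻ (there (there r) ◅ rs) with reach-both⁻ rs
  ... | inj₁ zy               = inj₁ (r ◅ zy)
  ... | inj₂ (inj₁ (zp , qy)) = inj₂ (inj₁ (r ◅ zp , qy))
  ... | inj₂ (inj₂ (zq , py)) = inj₂ (inj₂ (r ◅ zq , py))

  reach-redundant : Reaches A p q → Reaches ((p , q) ∷ A) x y → Reaches A x y
  reach-redundant pq r with reach-∷⁻ r
  ... | inj₁ xy        = xy
  ... | inj₂ (xp , qy) = xp ◅◅ pq ◅◅ qy

  reach-∷-cong : ∀ {e} → (∀ {x y} → Reaches A x y → Reaches B x y) →
                 Reaches (e ∷ A) x y → Reaches (e ∷ B) x y
  reach-∷-cong A⇒B r with reach-∷⁻ r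
  ... | inj₁ xy        = reach-there (A⇒B xy)
  ... | inj₂ (xp , qy) = reach-here (A⇒B xp) (A⇒B qy)

  ∷-swap-⊆ : ∀ {e f} → (e ∷ f ∷ A) ⊆ (f ∷ e ∷ A)
  ∷-swap-⊆ (here refl)         = there (here refl)
  ∷-swap-⊆ (there (here refl)) = here refl
  ∷-swap-⊆ (there (there e))   = there (there e)

  ∷-insert-⊆ : ∀ {f e} → (e ∷ A) ⊆ (e ∷ f ∷ A)
  ∷-insert-⊆ (here refl) = here refl
  ∷-insert-⊆ (there e)   = there (there e)

  ++-∷-⊆ : ∀ H {e} → (H ++ e ∷ A) ⊆ (e ∷ H ++ A)
  ++-∷-⊆ H e with ∈-++⁻ H e
  ... | inj₁ h           = there (∈-++⁺ˡ h)
  ... | inj₂ (here refl) = here refl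
  ... | inj₂ (there e′)  = there (∈-++⁺ʳ H e′)

  ++-∷-⊇ : ∀ H {e} → (e ∷ H ++ A) ⊆ (H ++ e ∷ A)
  ++-∷-⊇ H (here refl) = ∈-++⁺ʳ H (here refl)
  ++-∷-⊇ H (there e) with ∈-++⁻ H e
  ... | inj₁ h  = ∈-++⁺ˡ h
  ... | inj₂ e′ = ∈-++⁺ʳ H (there e′)

  conn-isEquivalence : IsEquivalence (Connected C)
  conn-isEquivalence = Eq.isEquivalence _

  conn-sym : Connected C x y → Connected C y x
  conn-sym = Eq.symmetric _

  conn-mono : A ⊆ B → Connected A x y → Connected B x y
  conn-mono A⊆B = Eq.map A⊆B

  ∈⇒conn : (x , y) ∈ C → Connected C x y
  ∈⇒conn e = fwd e ◅ ε

  ∈-both⁺ : SymClosure (λ x y → (x , y) ∈ C) x y → (x , y) ∈ both C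
  ∈-both⁺ (fwd (here refl)) = here refl
  ∈-both⁺ (bwd (here refl)) = there (here refl)
  ∈-both⁺ (fwd (there e))   = there (there (∈-both⁺ (fwd e)))
  ∈-both⁺ (bwd (there e))   = there (there (∈-both⁺ (bwd e)))

  ∈-both⁻ : ∀ C → (x , y) ∈ both C → SymClosure (λ x y → (x , y) ∈ C) x y
  ∈-both⁻ (_ ∷ C) (here refl)         = fwd (here refl)
  ∈-both⁻ (_ ∷ C) (there (here refl)) = bwd (here refl)
  ∈-both⁻ (_ ∷ C) (there (there e))   = Sym.map there (∈-both⁻ C e)

  conn⇒reach : Connected C x y → Reaches (both C) x y
  conn⇒reach = Star.map ∈-both⁺

  reach⇒conn : Reaches (both C) x y → Connected C x y
  reach⇒conn = Star.map (∈-both⁻ _)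

  conn-∷⁻ : Connected ((p , q) ∷ C) x y →
    Connected C x y ⊎ (Connected C x p × Connected C q y) ⊎ (Connected C x q × Connected C p y)
  conn-∷⁻ r with reach-both⁻ (conn⇒reach r)
  ... | inj₁ xy               = inj₁ (reach⇒conn xy)
  ... | inj₂ (inj₁ (xp , qy)) = inj₂ (inj₁ (reach⇒conn xp , reach⇒conn qy))
  ... | inj₂ (inj₂ (xq , py)) = inj₂ (inj₂ (reach⇒conn xq , reach⇒conn py))

  conn-∷-redundant : Connected C p q → Connected ((p , q) ∷ C) x y → Connected C x y
  conn-∷-redundant pq r with conn-∷⁻ r
  ... | inj₁ xy               = xy
  ... | inj₂ (inj₁ (xp , qy)) = xp ◅◅ pq ◅◅ qy
  ... | inj₂ (inj₂ (xq , py)) = xq ◅◅ conn-sym pq ◅◅ py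

  representatives : Graph v → List (Fin v)
  representatives C = deduplicate (connected? C) (allFin v)

  representatives-independent : ∀ C → Independent (conn-isEquivalence {C}) (representatives C)
  representatives-independent C = deduplicate-independent conn-isEquivalence (connected? C) _

  represented : ∀ C x → Any (Connected C x) (representatives C)
  represented C x = deduplicate-covers conn-isEquivalence (connected? C) (∈-allFin x)

  -- This separates `components` from the algorithm that defines it: from here on a count is found
  -- by exhibiting a transversal.
  components-unique : ∀ {T} → Independent (conn-isEquivalence {C}) T →
                      (∀ x → Any (Connected C x) T) → components C ≡ length T
  components-unique {C} {T} ind cov = ℕ.≤-antisym
    (independent≤covering conn-isEquivalence (representatives-independent C)
      (All.universal cov _))
    (independent≤covering conn-isEquivalence ind (All.universal (represented C) T))

  components-cong : (∀ {x y} → Connected A x y → Connected B x y) →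
                    (∀ {x y} → Connected B x y → Connected A x y) →
                    components A ≡ components B
  components-cong {A} {B} A⇒B B⇒A = sym (components-unique
    (AllPairs.map (λ ¬A → ¬A ∘ B⇒A) (representatives-independent A))
    (λ x → Any.map A⇒B (represented A x)))

  components-resp-⊆ : A ⊆ B → B ⊆ A → components A ≡ components B
  components-resp-⊆ A⊆B B⊆A = components-cong (conn-mono A⊆B) (conn-mono B⊆A)

  components-redundant : Connected C p q → components ((p , q) ∷ C) ≡ components C
  components-redundant pq = components-cong (conn-∷-redundant pq) (conn-mono there)

  -- In a transversal for `C` the representative of `p` is struck out: the class of `p` is absorbed
  -- by that of `q`, and no other classes merge.
  components-bridge : ¬ Connected C p q → components C ≡ suc (components ((p , q) ∷ C))
  components-bridge {C} {p} {q} p≁q = begin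
    length T               ≡⟨ length-removeAt′ T (Any.index ∈T) ⟩
    suc (length (T ─ ∈T))  ≡⟨ cong suc (components-unique ind cov) ⟨
    suc (components ((p , q) ∷ C)) ∎
    where
    open ≡-Reasoning
    T : List (Fin v)
    T = representatives C
    ∈T : Any (Connected C p) T
    ∈T = represented C p
    ─ind : Independent (conn-isEquivalence {C}) (T ─ ∈T)
    ─ind = ─-AllPairs ∈T (representatives-independent C)
    p≁ : All (λ t → ¬ Connected C p t) (T ─ ∈T)
    p≁ = removed-apart conn-isEquivalence (representatives-independent C) ∈T
    lift : ∀ {T′} → All (λ t → ¬ Connected C p t) T′ → Independent (conn-isEquivalence {C}) T′ →
           Independent (conn-isEquivalence {(p , q) ∷ C}) T′
    lift []        []        = []
    lift (px ∷ ps) (tx ∷ ts) = All.zipWith sep (ps , tx) ∷ lift ps ts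
      where
      sep : ∀ {t} → ¬ Connected C p t × ¬ Connected C _ t → ¬ Connected ((p , q) ∷ C) _ t
      sep (p≁t , x≁t) r with conn-∷⁻ r
      ... | inj₁ xt              = x≁t xt
      ... | inj₂ (inj₁ (xp , _)) = px (conn-sym xp)
      ... | inj₂ (inj₂ (_ , pt)) = p≁t pt
    ind : Independent (conn-isEquivalence {(p , q) ∷ C}) (T ─ ∈T)
    ind = lift p≁ ─ind
    cov : ∀ x → Any (Connected ((p , q) ∷ C) x) (T ─ ∈T)
    cov x with connected? C p x
    ... | yes px = Any.map (λ qt → conn-sym (conn-mono there px) ◅◅ ∈⇒conn (here refl) ◅◅ conn-mono there qt)
                     (─-Any ∈T (apart conn-isEquivalence p≁q) (represented C q))
    ... | no p≁x = Any.map (conn-mono there)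
                     (─-Any ∈T (apart conn-isEquivalence p≁x) (represented C x))

  no-edges : x ≢ y → ¬ Connected [] x y
  no-edges x≢y ε            = x≢y refl
  no-edges _   (fwd () ◅ _)
  no-edges _   (bwd () ◅ _)

  components-[] : components {v} [] ≡ v
  components-[] = trans
    (components-unique (AllPairs.map no-edges (Unique.allFin⁺ v))
                       (λ x → Any.map (λ { refl → ε }) (∈-allFin x)))
    (length-tabulate {n = v} id)

  connected⇒components≡1 : Fin v → (∀ x y → Connected C x y) → components C ≡ 1
  connected⇒components≡1 r conn =
    components-unique {T = r ∷ []} ([] ∷ []) (λ x → here (conn x r))

  components≡1⇒connected : components C ≡ 1 → ∀ x y → Connected C x y
  components≡1⇒connected {C} eq x y
    with representatives C | eq | represented C x | represented C y
  ... | t ∷ [] | _ | here xt | here yt = xt ◅◅ conn-sym yt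

  components-positive : Fin v → ∀ C → 1 ≤ components C
  components-positive r C with representatives C | represented C r
  ... | _ ∷ _ | _ = s≤s z≤n

  components-∷ : ∀ C p q → (Connected C p q × components ((p , q) ∷ C) ≡ components C)
                         ⊎ (¬ Connected C p q × components C ≡ suc (components ((p , q) ∷ C)))
  components-∷ C p q with connected? C p q
  ... | yes pq = inj₁ (pq , components-redundant pq)
  ... | no p≁q = inj₂ (p≁q , components-bridge p≁q)

  -- Each edge merges at most two classes. With empty `C` this makes the truncated subtraction in
  -- `nullity` exact; for general `C` it shows that no forest contains a loop.
  components-++-≤ : ∀ H → components C ≤ length H ℕ.+ components (H ++ C)
  components-++-≤ []            = ℕ.≤-refl
  components-++-≤ {C} ((x , y) ∷ H) with components-∷ (H ++ C) x y
  ... | inj₁ (_ , eq) rewrite eq = ℕ.≤-trans (components-++-≤ H) (ℕ.n≤1+n _)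
  ... | inj₂ (_ , eq) = ℕ.≤-trans (components-++-≤ H)
          (ℕ.≤-reflexive (trans (cong (length H ℕ.+_) eq) (ℕ.+-suc (length H) _)))

  components≤v : ∀ C → components C ≤ v
  components≤v C = subst (components C ≤_) (length-tabulate {n = v} id)
    (independent≤covering conn-isEquivalence (representatives-independent C)
      (All.universal (λ x → Any.map (λ { refl → ε }) (∈-allFin x)) _))

-- Finite sums and indicators

∑ : {A : Set} → List A → (A → ℤ) → ℤ
∑ xs f = foldr _+_ 0ℤ (map f xs)

module _ {A : Set} where

  ∑-++ : ∀ xs {ys} (f : A → ℤ) → ∑ (xs ++ ys) f ≡ ∑ xs f + ∑ ys f
  ∑-++ []       f = sym (ℤ.+-identityˡ _)
  ∑-++ (x ∷ xs) f = trans (cong (λ s → f x + s) (∑-++ xs f)) (sym (ℤ.+-assoc (f x) _ _))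

  ∑-map : ∀ {B : Set} (g : B → A) xs (f : A → ℤ) → ∑ (map g xs) f ≡ ∑ xs (f ∘ g)
  ∑-map g xs f = cong (foldr _+_ 0ℤ) (sym (map-∘ xs))

  ∑-cong-All : ∀ {xs} {f g : A → ℤ} → All (λ x → f x ≡ g x) xs → ∑ xs f ≡ ∑ xs g
  ∑-cong-All []       = refl
  ∑-cong-All (e ∷ es) = cong₂ _+_ e (∑-cong-All es)

  ∑-cong : ∀ xs {f g : A → ℤ} → (∀ x → f x ≡ g x) → ∑ xs f ≡ ∑ xs g
  ∑-cong xs f≗g = ∑-cong-All (All.universal f≗g xs)

  ∑-+ : ∀ xs (f g : A → ℤ) → ∑ xs (λ x → f x + g x) ≡ ∑ xs f + ∑ xs g
  ∑-+ []       f g = refl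
  ∑-+ (x ∷ xs) f g = trans (cong (λ s → f x + g x + s) (∑-+ xs f g)) (interchange (f x) (g x) _ _)
    where
    interchange : ∀ i j k l → i + j + (k + l) ≡ i + k + (j + l)
    interchange = solve-∀

  ∑-* : ∀ xs k (f : A → ℤ) → ∑ xs (λ x → k * f x) ≡ k * ∑ xs f
  ∑-* []       k f = sym (ℤ.*-zeroʳ k)
  ∑-* (x ∷ xs) k f = trans (cong (λ s → k * f x + s) (∑-* xs k f)) (sym (ℤ.*-distribˡ-+ k _ _))

𝟙 : {P : Set} → Dec P → ℤ
𝟙 P? = if does P? then 1ℤ else 0ℤ

module _ {P : Set} (P? : Dec P) where

  𝟙-yes : P → 𝟙 P? ≡ 1ℤ
  𝟙-yes p = cong (if_then 1ℤ else 0ℤ) (dec-true P? p)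

  𝟙-no : ¬ P → 𝟙 P? ≡ 0ℤ
  𝟙-no ¬p = cong (if_then 1ℤ else 0ℤ) (dec-false P? ¬p)

𝟙-⇔ : ∀ {P Q : Set} (P? : Dec P) (Q? : Dec Q) → (P → Q) → (Q → P) → 𝟙 P? ≡ 𝟙 Q?
𝟙-⇔ (yes p) Q? to from = sym (𝟙-yes Q? (to p))
𝟙-⇔ (no ¬p) Q? to from = sym (𝟙-no Q? (¬p ∘ from))

length-filter-∑ : ∀ {A : Set} {P : A → Set} (P? : U.Decidable P) xs →
                  + length (filter P? xs) ≡ ∑ xs (λ x → 𝟙 (P? x))
length-filter-∑ P? []       = refl
length-filter-∑ P? (x ∷ xs) with P? x
... | yes _ = cong (λ s → 1ℤ + s) (length-filter-∑ P? xs)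
... | no _  = trans (length-filter-∑ P? xs) (sym (ℤ.+-identityˡ _))

sgn : ℕ → ℤ
sgn k = -1ℤ ^ k

module _ {v : ℕ} where

  ∑-spanningSubgraphs-∷ : ∀ e (L : Graph v) f → ∑ (spanningSubgraphs (e ∷ L)) f ≡
    ∑ (spanningSubgraphs L) (f ∘ (e ∷_)) + ∑ (spanningSubgraphs L) f
  ∑-spanningSubgraphs-∷ e L f = trans (∑-++ (map (e ∷_) (spanningSubgraphs L)) f)
    (cong (_+ ∑ (spanningSubgraphs L) f) (∑-map (e ∷_) (spanningSubgraphs L) f))

  ∑-orientations-∷ : ∀ x y (L : Graph v) f → ∑ (orientations ((x , y) ∷ L)) f ≡
    ∑ (orientations L) (λ D → f ((x , y) ∷ D) + f ((y , x) ∷ D))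
  ∑-orientations-∷ x y L f = begin
    ∑ (orientations ((x , y) ∷ L)) f
      ≡⟨ ∑-++ (map ((x , y) ∷_) (orientations L)) f ⟩
    ∑ (map ((x , y) ∷_) (orientations L)) f + ∑ (map ((y , x) ∷_) (orientations L)) f
      ≡⟨ cong₂ _+_ (∑-map _ (orientations L) f) (∑-map _ (orientations L) f) ⟩
    ∑ (orientations L) (f ∘ ((x , y) ∷_)) + ∑ (orientations L) (f ∘ ((y , x) ∷_))
      ≡⟨ ∑-+ (orientations L) _ _ ⟨
    ∑ (orientations L) (λ D → f ((x , y) ∷ D) + f ((y , x) ∷ D)) ∎
    where open ≡-Reasoning

-- Acyclic root-connected orientations

module _ {v : ℕ} where

  private variable
    A B C D H : Graph v
    x y z w : Fin v

  -- Only arcs of the second digraph must avoid closed walks. The first will also contain contracted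
  -- edges, which form 2-cycles by themselves; what is expressed is acyclicity after contraction.
  AcyclicIn : Digraph v → Digraph v → Set
  AcyclicIn B = All (λ (u , w) → ¬ Reaches B w u)

  AcyclicRooted : Fin v → Digraph v → Digraph v → Set
  AcyclicRooted r A D = AcyclicIn (D ++ A) D × RootConnected r (D ++ A)

  acyclicRooted? : ∀ r A → U.Decidable (AcyclicRooted r A)
  acyclicRooted? r A D =
    All.all? (λ (u , w) → ¬? (reaches? (D ++ A) w u)) D ×-dec rootConnected? r (D ++ A)

  acyclicIn-antitone : (∀ {x y} → Reaches A x y → Reaches B x y) →
                       AcyclicIn B D → AcyclicIn A D
  acyclicIn-antitone A⇒B = All.map (λ ¬r → ¬r ∘ A⇒B)

  -- A closed walk through an arc of `D` that needs the new arc (x , y) would provide a path from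
  -- `y` to `x` without it.
  acyclicIn-∷ : ∀ D → AcyclicIn (D ++ A) D → ¬ Reaches (D ++ A) y x →
                AcyclicIn ((x , y) ∷ D ++ A) D
  acyclicIn-∷ {A} {y} {x} D α ¬yx = All.tabulate λ d∈D r → case d∈D (reach-∷⁻ r)
    where
    case : ∀ {u w} → (u , w) ∈ D →
           ¬ (Reaches (D ++ A) w u ⊎ (Reaches (D ++ A) w x × Reaches (D ++ A) y u))
    case d∈D (inj₁ wu)        = All.lookup α d∈D wu
    case d∈D (inj₂ (wx , yu)) = ¬yx (yu ◅◅ ∈-++⁺ˡ d∈D ◅ wx)

  acyclicIn-both : ∀ D → AcyclicIn (D ++ A) D →
                   ¬ Reaches (D ++ A) x y → ¬ Reaches (D ++ A) y x →
                   AcyclicIn ((x , y) ∷ (y , x) ∷ D ++ A) D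
  acyclicIn-both {A} {x} {y} D α ¬xy ¬yx = All.tabulate λ d∈D r → case d∈D (reach-both⁻ r)
    where
    case : ∀ {u w} → (u , w) ∈ D →
           ¬ (Reaches (D ++ A) w u ⊎ (Reaches (D ++ A) w x × Reaches (D ++ A) y u)
                                   ⊎ (Reaches (D ++ A) w y × Reaches (D ++ A) x u))
    case d∈D (inj₁ wu)               = All.lookup α d∈D wu
    case d∈D (inj₂ (inj₁ (wx , yu))) = ¬yx (yu ◅◅ ∈-++⁺ˡ d∈D ◅ wx)
    case d∈D (inj₂ (inj₂ (wy , xu))) = ¬xy (xu ◅◅ ∈-++⁺ˡ d∈D ◅ wy)

  reach-++⁻ : ∀ D → Reaches (D ++ A) x y → Reaches A x y ⊎
    (∃ λ u → ∃ λ w → (u , w) ∈ D × Reaches (D ++ A) x u × Reaches (D ++ A) w y)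
  reach-++⁻ D ε = inj₁ ε
  reach-++⁻ D (r ◅ rs) with ∈-++⁻ D r
  ... | inj₁ d∈D = inj₂ (_ , _ , d∈D , ε , rs)
  ... | inj₂ a∈A with reach-++⁻ D rs
  ...   | inj₁ zy                        = inj₁ (a∈A ◅ zy)
  ...   | inj₂ (_ , _ , d∈D , zu , wy) = inj₂ (_ , _ , d∈D , r ◅ zu , wy)

  -- A path from `x` to `y` has to use an arc of `D`, and a path back would put this arc on a closed
  -- walk.
  no-2-cycle : ∀ D → AcyclicIn (D ++ A) D → ¬ Reaches A x y →
               Reaches (D ++ A) x y → ¬ Reaches (D ++ A) y x
  no-2-cycle D α ¬xy xy yx with reach-++⁻ D xy
  ... | inj₁ xy′                     = ¬xy xy′
  ... | inj₂ (_ , _ , d∈D , xu , wy) = All.lookup α d∈D (wy ◅◅ yx ◅◅ xu)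

  contract-⊆ : ∀ D → (D ++ (x , y) ∷ (y , x) ∷ A) ⊆ ((x , y) ∷ (y , x) ∷ D ++ A)
  contract-⊆ D e with ++-∷-⊆ D e
  ... | here refl = here refl
  ... | there e′  = there (++-∷-⊆ D e′)

  contract-⊇ : ∀ D → ((x , y) ∷ (y , x) ∷ D ++ A) ⊆ (D ++ (x , y) ∷ (y , x) ∷ A)
  contract-⊇ D (here refl) = ++-∷-⊇ D (here refl)
  contract-⊇ D (there e)   = ++-∷-⊇ D (there (++-∷-⊇ D e))

  rooted-one-side : ∀ {r} → RootConnected r ((x , y) ∷ (y , x) ∷ B) → Reaches B r x →
                    RootConnected r ((x , y) ∷ B)
  rooted-one-side ρ rx z with reach-both⁻ (ρ z)
  ... | inj₁ rz              = reach-there rz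
  ... | inj₂ (inj₁ (_ , yz)) = reach-here rx yz
  ... | inj₂ (inj₂ (_ , xz)) = reach-there (rx ◅◅ xz)

  rooted-drop : ∀ {r} → RootConnected r ((x , y) ∷ B) → Reaches B r y → RootConnected r B
  rooted-drop ρ ry z with reach-∷⁻ (ρ z)
  ... | inj₁ rz       = rz
  ... | inj₂ (_ , yz) = ry ◅◅ yz

  -- Let `D` be acyclic relative to `D ++ A`. If `x` reaches `y`, only the arc (x , y) can be added;
  -- it creates no new reachability, and contraction closes a cycle, so one direction accounts for
  -- the deletion. The same holds with `x` and `y` exchanged. If neither reaches the other, all four
  -- digraphs are acyclic and the root decides. If it reaches everything in `D ++ A`, all four terms
  -- are 1. If it does so only after contraction, it reaches exactly one of `x` and `y` beforehand,
  -- and the arc must point away from that end.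
  acyclicRooted-deletion-contraction : ∀ r A {x y} →
    ¬ Reaches A x y → ¬ Reaches A y x → ∀ D →
    (xyD? : Dec (AcyclicRooted r A ((x , y) ∷ D)))
    (yxD? : Dec (AcyclicRooted r A ((y , x) ∷ D)))
    (del? : Dec (AcyclicRooted r A D))
    (con? : Dec (AcyclicRooted r ((x , y) ∷ (y , x) ∷ A) D)) →
    𝟙 xyD? + 𝟙 yxD? ≡ 𝟙 del? + 𝟙 con?
  acyclicRooted-deletion-contraction r A {x} {y} ¬xyA ¬yxA D xyD? yxD? del? con? = main
    where
    E A′ : Digraph v
    E = D ++ A
    A′ = (x , y) ∷ (y , x) ∷ A

    Equation : Set
    Equation = 𝟙 xyD? + 𝟙 yxD? ≡ 𝟙 del? + 𝟙 con?

    values : ∀ {i j k l} → 𝟙 xyD? ≡ i → 𝟙 yxD? ≡ j → 𝟙 del? ≡ k → 𝟙 con? ≡ l →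
             i + j ≡ k + l → Equation
    values p q r s eq = trans (cong₂ _+_ p q) (trans eq (sym (cong₂ _+_ r s)))

    toCon : Reaches ((x , y) ∷ (y , x) ∷ E) z w → Reaches (D ++ A′) z w
    toCon = reach-mono (contract-⊇ D)
    fromCon : Reaches (D ++ A′) z w → Reaches ((x , y) ∷ (y , x) ∷ E) z w
    fromCon = reach-mono (contract-⊆ D)
    lift : Reaches E z w → Reaches (D ++ A′) z w
    lift = toCon ∘ reach-there ∘ reach-there

    con⇒acyclic : AcyclicIn (D ++ A′) D → AcyclicIn E D
    con⇒acyclic = acyclicIn-antitone lift

    con⇒¬xy : AcyclicIn (D ++ A′) D → ¬ Reaches E x y
    con⇒¬xy α xy with reach-++⁻ D xy
    ... | inj₁ xyA = ¬xyA xyA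
    ... | inj₂ (_ , _ , d∈D , xu , wy) =
      All.lookup α d∈D (lift wy ◅◅ toCon (there (here refl) ◅ ε) ◅◅ lift xu)

    con⇒¬yx : AcyclicIn (D ++ A′) D → ¬ Reaches E y x
    con⇒¬yx α yx with reach-++⁻ D yx
    ... | inj₁ yxA = ¬yxA yxA
    ... | inj₂ (_ , _ , d∈D , yu , wx) =
      All.lookup α d∈D (lift wx ◅◅ toCon (here refl ◅ ε) ◅◅ lift yu)

    xyD-intro : AcyclicIn E D → ¬ Reaches E y x → RootConnected r ((x , y) ∷ E) →
                AcyclicRooted r A ((x , y) ∷ D)
    xyD-intro α ¬yx ρ = ((¬yx ∘ reach-from-head) ∷ acyclicIn-∷ D α ¬yx) , ρ
    yxD-intro : AcyclicIn E D → ¬ Reaches E x y → RootConnected r ((y , x) ∷ E) →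
                AcyclicRooted r A ((y , x) ∷ D)
    yxD-intro α ¬xy ρ = ((¬xy ∘ reach-from-head) ∷ acyclicIn-∷ D α ¬xy) , ρ
    xyD⇒¬yx : AcyclicRooted r A ((x , y) ∷ D) → ¬ Reaches E y x
    xyD⇒¬yx ((¬yx ∷ _) , _) = ¬yx ∘ reach-there
    yxD⇒¬xy : AcyclicRooted r A ((y , x) ∷ D) → ¬ Reaches E x y
    yxD⇒¬xy ((¬xy ∷ _) , _) = ¬xy ∘ reach-there

    main : Equation
    main with All.all? (λ (u , w) → ¬? (reaches? E w u)) D | reaches? E x y | reaches? E y x
    ... | no ¬α | _ | _ = values
      (𝟙-no xyD? λ { ((_ ∷ α) , _) → ¬α (acyclicIn-antitone reach-there α) })
      (𝟙-no yxD? λ { ((_ ∷ α) , _) → ¬α (acyclicIn-antitone reach-there α) })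
      (𝟙-no del? λ (α , _) → ¬α α)
      (𝟙-no con? λ (α , _) → ¬α (con⇒acyclic α))
      refl
    ... | yes α | yes xy | _ = values
      (𝟙-⇔ xyD? del? (λ (_ , ρ) → α , λ z → [ id , (λ (rx , yz) → rx ◅◅ xy ◅◅ yz) ]′ (reach-∷⁻ (ρ z)))
                     (λ (_ , ρ) → xyD-intro α (no-2-cycle D α ¬xyA xy) (reach-there ∘ ρ)))
      (𝟙-no yxD? λ π → yxD⇒¬xy π xy)
      refl
      (𝟙-no con? λ (α , _) → con⇒¬xy α xy)
      refl
    ... | yes α | no ¬xy | yes yx = values
      (𝟙-no xyD? λ π → xyD⇒¬yx π yx)
      (𝟙-⇔ yxD? del? (λ (_ , ρ) → α , λ z → [ id , (λ (ry , xz) → ry ◅◅ yx ◅◅ xz) ]′ (reach-∷⁻ (ρ z)))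
                     (λ (_ , ρ) → yxD-intro α ¬xy (reach-there ∘ ρ)))
      refl
      (𝟙-no con? λ (α , _) → con⇒¬yx α yx)
      (ℤ.+-comm 0ℤ (𝟙 del?))
    ... | yes α | no ¬xy | no ¬yx
      with rootConnected? r E | rootConnected? r ((x , y) ∷ (y , x) ∷ E)
    ...   | yes ρ | _ = values
      (𝟙-yes xyD? (xyD-intro α ¬yx (reach-there ∘ ρ)))
      (𝟙-yes yxD? (yxD-intro α ¬xy (reach-there ∘ ρ)))
      (𝟙-yes del? (α , ρ))
      (𝟙-yes con? (acyclicIn-antitone fromCon (acyclicIn-both D α ¬xy ¬yx) , lift ∘ ρ))
      refl
    ...   | no ¬ρ | no ¬ρ′ = values
      (𝟙-no xyD? λ (_ , ρ) → ¬ρ′ (reach-mono ∷-insert-⊆ ∘ ρ))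
      (𝟙-no yxD? λ (_ , ρ) → ¬ρ′ (reach-there ∘ ρ))
      (𝟙-no del? (¬ρ ∘ proj₂))
      (𝟙-no con? λ (_ , ρ) → ¬ρ′ (fromCon ∘ ρ))
      refl
    ...   | no ¬ρ | yes ρ′ with reaches? E r x
    ...     | yes rx = values
      (𝟙-yes xyD? (xyD-intro α ¬yx (rooted-one-side ρ′ rx)))
      (𝟙-no yxD? λ (_ , ρ) → ¬ρ (rooted-drop ρ rx))
      (𝟙-no del? (¬ρ ∘ proj₂))
      (𝟙-yes con? (acyclicIn-antitone fromCon (acyclicIn-both D α ¬xy ¬yx) , toCon ∘ ρ′))
      refl
    ...     | no ¬rx = values
      (𝟙-no xyD? λ (_ , ρ) → ¬ρ (rooted-drop ρ ry))
      (𝟙-yes yxD? (yxD-intro α ¬xy (rooted-one-side (reach-mono ∷-swap-⊆ ∘ ρ′) ry)))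
      (𝟙-no del? (¬ρ ∘ proj₂))
      (𝟙-yes con? (acyclicIn-antitone fromCon (acyclicIn-both D α ¬xy ¬yx) , toCon ∘ ρ′))
      refl
      where
      ry : Reaches E r y
      ry with reach-both⁻ (ρ′ y)
      ... | inj₁ ry              = ry
      ... | inj₂ (inj₁ (rx , _)) = contradiction rx ¬rx
      ... | inj₂ (inj₂ (ry , _)) = ry

  components-insert : ∀ H {x y} → components ((x , y) ∷ H ++ C) ≡ components (H ++ (x , y) ∷ C)
  components-insert {C} H {x} {y} = components-resp-⊆ (++-∷-⊇ H) (++-∷-⊆ H)

  -- For connected `L ++ C` this is, up to sign, the value at (1,0) of the Tutte polynomial of
  -- `L ++ C` with the edges of `C` contracted.
  connectedSum : Graph v → Graph v → ℤ
  connectedSum C L = ∑ (spanningSubgraphs L) λ H →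
    sgn (length H) * 𝟙 (components (H ++ C) ℕ.≟ 1)

  connectedSum-∷ : ∀ C L {x y} → connectedSum C ((x , y) ∷ L) ≡
                   - connectedSum ((x , y) ∷ C) L + connectedSum C L
  connectedSum-∷ C L {x} {y} = begin
    connectedSum C ((x , y) ∷ L)
      ≡⟨ ∑-spanningSubgraphs-∷ (x , y) L _ ⟩
    ∑ (spanningSubgraphs L) (λ H → -1ℤ * sgn (length H) * 𝟙 (components ((x , y) ∷ H ++ C) ℕ.≟ 1)) + connectedSum C L
      ≡⟨ cong (_+ connectedSum C L) (∑-cong (spanningSubgraphs L) step) ⟩
    ∑ (spanningSubgraphs L) (λ H → -1ℤ * (sgn (length H) * 𝟙 (components (H ++ (x , y) ∷ C) ℕ.≟ 1))) + connectedSum C L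
      ≡⟨ cong (_+ connectedSum C L) (trans (∑-* (spanningSubgraphs L) -1ℤ _) (ℤ.-1*i≡-i _)) ⟩
    - connectedSum ((x , y) ∷ C) L + connectedSum C L ∎
    where
    open ≡-Reasoning
    step : ∀ H → -1ℤ * sgn (length H) * 𝟙 (components ((x , y) ∷ H ++ C) ℕ.≟ 1) ≡
                 -1ℤ * (sgn (length H) * 𝟙 (components (H ++ (x , y) ∷ C) ℕ.≟ 1))
    step H rewrite components-insert {C} H {x} {y} = ℤ.*-assoc -1ℤ (sgn (length H)) _

  -- In `connectedSum-∷` the two terms then cancel: a loop changes the sign of a subgraph but not
  -- its connectedness. This matches the absence of acyclic orientations.
  connectedSum-loop : ∀ C L {x y} → Connected C x y → connectedSum ((x , y) ∷ C) L ≡ connectedSum C L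
  connectedSum-loop C L {x} {y} xy = ∑-cong (spanningSubgraphs L) λ H →
    cong (λ k → sgn (length H) * 𝟙 (k ℕ.≟ 1))
      (trans (sym (components-insert H))
             (components-redundant (conn-mono (∈-++⁺ʳ H) xy)))

  -- Deletion–contraction: the arcs of both C stand for contracted edges, and the
  -- count splits orientation by orientation of the remaining edges.
  acyclicRooted-sum : ∀ r C L →
    ∑ (orientations L) (λ D → 𝟙 (acyclicRooted? r (both C) D)) ≡
    sgn (suc (components C)) * connectedSum C L
  acyclicRooted-sum r C [] = base (components C) (acyclicRooted? r (both C) [])
    (λ (_ , ρ) → connected⇒components≡1 r λ x y → conn-sym (reach⇒conn (ρ x)) ◅◅ reach⇒conn (ρ y))
    (λ c≡1 → [] , λ x → conn⇒reach (components≡1⇒connected c≡1 r x))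
    where
    base : ∀ {P : Set} k (P? : Dec P) → (P → k ≡ 1) → (k ≡ 1 → P) →
           𝟙 P? + 0ℤ ≡ sgn (suc k) * (1ℤ * 𝟙 (k ℕ.≟ 1) + 0ℤ)
    base k (yes p) to from rewrite to p = refl
    base k (no ¬p) to from rewrite 𝟙-no (k ℕ.≟ 1) (¬p ∘ from) = sym (ℤ.*-zeroʳ (sgn (suc k)))
  acyclicRooted-sum r C ((x , y) ∷ L) with components-∷ C x y
  ... | inj₁ (xy , _) = begin
    ∑ (orientations ((x , y) ∷ L)) f
      ≡⟨ ∑-orientations-∷ x y L f ⟩
    ∑ (orientations L) (λ D → f ((x , y) ∷ D) + f ((y , x) ∷ D))
      ≡⟨ ∑-cong (orientations L) (λ D → cong₂ _+_
           (𝟙-no (acyclicRooted? r (both C) ((x , y) ∷ D)) (loop (conn-sym xy)))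
           (𝟙-no (acyclicRooted? r (both C) ((y , x) ∷ D)) (loop xy))) ⟩
    -- The summand 0ℤ + 0ℤ is read as a product, equal to it by computation, so that `∑-*` shows the
    -- sum to vanish.
    ∑ (orientations L) (λ D → 0ℤ * 0ℤ)
      ≡⟨ ∑-* (orientations L) 0ℤ (λ _ → 0ℤ) ⟩
    0ℤ * ∑ (orientations L) (λ _ → 0ℤ)
      ≡⟨ cancel s (connectedSum C L) ⟩
    s * (- connectedSum C L + connectedSum C L)
      ≡⟨ cong (λ t → s * (- t + connectedSum C L)) (connectedSum-loop C L xy) ⟨
    s * (- connectedSum ((x , y) ∷ C) L + connectedSum C L)
      ≡⟨ cong (s *_) (connectedSum-∷ C L) ⟨
    s * connectedSum C ((x , y) ∷ L) ∎
    where
    open ≡-Reasoning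
    f : Digraph v → ℤ
    f D = 𝟙 (acyclicRooted? r (both C) D)
    s : ℤ
    s = sgn (suc (components C))
    loop : ∀ {x y D} → Connected C y x → ¬ AcyclicRooted r (both C) ((x , y) ∷ D)
    loop {D = D} yx ((¬yx ∷ _) , _) = ¬yx (reach-there (reach-mono (∈-++⁺ʳ D) (conn⇒reach yx)))
    cancel : ∀ s t → 0ℤ ≡ s * (- t + t)
    cancel = solve-∀
  ... | inj₂ (¬xy , eq) = begin
    ∑ (orientations ((x , y) ∷ L)) f
      ≡⟨ ∑-orientations-∷ x y L f ⟩
    ∑ (orientations L) (λ D → f ((x , y) ∷ D) + f ((y , x) ∷ D))
      ≡⟨ ∑-cong (orientations L) (λ D → acyclicRooted-deletion-contraction r (both C)
           (¬xy ∘ reach⇒conn) (¬xy ∘ conn-sym ∘ reach⇒conn) D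
           (acyclicRooted? r (both C) ((x , y) ∷ D)) (acyclicRooted? r (both C) ((y , x) ∷ D))
           (acyclicRooted? r (both C) D) (acyclicRooted? r (both ((x , y) ∷ C)) D)) ⟩
    ∑ (orientations L) (λ D → f D + f′ D)
      ≡⟨ ∑-+ (orientations L) f f′ ⟩
    ∑ (orientations L) f + ∑ (orientations L) f′
      ≡⟨ cong₂ _+_ (acyclicRooted-sum r C L) (acyclicRooted-sum r ((x , y) ∷ C) L) ⟩
    sgn (suc (components C)) * connectedSum C L + sgn (suc k) * connectedSum ((x , y) ∷ C) L
      -- Contraction costs one component, so the two terms carry opposite signs, as they do in
      -- `connectedSum-∷`.
      ≡⟨ cong (λ j → sgn (suc j) * connectedSum C L + sgn (suc k) * connectedSum ((x , y) ∷ C) L) eq ⟩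
    -1ℤ * sgn (suc k) * connectedSum C L + sgn (suc k) * connectedSum ((x , y) ∷ C) L
      ≡⟨ regroup (sgn (suc k)) (connectedSum C L) (connectedSum ((x , y) ∷ C) L) ⟩
    sgn (suc (suc k)) * (- connectedSum ((x , y) ∷ C) L + connectedSum C L)
      ≡⟨ cong₂ (λ j t → sgn (suc j) * t) (sym eq) (sym (connectedSum-∷ C L)) ⟩
    sgn (suc (components C)) * connectedSum C ((x , y) ∷ L) ∎
    where
    open ≡-Reasoning
    k : ℕ
    k = components ((x , y) ∷ C)
    f f′ : Digraph v → ℤ
    f D = 𝟙 (acyclicRooted? r (both C) D)
    f′ D = 𝟙 (acyclicRooted? r (both ((x , y) ∷ C)) D)
    regroup : ∀ s t u → -1ℤ * s * t + s * u ≡ -1ℤ * s * (- u + t)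
    regroup = solve-∀

  acyclicIn⇔acyclic : ∀ D → (AcyclicIn D D → Acyclic D) × (Acyclic D → AcyclicIn D D)
  acyclicIn⇔acyclic D = (λ α x p → split α p) , λ α → All.tabulate λ d∈D wu → α _ (join d∈D wu)
    where
    weaken : TransClosure (Arc D) x y → Reaches D x y
    weaken [ d ]   = d ◅ ε
    weaken (d ∷ p) = d ◅ weaken p
    split : AcyclicIn D D → ¬ TransClosure (Arc D) x x
    split α [ d ]   = All.lookup α d ε
    split α (d ∷ p) = All.lookup α d (weaken p)
    join : (x , y) ∈ D → Reaches D y z → TransClosure (Arc D) x z
    join d ε        = [ d ]
    join d (e ◅ es) = d ∷ join e es

  #acyclicRootConnected-sum : ∀ (L : Graph v) r →
    + #acyclicRootConnected L r ≡ sgn (suc v) * connectedSum [] L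
  #acyclicRootConnected-sum L r = begin
    + #acyclicRootConnected L r
      ≡⟨ length-filter-∑ _ (orientations L) ⟩
    ∑ (orientations L) (λ D → 𝟙 (acyclic? D ×-dec rootConnected? r D))
      ≡⟨ ∑-cong (orientations L) (λ D → 𝟙-⇔ (acyclic? D ×-dec rootConnected? r D) (acyclicRooted? r [] D)
           (λ (α , ρ) → to D α ρ) (λ (α , ρ) → from D α ρ)) ⟩
    ∑ (orientations L) (λ D → 𝟙 (acyclicRooted? r [] D))
      ≡⟨ acyclicRooted-sum r [] L ⟩
    sgn (suc (components {v} [])) * connectedSum [] L
      ≡⟨ cong (λ k → sgn (suc k) * connectedSum [] L) (components-[] {v}) ⟩
    sgn (suc v) * connectedSum [] L ∎
    where
    open ≡-Reasoning
    to : ∀ D → Acyclic D → RootConnected r D → AcyclicRooted r [] D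
    to D α ρ = subst (λ B → AcyclicIn B D × RootConnected r B) (sym (++-identityʳ D))
                 (acyclicIn⇔acyclic D .proj₂ α , ρ)
    from : ∀ D → AcyclicIn (D ++ []) D → RootConnected r (D ++ []) → Acyclic D × RootConnected r D
    from D α ρ with α′ , ρ′ ← subst (λ B → AcyclicIn B D × RootConnected r B) (++-identityʳ D) (α , ρ)
      = acyclicIn⇔acyclic D .proj₁ α′ , ρ′

-- Strongly connected orientations

module _ {v : ℕ} where

  private variable
    A B C D H L : Graph v
    x y z z′ w : Fin v
    e : Fin v × Fin v

  _≟ᵃ_ : DecidableEquality (Fin v × Fin v)
  _≟ᵃ_ = ×.≡-dec Fin._≟_ Fin._≟_

  -- Compared position by position: parallel edges are oriented independently, and an orientation
  -- inherits the order of the edges, on which `Minimal` depends.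
  Orients : Graph v → Digraph v → Set
  Orients = Pointwise (λ e d → d ≡ e ⊎ d ≡ swap e)

  orientations-sound : ∀ L → All (Orients L) (orientations L)
  orientations-sound []            = [] ∷ []
  orientations-sound ((x , y) ∷ L) = All.++⁺
    (All.map⁺ (All.map (inj₁ refl ∷_) (orientations-sound L)))
    (All.map⁺ (All.map (inj₂ refl ∷_) (orientations-sound L)))

  spanningSubgraphs-sound : ∀ L → H ∈ spanningSubgraphs L → H ⊆ L
  spanningSubgraphs-sound []      (here refl) ()
  spanningSubgraphs-sound (e ∷ L) H∈ h with ∈-++⁻ (map (e ∷_) (spanningSubgraphs L)) H∈
  ... | inj₂ H∈L = there (spanningSubgraphs-sound L H∈L h)
  ... | inj₁ H∈e with ∈-map⁻ (e ∷_) H∈e | h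
  ...   | _ , H∈L , refl | here refl = here refl
  ...   | _ , H∈L , refl | there h′  = there (spanningSubgraphs-sound L H∈L h′)

  orients-∈⁻ : Orients L D → (x , y) ∈ D → SymClosure (λ x y → (x , y) ∈ L) x y
  orients-∈⁻ (inj₁ refl ∷ o) (here refl) = fwd (here refl)
  orients-∈⁻ (inj₂ refl ∷ o) (here refl) = bwd (here refl)
  orients-∈⁻ (_ ∷ o)         (there d)   = Sym.map there (orients-∈⁻ o d)

  orients-∈⁺ : Orients L D → (x , y) ∈ L → SymClosure (λ x y → (x , y) ∈ D) x y
  orients-∈⁺ (inj₁ refl ∷ o) (here refl) = fwd (here refl)
  orients-∈⁺ (inj₂ refl ∷ o) (here refl) = bwd (here refl)
  orients-∈⁺ (_ ∷ o)         (there e)   = Sym.map there (orients-∈⁺ o e)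

  orients-reach⇒conn : Orients L D → Reaches (D ++ both C) x y → Connected (L ++ C) x y
  orients-reach⇒conn {L} {D} {C} o = Star.map step
    where
    step : (x , y) ∈ D ++ both C → SymClosure (λ x y → (x , y) ∈ L ++ C) x y
    step e with ∈-++⁻ D e
    ... | inj₁ d = Sym.map ∈-++⁺ˡ (orients-∈⁻ o d)
    ... | inj₂ c = Sym.map (∈-++⁺ʳ L) (∈-both⁻ C c)

  orients-conn : Orients L D → Connected (L ++ C) x y → Connected (D ++ both C) x y
  orients-conn {L} {D} {C} o = Eq.join ∘ Eq.map step
    where
    step : (x , y) ∈ L ++ C → Connected (D ++ both C) x y
    step e with ∈-++⁻ L e
    ... | inj₁ l = Sym.map ∈-++⁺ˡ (orients-∈⁺ o l) ◅ ε
    ... | inj₂ c = fwd (∈-++⁺ʳ D (∈-both⁺ (fwd c))) ◅ ε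

  -- Edges decrease along L and lie below those of A. Each arc d is compared with its
  -- edge (x , y) as given by L, the reference direction: in a minimal orientation the
  -- least edge of every directed cycle has its reference direction.
  Minimal : Digraph v → Graph v → Digraph v → Set
  Minimal A []            D       = ⊤
  Minimal A (_ ∷ _)       []      = ⊤
  Minimal A ((x , y) ∷ L) (d ∷ D) = (d ≡ (y , x) → ¬ Reaches A x y) × Minimal (d ∷ A) L D

  minimal? : ∀ A L D → Dec (Minimal A L D)
  minimal? A []            D       = yes tt
  minimal? A (_ ∷ _)       []      = yes tt
  minimal? A ((x , y) ∷ L) (d ∷ D) =
    (d ≟ᵃ (y , x) →-dec ¬? (reaches? A x y)) ×-dec minimal? (d ∷ A) L D

  minimal-antitone : (∀ {x y} → Reaches A x y → Reaches B x y) →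
                     ∀ L {D} → Minimal B L D → Minimal A L D
  minimal-antitone A⇒B []      m = tt
  minimal-antitone A⇒B (_ ∷ L) {[]}    m = tt
  minimal-antitone A⇒B (_ ∷ L) {d ∷ D} (h , m) =
    (λ flipped → h flipped ∘ A⇒B) , minimal-antitone (reach-∷-cong A⇒B) L m

  minimal-swap : ∀ L {e f} → Minimal (e ∷ f ∷ A) L D → Minimal (f ∷ e ∷ A) L D
  minimal-swap L = minimal-antitone (reach-mono ∷-swap-⊆) L

  -- By `reach-both⁻` a path needs at most one of the two opposite arcs, so a violation in the
  -- presence of both already occurs with one of them.
  minimal-both : ∀ L D → Minimal ((x , y) ∷ A) L D → Minimal ((y , x) ∷ A) L D →
                 Minimal ((x , y) ∷ (y , x) ∷ A) L D
  minimal-both []            D       _ _ = tt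
  minimal-both (_ ∷ _)       []      _ _ = tt
  minimal-both {x} {y} {A} ((u , w) ∷ L) (d ∷ D) (h₁ , m₁) (h₂ , m₂) =
    (λ flipped → λ r → head flipped (reach-both⁻ r)) ,
    minimal-antitone (reach-mono shuffle) L
      (minimal-both L D (minimal-swap L m₁) (minimal-swap L m₂))
    where
    head : d ≡ (w , u) → ¬ (Reaches A u w ⊎ (Reaches A u x × Reaches A y w)
                                           ⊎ (Reaches A u y × Reaches A x w))
    head flipped (inj₁ uw)               = h₁ flipped (reach-there uw)
    head flipped (inj₂ (inj₁ (ux , yw))) = h₁ flipped (reach-here ux yw)
    head flipped (inj₂ (inj₂ (uy , xw))) = h₂ flipped (reach-here uy xw)
    shuffle : (d ∷ (x , y) ∷ (y , x) ∷ A) ⊆ ((x , y) ∷ (y , x) ∷ d ∷ A)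
    shuffle (here refl)                 = there (there (here refl))
    shuffle (there (here refl))         = here refl
    shuffle (there (there (here refl))) = there (here refl)
    shuffle (there (there (there e)))   = there (there (there e))

  -- If the least edge of a cycle through (x , y) is misdirected, then that edge
  -- provides a path from y to x, and (y , x) creates no new reachability.
  minimal-either : ∀ L D → Minimal A L D →
                   Minimal ((x , y) ∷ A) L D ⊎ Minimal ((y , x) ∷ A) L D
  minimal-either []      D  _ = inj₁ tt
  minimal-either (_ ∷ _) [] _ = inj₁ tt
  minimal-either {A} ((u , w) ∷ L) (d ∷ D) (h , m) =
    [ extend , Sum.swap ∘ extend ]′ (minimal-either L D m)
    where
    extend : Minimal ((x , y) ∷ d ∷ A) L D →
             Minimal ((x , y) ∷ A) ((u , w) ∷ L) (d ∷ D) ⊎ Minimal ((y , x) ∷ A) ((u , w) ∷ L) (d ∷ D)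
    extend {x} {y} m′ with d ≟ᵃ (w , u) | reaches? ((x , y) ∷ A) u w
    ... | no ¬flipped | _        = inj₁ ((λ flipped → contradiction flipped ¬flipped) , minimal-swap L m′)
    ... | _           | no ¬uw   = inj₁ ((λ _ → ¬uw) , minimal-swap L m′)
    ... | yes refl    | yes uw with reach-∷⁻ uw
    ...   | inj₁ uwA       = contradiction uwA (h refl)
    ...   | inj₂ (ux , yw) = inj₂ ((λ _ → ¬uw) , minimal-antitone
              (reach-redundant (reach-there yw ◅◅ here refl ◅ reach-there ux) ∘ reach-mono ∷-swap-⊆) L m)
      where
      ¬uw : ¬ Reaches ((y , x) ∷ A) u w
      ¬uw r = [ h refl , (λ (_ , xw) → h refl (ux ◅◅ xw)) ]′ (reach-∷⁻ r)

  -- A violation that uses (y , x) is a directed cycle through this arc; the rest of the cycle is a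
  -- path from `x` to `y` in `D ++ A`.
  minimal-∷ : ∀ L D → ¬ Reaches (D ++ A) x y → Minimal A L D → Minimal ((y , x) ∷ A) L D
  minimal-∷ []      D  _ _ = tt
  minimal-∷ (_ ∷ _) [] _ _ = tt
  minimal-∷ {A} {x} {y} ((u , w) ∷ L) (d ∷ D) ¬xy (h , m) =
    head , minimal-swap L (minimal-∷ L D (¬xy ∘ reach-mono (++-∷-⊆ D)) m)
    where
    lift : Reaches A z z′ → Reaches (d ∷ D ++ A) z z′
    lift = reach-there ∘ reach-mono (∈-++⁺ʳ D)
    head : d ≡ (w , u) → ¬ Reaches ((y , x) ∷ A) u w
    head refl r = [ h refl , (λ (uy , xw) → ¬xy (lift xw ◅◅ here refl ◅ lift uy)) ]′ (reach-∷⁻ r)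

  MinimalStrong : Digraph v → Graph v → Digraph v → Set
  MinimalStrong A L D = Minimal A L D × StronglyConnected (D ++ A)

  minimalStrong? : ∀ A L D → Dec (MinimalStrong A L D)
  minimalStrong? A L D = minimal? A L D ×-dec stronglyConnected? (D ++ A)

  -- Along an undirected walk from x to y, some edge joins a vertex reachable from x
  -- to one reachable from y.
  nonbridge-reach : StronglyConnected ((x , y) ∷ (y , x) ∷ B) → Connected B x y →
                    Reaches B x y ⊎ Reaches B y x
  nonbridge-reach {x} {y} {B} σ = walk ε
    where
    out : ∀ z → Reaches B x z ⊎ Reaches B y z
    out z with reach-both⁻ (σ x z)
    ... | inj₁ xz              = inj₁ xz
    ... | inj₂ (inj₁ (_ , yz)) = inj₂ yz
    ... | inj₂ (inj₂ (_ , xz)) = inj₁ xz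
    into : ∀ z → Reaches B z x ⊎ Reaches B z y
    into z with reach-both⁻ (σ z x)
    ... | inj₁ zx              = inj₁ zx
    ... | inj₂ (inj₁ (zx , _)) = inj₁ zx
    ... | inj₂ (inj₂ (zy , _)) = inj₂ zy
    walk : Reaches B x z → Connected B z y → Reaches B x y ⊎ Reaches B y x
    walk xz ε = inj₁ xz
    walk xz (fwd e ◅ rest) = walk (xz ◅◅ e ◅ ε) rest
    walk {z} xz (_◅_ {j = z′} (bwd e) rest) with out z′
    ... | inj₁ xz′ = walk xz′ rest
    ... | inj₂ yz′ with into z
    ...   | inj₁ zx = inj₂ (yz′ ◅◅ e ◅ zx)
    ...   | inj₂ zy = inj₁ (xz ◅◅ zy)

  -- If the deletion is strongly connected, so are the other three digraphs, and the equation is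
  -- inclusion and exclusion over the two directions: minimality after deletion means minimality for
  -- at least one direction (`minimal-either`), after contraction for both (`minimal-both`). If only
  -- the contraction is strongly connected, `nonbridge-reach` gives a path between `x` and `y` in
  -- one direction, and just the arc closing it to a cycle makes the digraph strong. There is no
  -- path the other way, so by `minimal-∷` minimality for this arc is minimality for the
  -- contraction.
  minimalStrong-deletion-contraction : ∀ A L D {x y} →
    ¬ Reaches A x y → ¬ Reaches A y x → Connected (D ++ A) x y →
    (xyD? : Dec (MinimalStrong A ((x , y) ∷ L) ((x , y) ∷ D)))
    (yxD? : Dec (MinimalStrong A ((x , y) ∷ L) ((y , x) ∷ D)))
    (del? : Dec (MinimalStrong A L D))
    (con? : Dec (MinimalStrong ((x , y) ∷ (y , x) ∷ A) L D)) →
    𝟙 xyD? + 𝟙 yxD? ≡ 𝟙 del? + 𝟙 con?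
  minimalStrong-deletion-contraction A L D {x} {y} ¬xyA ¬yxA conn xyD? yxD? del? con? = main
    where
    E A′ : Digraph v
    E = D ++ A
    A′ = (x , y) ∷ (y , x) ∷ A

    Equation : Set
    Equation = 𝟙 xyD? + 𝟙 yxD? ≡ 𝟙 del? + 𝟙 con?

    values : ∀ {i j k l} → 𝟙 xyD? ≡ i → 𝟙 yxD? ≡ j → 𝟙 del? ≡ k → 𝟙 con? ≡ l →
             i + j ≡ k + l → Equation
    values p q r s eq = trans (cong₂ _+_ p q) (trans eq (sym (cong₂ _+_ r s)))

    toCon : Reaches ((x , y) ∷ (y , x) ∷ E) z w → Reaches (D ++ A′) z w
    toCon = reach-mono (contract-⊇ D)
    fromCon : Reaches (D ++ A′) z w → Reaches ((x , y) ∷ (y , x) ∷ E) z w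
    fromCon = reach-mono (contract-⊆ D)

    xy⇒del : Minimal ((x , y) ∷ A) L D → Minimal A L D
    xy⇒del = minimal-antitone reach-there L
    yx⇒del : Minimal ((y , x) ∷ A) L D → Minimal A L D
    yx⇒del = minimal-antitone reach-there L
    con⇒xy : Minimal A′ L D → Minimal ((x , y) ∷ A) L D
    con⇒xy = minimal-antitone (reach-mono ∷-insert-⊆) L
    con⇒yx : Minimal A′ L D → Minimal ((y , x) ∷ A) L D
    con⇒yx = minimal-antitone reach-there L

    main : Equation
    main with stronglyConnected? E | stronglyConnected? ((x , y) ∷ (y , x) ∷ E)
    ... | no ¬σ | no ¬σ′ = values
      (𝟙-no xyD? λ (_ , σ) → ¬σ′ λ z w → reach-mono ∷-insert-⊆ (σ z w))
      (𝟙-no yxD? λ (_ , σ) → ¬σ′ λ z w → reach-there (σ z w))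
      (𝟙-no del? (¬σ ∘ proj₂))
      (𝟙-no con? λ (_ , σ) → ¬σ′ λ z w → fromCon (σ z w))
      refl
    ... | no ¬σ | yes σ′ with nonbridge-reach σ′ conn
    ...   | inj₂ yx = values
      (𝟙-⇔ xyD? con?
        (λ ((_ , m) , σ) → minimal-both L D m (minimal-∷ L D ¬xy (xy⇒del m)) , λ z w → toCon (σ′ z w))
        (λ (m , _) → ((λ _ → ¬xyA) , con⇒xy m) ,
           λ z w → reach-redundant (reach-there yx) (reach-mono ∷-swap-⊆ (σ′ z w))))
      (𝟙-no yxD? λ (_ , σ) → ¬σ λ z w → reach-redundant yx (σ z w))
      (𝟙-no del? (¬σ ∘ proj₂))
      refl
      (ℤ.+-comm (𝟙 con?) 0ℤ)
      where
      ¬xy : ¬ Reaches E x y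
      ¬xy xy = ¬σ λ z w → reach-redundant yx (reach-redundant (reach-there xy) (σ′ z w))
    ...   | inj₁ xy = values
      (𝟙-no xyD? λ (_ , σ) → ¬σ λ z w → reach-redundant xy (σ z w))
      (𝟙-⇔ yxD? con?
        (λ ((_ , m) , σ) → minimal-both L D (minimal-∷ L D ¬yx (yx⇒del m)) m , λ z w → toCon (σ′ z w))
        (λ (m , _) → ((λ _ → ¬xyA) , con⇒yx m) ,
           λ z w → reach-redundant (reach-there xy) (σ′ z w)))
      (𝟙-no del? (¬σ ∘ proj₂))
      refl
      refl
      where
      ¬yx : ¬ Reaches E y x
      ¬yx yx = ¬σ λ z w → reach-redundant yx (reach-redundant (reach-there xy) (σ′ z w))
    main | yes σ | _ with minimal? ((x , y) ∷ A) L D | minimal? ((y , x) ∷ A) L D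
    ... | yes m₁ | yes m₂ = values
      (𝟙-yes xyD? (((λ _ → ¬xyA) , m₁) , λ z w → reach-there (σ z w)))
      (𝟙-yes yxD? (((λ _ → ¬xyA) , m₂) , λ z w → reach-there (σ z w)))
      (𝟙-yes del? (xy⇒del m₁ , σ))
      (𝟙-yes con? (minimal-both L D m₁ m₂ , λ z w → toCon (reach-there (reach-there (σ z w)))))
      refl
    ... | yes m₁ | no ¬m₂ = values
      (𝟙-yes xyD? (((λ _ → ¬xyA) , m₁) , λ z w → reach-there (σ z w)))
      (𝟙-no yxD? λ ((_ , m₂) , _) → ¬m₂ m₂)
      (𝟙-yes del? (xy⇒del m₁ , σ))
      (𝟙-no con? λ (m , _) → ¬m₂ (con⇒yx m))
      refl
    ... | no ¬m₁ | yes m₂ = values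
      (𝟙-no xyD? λ ((_ , m₁) , _) → ¬m₁ m₁)
      (𝟙-yes yxD? (((λ _ → ¬xyA) , m₂) , λ z w → reach-there (σ z w)))
      (𝟙-yes del? (yx⇒del m₂ , σ))
      (𝟙-no con? λ (m , _) → ¬m₁ (con⇒xy m))
      refl
    ... | no ¬m₁ | no ¬m₂ = values
      (𝟙-no xyD? λ ((_ , m₁) , _) → ¬m₁ m₁)
      (𝟙-no yxD? λ ((_ , m₂) , _) → ¬m₂ m₂)
      (𝟙-no del? λ (m , _) → [ ¬m₁ , ¬m₂ ]′ (minimal-either L D m))
      (𝟙-no con? λ (m , _) → ¬m₁ (con⇒xy m))
      refl

  -- The condition says that each edge of `H` reduces the number of components, that is, that `H` is
  -- a forest once `C` is contracted.
  forestSum : Graph v → Graph v → ℤ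
  forestSum C L = ∑ (spanningSubgraphs L) λ H →
    sgn (length H) * 𝟙 (length H ℕ.+ components (H ++ C) ℕ.≟ components C)

  private
    forestSum-head : ∀ C L {x y} (g : Graph v → ℤ) →
      (∀ {H} → H ∈ spanningSubgraphs L →
        𝟙 (suc (length H ℕ.+ components ((x , y) ∷ H ++ C)) ℕ.≟ components C) ≡ g H) →
      forestSum C ((x , y) ∷ L) ≡
      - ∑ (spanningSubgraphs L) (λ H → sgn (length H) * g H) + forestSum C L
    forestSum-head C L {x} {y} g eq = begin
      forestSum C ((x , y) ∷ L)
        ≡⟨ ∑-spanningSubgraphs-∷ (x , y) L _ ⟩
      ∑ (spanningSubgraphs L) (λ H → -1ℤ * sgn (length H) *
        𝟙 (suc (length H ℕ.+ components ((x , y) ∷ H ++ C)) ℕ.≟ components C)) + forestSum C L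
        ≡⟨ cong (_+ forestSum C L) (∑-cong-All (All.tabulate step)) ⟩
      ∑ (spanningSubgraphs L) (λ H → -1ℤ * (sgn (length H) * g H)) + forestSum C L
        ≡⟨ cong (_+ forestSum C L) (trans (∑-* (spanningSubgraphs L) -1ℤ _) (ℤ.-1*i≡-i _)) ⟩
      - ∑ (spanningSubgraphs L) (λ H → sgn (length H) * g H) + forestSum C L ∎
      where
      open ≡-Reasoning
      step : ∀ {H} → H ∈ spanningSubgraphs L →
        -1ℤ * sgn (length H) * 𝟙 (suc (length H ℕ.+ components ((x , y) ∷ H ++ C)) ℕ.≟ components C) ≡
        -1ℤ * (sgn (length H) * g H)
      step {H} H∈ = trans (cong (-1ℤ * sgn (length H) *_) (eq H∈)) (ℤ.*-assoc -1ℤ (sgn (length H)) (g H))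

  forestSum-loop : ∀ C L → Connected C x y → forestSum C ((x , y) ∷ L) ≡ forestSum C L
  forestSum-loop {x} {y} C L xy = begin
    forestSum C ((x , y) ∷ L)
      ≡⟨ forestSum-head C L (λ _ → 0ℤ) zeros ⟩
    - ∑ (spanningSubgraphs L) (λ H → sgn (length H) * 0ℤ) + forestSum C L
      ≡⟨ cong (λ t → - t + forestSum C L) (∑-cong (spanningSubgraphs L) λ H →
           trans (ℤ.*-zeroʳ (sgn (length H))) (sym (ℤ.*-zeroˡ 0ℤ))) ⟩
    - ∑ (spanningSubgraphs L) (λ H → 0ℤ * 0ℤ) + forestSum C L
      ≡⟨ cong (λ t → - t + forestSum C L) (∑-* (spanningSubgraphs L) 0ℤ (λ _ → 0ℤ)) ⟩
    0ℤ + forestSum C L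
      ≡⟨ ℤ.+-identityˡ _ ⟩
    forestSum C L ∎
    where
    open ≡-Reasoning
    zeros : ∀ {H} → H ∈ spanningSubgraphs L →
      𝟙 (suc (length H ℕ.+ components ((x , y) ∷ H ++ C)) ℕ.≟ components C) ≡ 0ℤ
    zeros {H} _ = 𝟙-no (suc (length H ℕ.+ components ((x , y) ∷ H ++ C)) ℕ.≟ components C) λ eq →
      ℕ.<⇒≱ (ℕ.≤-reflexive eq) (subst (λ k → components C ℕ.≤ length H ℕ.+ k)
        (sym (components-redundant (conn-mono (∈-++⁺ʳ H) xy))) (components-++-≤ H))

  forestSum-∷ : ∀ C L → ¬ Connected C x y →
                forestSum C ((x , y) ∷ L) ≡ - forestSum ((x , y) ∷ C) L + forestSum C L
  forestSum-∷ {x} {y} C L x≁y = forestSum-head C L _ λ {H} _ →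
    𝟙-⇔ (suc (length H ℕ.+ components ((x , y) ∷ H ++ C)) ℕ.≟ components C)
        (length H ℕ.+ components (H ++ (x , y) ∷ C) ℕ.≟ components ((x , y) ∷ C))
        (λ eq → trans (cong (length H ℕ.+_) (sym (components-insert H)))
                      (ℕ.suc-injective (trans eq (components-bridge x≁y))))
        (λ eq → trans (cong suc (trans (cong (length H ℕ.+_) (components-insert H)) eq))
                      (sym (components-bridge x≁y)))

  -- Adding a bridge turns a forest into a forest of the opposite sign, so the terms cancel in
  -- pairs; correspondingly, no orientation of a graph with a bridge is strongly connected.
  forestSum-bridge : ∀ C L → ¬ Connected (L ++ C) x y → forestSum C ((x , y) ∷ L) ≡ 0ℤ
  forestSum-bridge {x} {y} C L x≁y = trans
    (forestSum-head C L (λ H → 𝟙 (length H ℕ.+ components (H ++ C) ℕ.≟ components C)) λ {H} H∈ →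
      cong (λ k → 𝟙 (k ℕ.≟ components C)) (trans (sym (ℕ.+-suc (length H) _))
        (cong (length H ℕ.+_) (sym (components-bridge (x≁y ∘ conn-mono (widen H H∈)))))))
    (ℤ.+-inverseˡ (forestSum C L))
    where
    widen : ∀ H → H ∈ spanningSubgraphs L → (H ++ C) ⊆ (L ++ C)
    widen H H∈ e = [ ∈-++⁺ˡ ∘ spanningSubgraphs-sound L H∈ , ∈-++⁺ʳ L ]′ (∈-++⁻ H e)

  -- A loop of the contracted graph closes a cycle with edges of `C`, all counted as greater, and so
  -- keeps only its reference direction; a bridge leaves no orientation at all; any other edge obeys
  -- deletion and contraction. The ends of an edge have to be distinct for the reference direction
  -- to differ from its reverse.
  minimalStrong-sum : Fin v → ∀ C L → All (λ (x , y) → x ≢ y) L →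
    (∀ x y → Connected (L ++ C) x y) →
    ∑ (orientations L) (λ D → 𝟙 (minimalStrong? (both C) L D)) ≡
    sgn (suc (components C)) * forestSum C L
  minimalStrong-sum r C [] _ conn = base (components C) (minimalStrong? (both C) [] [])
    (connected⇒components≡1 r conn)
    (tt , λ x y → conn⇒reach (conn x y))
    where
    base : ∀ {P : Set} k (P? : Dec P) → k ≡ 1 → P → 𝟙 P? + 0ℤ ≡ sgn (suc k) * (1ℤ * 𝟙 (k ℕ.≟ k) + 0ℤ)
    base _ P? refl p rewrite 𝟙-yes P? p = refl
  minimalStrong-sum r C ((x , y) ∷ L) (x≢y ∷ loopless) conn with components-∷ C x y
  ... | inj₁ (xy , _) = begin
    ∑ (orientations ((x , y) ∷ L)) f
      ≡⟨ ∑-orientations-∷ x y L f ⟩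
    ∑ (orientations L) (λ D → f ((x , y) ∷ D) + f ((y , x) ∷ D))
      ≡⟨ ∑-cong (orientations L) (λ D → trans (cong₂ _+_ (keep D)
           (𝟙-no (minimalStrong? (both C) ((x , y) ∷ L) ((y , x) ∷ D)) λ ((h , _) , _) → h refl (conn⇒reach xy)))
           (ℤ.+-identityʳ _)) ⟩
    ∑ (orientations L) (λ D → 𝟙 (minimalStrong? (both C) L D))
      ≡⟨ minimalStrong-sum r C L loopless (λ z w → conn-∷-redundant (conn-mono (∈-++⁺ʳ L) xy) (conn z w)) ⟩
    sgn (suc (components C)) * forestSum C L
      ≡⟨ cong (sgn (suc (components C)) *_) (forestSum-loop C L xy) ⟨
    sgn (suc (components C)) * forestSum C ((x , y) ∷ L) ∎
    where
    open ≡-Reasoning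
    f : Digraph v → ℤ
    f D = 𝟙 (minimalStrong? (both C) ((x , y) ∷ L) D)
    keep : ∀ D → f ((x , y) ∷ D) ≡ 𝟙 (minimalStrong? (both C) L D)
    keep D = 𝟙-⇔ (minimalStrong? (both C) ((x , y) ∷ L) ((x , y) ∷ D)) (minimalStrong? (both C) L D)
      (λ ((_ , m) , σ) → minimal-antitone reach-there L m ,
         λ z w → reach-redundant (reach-mono (∈-++⁺ʳ D) (conn⇒reach xy)) (σ z w))
      (λ (m , σ) → ((λ flipped → contradiction (cong proj₁ flipped) x≢y) ,
                    minimal-antitone (reach-redundant (conn⇒reach xy)) L m) ,
         λ z w → reach-there (σ z w))
  ... | inj₂ (x≁y , eq) with connected? (L ++ C) x y
  ...   | yes xy = begin
    ∑ (orientations ((x , y) ∷ L)) f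
      ≡⟨ ∑-orientations-∷ x y L f ⟩
    ∑ (orientations L) (λ D → f ((x , y) ∷ D) + f ((y , x) ∷ D))
      ≡⟨ ∑-cong-All (All.map (λ {D} o → minimalStrong-deletion-contraction (both C) L D
           (x≁y ∘ reach⇒conn) (x≁y ∘ conn-sym ∘ reach⇒conn) (orients-conn o xy)
           (minimalStrong? (both C) ((x , y) ∷ L) ((x , y) ∷ D))
           (minimalStrong? (both C) ((x , y) ∷ L) ((y , x) ∷ D))
           (minimalStrong? (both C) L D) (minimalStrong? (both ((x , y) ∷ C)) L D))
           (orientations-sound L)) ⟩
    ∑ (orientations L) (λ D → g D + g′ D)
      ≡⟨ ∑-+ (orientations L) g g′ ⟩
    ∑ (orientations L) g + ∑ (orientations L) g′
      ≡⟨ cong₂ _+_ (minimalStrong-sum r C L loopless (λ z w → conn-∷-redundant xy (conn z w)))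
                   (minimalStrong-sum r ((x , y) ∷ C) L loopless
                     (λ z w → conn-mono (++-∷-⊇ L) (conn z w))) ⟩
    sgn (suc (components C)) * forestSum C L + sgn (suc k) * forestSum ((x , y) ∷ C) L
      ≡⟨ cong (λ j → sgn (suc j) * forestSum C L + sgn (suc k) * forestSum ((x , y) ∷ C) L) eq ⟩
    -1ℤ * sgn (suc k) * forestSum C L + sgn (suc k) * forestSum ((x , y) ∷ C) L
      ≡⟨ regroup (sgn (suc k)) (forestSum C L) (forestSum ((x , y) ∷ C) L) ⟩
    sgn (suc (suc k)) * (- forestSum ((x , y) ∷ C) L + forestSum C L)
      ≡⟨ cong₂ (λ j t → sgn (suc j) * t) (sym eq) (sym (forestSum-∷ C L x≁y)) ⟩
    sgn (suc (components C)) * forestSum C ((x , y) ∷ L) ∎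
    where
    open ≡-Reasoning
    k : ℕ
    k = components ((x , y) ∷ C)
    f g g′ : Digraph v → ℤ
    f D = 𝟙 (minimalStrong? (both C) ((x , y) ∷ L) D)
    g D = 𝟙 (minimalStrong? (both C) L D)
    g′ D = 𝟙 (minimalStrong? (both ((x , y) ∷ C)) L D)
    regroup : ∀ s t u → -1ℤ * s * t + s * u ≡ -1ℤ * s * (- u + t)
    regroup = solve-∀
  ...   | no x≁y′ = begin
    ∑ (orientations ((x , y) ∷ L)) f
      ≡⟨ ∑-orientations-∷ x y L f ⟩
    ∑ (orientations L) (λ D → f ((x , y) ∷ D) + f ((y , x) ∷ D))
      ≡⟨ ∑-cong-All (All.map (λ {D} o → cong₂ _+_
           (𝟙-no (minimalStrong? (both C) ((x , y) ∷ L) ((x , y) ∷ D)) λ (_ , σ) →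
             x≁y′ (conn-sym (orients-reach⇒conn o (reach-from-head (σ y x)))))
           (𝟙-no (minimalStrong? (both C) ((x , y) ∷ L) ((y , x) ∷ D)) λ (_ , σ) →
             x≁y′ (orients-reach⇒conn o (reach-from-head (σ x y)))))
           (orientations-sound L)) ⟩
    ∑ (orientations L) (λ D → 0ℤ * 0ℤ)
      ≡⟨ ∑-* (orientations L) 0ℤ (λ _ → 0ℤ) ⟩
    0ℤ
      ≡⟨ ℤ.*-zeroʳ (sgn (suc (components C))) ⟨
    sgn (suc (components C)) * 0ℤ
      ≡⟨ cong (sgn (suc (components C)) *_) (forestSum-bridge C L x≁y′) ⟨
    sgn (suc (components C)) * forestSum C ((x , y) ∷ L) ∎
    where
    open ≡-Reasoning
    f : Digraph v → ℤ
    f D = 𝟙 (minimalStrong? (both C) ((x , y) ∷ L) D)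

-- Indegree sequences

module _ {v : ℕ} where

  private variable
    C D D′ E L : Graph v
    x y z u w p q : Fin v

  hit : Fin v → Fin v → ℕ
  hit w z = if does (w Fin.≟ z) then 1 else 0

  indegree-∷ : ∀ u w D z → indegree ((u , w) ∷ D) z ≡ hit w z ℕ.+ indegree D z
  indegree-∷ u w D z with does (w Fin.≟ z)
  ... | true  = refl
  ... | false = refl

  indegree-∷ʳ : ∀ u w D z → indegree (D ∷ʳ (u , w)) z ≡ hit w z ℕ.+ indegree D z
  indegree-∷ʳ u w D z = begin
    indegree (D ∷ʳ (u , w)) z                ≡⟨ cong length (filter-++ _ D ((u , w) ∷ [])) ⟩
    _                                        ≡⟨ length-++ (filter _ D) ⟩
    indegree D z ℕ.+ indegree ((u , w) ∷ []) z ≡⟨ cong (indegree D z ℕ.+_) (indegree-∷ u w [] z) ⟩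
    indegree D z ℕ.+ (hit w z ℕ.+ 0)         ≡⟨ rearrange (indegree D z) (hit w z) ⟩
    hit w z ℕ.+ indegree D z                 ∎
    where
    open ≡-Reasoning
    rearrange : ∀ i j → i ℕ.+ (j ℕ.+ 0) ≡ j ℕ.+ i
    rearrange = solve-∀ᴺ

  ∑-hit : ∀ (f : Fin v → ℤ) w {zs} → Unique zs → w ∈ zs → ∑ zs (λ z → f z * + hit w z) ≡ f w
  ∑-hit f w {z ∷ zs} (z∉ ∷ uniq) w∈ with w Fin.≟ z | w∈
  ... | no w≢z   | here w≡z = contradiction w≡z w≢z
  ... | no _     | there w∈zs = trans (cong₂ _+_ (ℤ.*-zeroʳ (f z)) (∑-hit f w uniq w∈zs)) (ℤ.+-identityˡ _)
  ... | yes refl | _ = begin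
    f w * 1ℤ + ∑ zs (λ z → f z * + hit w z)
      ≡⟨ cong₂ _+_ (ℤ.*-identityʳ (f w)) (∑-cong-All (All.map miss z∉)) ⟩
    f w + ∑ zs (λ _ → 0ℤ * 0ℤ)
      ≡⟨ cong (λ t → f w + t) (∑-* zs 0ℤ (λ _ → 0ℤ)) ⟩
    f w + 0ℤ ≡⟨ ℤ.+-identityʳ (f w) ⟩
    f w ∎
    where
    open ≡-Reasoning
    miss : ∀ {y} → w ≢ y → f y * + hit w y ≡ 0ℤ * 0ℤ
    miss {y} w≢y rewrite dec-false (w Fin.≟ y) w≢y = ℤ.*-zeroʳ (f y)

  -- Double counting of the arcs: a sum over heads is determined by the indegrees alone.
  ∑-heads : ∀ (f : Fin v → ℤ) D →
            ∑ D (λ (_ , w) → f w) ≡ ∑ (allFin v) (λ z → f z * + indegree D z)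
  ∑-heads f [] = sym (trans (∑-cong (allFin v) λ z → ℤ.*-comm (f z) 0ℤ) (∑-* (allFin v) 0ℤ f))
  ∑-heads f ((u , w) ∷ D) = begin
    f w + ∑ D (λ (_ , w) → f w)
      ≡⟨ cong₂ _+_ (sym (∑-hit f w (Unique.allFin⁺ v) (∈-allFin w))) (∑-heads f D) ⟩
    ∑ (allFin v) (λ z → f z * + hit w z) + ∑ (allFin v) (λ z → f z * + indegree D z)
      ≡⟨ ∑-+ (allFin v) _ _ ⟨
    ∑ (allFin v) (λ z → f z * + hit w z + f z * + indegree D z)
      ≡⟨ ∑-cong (allFin v) (λ z → trans (sym (ℤ.*-distribˡ-+ (f z) _ _))
           (cong (λ k → f z * + k) (sym (indegree-∷ u w D z)))) ⟩
    ∑ (allFin v) (λ z → f z * + indegree ((u , w) ∷ D) z) ∎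
    where open ≡-Reasoning

  Closed : (Fin v → Set) → Digraph v → Set
  Closed S D = ∀ {u w} → (u , w) ∈ D → S u → S w

  closed-reach : {S : Fin v → Set} → Closed S D → Reaches D x y → S x → S y
  closed-reach closed ε        sx = sx
  closed-reach closed (d ◅ ds) sx = closed-reach closed ds (closed d sx)

  reach-closed : Closed (Reaches D x) D
  reach-closed d xu = xu ◅◅ d ◅ ε

  module _ {S : Fin v → Set} (S? : U.Decidable S) where

    leaving? : U.Decidable (λ (d : Fin v × Fin v) → S (proj₁ d) × ¬ S (proj₂ d))
    leaving? (u , w) = S? u ×-dec ¬? (S? w)

    -- An edge that meets `S` is directed either to a head in `S` or out of `S`. Hence the sum is
    -- the same for all orientations of `L`.
    heads+leaving : Orients L D →
      ∑ D (λ (_ , w) → 𝟙 (S? w)) + ∑ D (λ d → 𝟙 (leaving? d)) ≡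
      ∑ L (λ (x , y) → 𝟙 (S? x ⊎-dec S? y))
    heads+leaving [] = refl
    heads+leaving {(x , y) ∷ L} {(u , w) ∷ D} (d ∷ o) = trans
      (interchange (𝟙 (S? w)) _ (𝟙 (leaving? (u , w))) _)
      (cong₂ _+_ (arc d) (heads+leaving o))
      where
      interchange : ∀ i j k l → i + j + (k + l) ≡ i + k + (j + l)
      interchange = solve-∀
      arc : (u , w) ≡ (x , y) ⊎ (u , w) ≡ (y , x) →
            𝟙 (S? w) + 𝟙 (leaving? (u , w)) ≡ 𝟙 (S? x ⊎-dec S? y)
      arc (inj₁ refl) with S? u | S? w
      ... | yes _ | yes _ = refl
      ... | yes _ | no _  = refl
      ... | no _  | yes _ = refl
      ... | no _  | no _  = refl
      arc (inj₂ refl) with S? u | S? w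
      ... | yes _ | yes _ = refl
      ... | yes _ | no _  = refl
      ... | no _  | yes _ = refl
      ... | no _  | no _  = refl

    closed⇒leaving≡0 : Closed S D → ∑ D (λ d → 𝟙 (leaving? d)) ≡ 0ℤ
    closed⇒leaving≡0 {D} closed = trans (sym (length-filter-∑ leaving? D))
      (cong (λ ds → + length ds) (filter-none leaving? (All.tabulate λ d (su , ¬sw) → ¬sw (closed d su))))

    leaving≡0⇒closed : ∑ D (λ d → 𝟙 (leaving? d)) ≡ 0ℤ → Closed S D
    leaving≡0⇒closed {D} eq {u} {w} d su with S? w
    ... | yes sw = sw
    ... | no ¬sw with filter leaving? D | ∈-filter⁺ leaving? d (su , ¬sw) | trans (length-filter-∑ leaving? D) eq
    ...   | _ ∷ _ | _ | ()

    -- The arcs with head in S are at most the edges meeting S, with equality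
    -- exactly when no arc leaves S; so closure is a property of the indegrees.
    closed-transfer : Orients L D → Orients L D′ → (S p → S q) → (S q → S p) →
      (∀ z → hit p z ℕ.+ indegree D z ≡ hit q z ℕ.+ indegree D′ z) →
      Closed S D → Closed S D′
    closed-transfer {L} {D} {D′} {p} {q} o o′ p⇒q q⇒p eq closed =
      leaving≡0⇒closed (∙-cancelˡ (heads D′) _ _ (trans
        (trans (heads+leaving o′) (sym (heads+leaving o)))
        (cong₂ _+_ heads≡ (closed⇒leaving≡0 closed))))
      where
      heads : Digraph v → ℤ
      heads D = ∑ D (λ (_ , w) → 𝟙 (S? w))
      heads≡ : heads D ≡ heads D′
      -- Auxiliary loops at `p` and `q` turn the hypothesis `eq` into equality of indegrees, to
      -- which `∑-heads` applies.
      heads≡ = ∙-cancelˡ (𝟙 (S? p)) _ _ (begin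
        heads ((p , p) ∷ D)
          ≡⟨ ∑-heads (λ w → 𝟙 (S? w)) ((p , p) ∷ D) ⟩
        ∑ (allFin v) (λ z → 𝟙 (S? z) * + indegree ((p , p) ∷ D) z)
          ≡⟨ ∑-cong (allFin v) (λ z → cong (λ k → 𝟙 (S? z) * + k)
               (trans (indegree-∷ p p D z) (trans (eq z) (sym (indegree-∷ q q D′ z))))) ⟩
        ∑ (allFin v) (λ z → 𝟙 (S? z) * + indegree ((q , q) ∷ D′) z)
          ≡⟨ ∑-heads (λ w → 𝟙 (S? w)) ((q , q) ∷ D′) ⟨
        𝟙 (S? q) + heads D′
          ≡⟨ cong (_+ heads D′) (𝟙-⇔ (S? q) (S? p) q⇒p p⇒q) ⟩
        𝟙 (S? p) + heads D′ ∎)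
        where open ≡-Reasoning

  -- The set of vertices that `D′` reaches from `x` is closed under `D′`, hence under `D`, so `D`
  -- cannot leave it either. Strong connectedness is thus a property of the indegree sequence.
  reach-transfer : Orients L D → Orients L D′ → (∀ z → indegree D z ≡ indegree D′ z) →
                   Reaches D x y → Reaches D′ x y
  reach-transfer {D = D} {D′} {x} o o′ eq xy = closed-reach
    (closed-transfer (reaches? D′ x) {p = x} {q = x} o′ o id id (λ z → cong (hit x z ℕ.+_) (sym (eq z))) reach-closed)
    xy ε

  -- This is the effect of reversing a path from `u` to `w`: the indegree of `u` grows by one and
  -- that of `w` drops by one. Instead of extracting a simple path, the recursion runs over the
  -- arcs. If the first arc (p , q) is needed, the paths from `u` to `p` and from `q` to `w` avoid
  -- it and are reversed one after the other.
  reverse-path : ∀ L → Orients L D → Reaches D u w →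
    ∃ λ D′ → Orients L D′ × (∀ z → hit w z ℕ.+ indegree D′ z ≡ hit u z ℕ.+ indegree D z)
  reverse-path [] [] ε = [] , [] , λ _ → refl
  reverse-path {(p , q) ∷ D} {u} {w} (_ ∷ L) (d ∷ o) uw with reaches? D u w
  ... | yes uw′ with reverse-path L o uw′
  ...   | D′ , o′ , eq = (p , q) ∷ D′ , d ∷ o′ , λ z → begin
    hit w z ℕ.+ indegree ((p , q) ∷ D′) z       ≡⟨ cong (hit w z ℕ.+_) (indegree-∷ p q D′ z) ⟩
    hit w z ℕ.+ (hit q z ℕ.+ indegree D′ z)     ≡⟨ exchange (hit w z) (hit q z) _ ⟩
    hit q z ℕ.+ (hit w z ℕ.+ indegree D′ z)     ≡⟨ cong (hit q z ℕ.+_) (eq z) ⟩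
    hit q z ℕ.+ (hit u z ℕ.+ indegree D z)      ≡⟨ exchange (hit q z) (hit u z) _ ⟩
    hit u z ℕ.+ (hit q z ℕ.+ indegree D z)      ≡⟨ cong (hit u z ℕ.+_) (indegree-∷ p q D z) ⟨
    hit u z ℕ.+ indegree ((p , q) ∷ D) z        ∎
    where
    open ≡-Reasoning
    exchange : ∀ i j k → i ℕ.+ (j ℕ.+ k) ≡ j ℕ.+ (i ℕ.+ k)
    exchange = solve-∀ᴺ
  reverse-path {(p , q) ∷ D} {u} {w} (_ ∷ L) (d ∷ o) uw | no ¬uw with reach-∷⁻ uw
  ... | inj₁ uw′       = contradiction uw′ ¬uw
  ... | inj₂ (up , qw) with reverse-path L o up
  ...   | D₁ , o₁ , eq₁ with reverse-path L o₁ qw₁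
    where
    -- After the first reversal `w` must still be reachable from `q`. The set `S` is closed under
    -- `D₁`, so by the indegrees also under `D`, and therefore contains `w`; but `D` does not reach
    -- `w` from `u`.
    S : Fin v → Set
    S z = Reaches D u z ⊎ Reaches D₁ q z
    S? : U.Decidable S
    S? z = reaches? D u z ⊎-dec reaches? D₁ q z
    closed₁ : Closed S D₁
    closed₁ e (inj₁ uz) = inj₁ (closed-transfer (reaches? D u) {p = u} {q = p} o o₁
      (λ _ → up) (λ _ → ε) (λ z → sym (eq₁ z)) reach-closed e uz)
    closed₁ e (inj₂ qz) = inj₂ (reach-closed e qz)
    closed : Closed S D
    closed = closed-transfer S? {p = p} {q = u} o₁ o (λ _ → inj₁ ε) (λ _ → inj₁ up) eq₁ closed₁
    qw₁ : Reaches D₁ q w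
    qw₁ with closed-reach closed qw (inj₂ ε)
    ... | inj₁ uw = contradiction uw ¬uw
    ... | inj₂ r  = r
  ...     | D₂ , o₂ , eq₂ = (q , p) ∷ D₂ , flip d ∷ o₂ , λ z → begin
    hit w z ℕ.+ indegree ((q , p) ∷ D₂) z       ≡⟨ cong (hit w z ℕ.+_) (indegree-∷ q p D₂ z) ⟩
    hit w z ℕ.+ (hit p z ℕ.+ indegree D₂ z)     ≡⟨ exchange (hit w z) (hit p z) _ ⟩
    hit p z ℕ.+ (hit w z ℕ.+ indegree D₂ z)     ≡⟨ cong (hit p z ℕ.+_) (eq₂ z) ⟩
    hit p z ℕ.+ (hit q z ℕ.+ indegree D₁ z)     ≡⟨ exchange (hit p z) (hit q z) _ ⟩
    hit q z ℕ.+ (hit p z ℕ.+ indegree D₁ z)     ≡⟨ cong (hit q z ℕ.+_) (eq₁ z) ⟩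
    hit q z ℕ.+ (hit u z ℕ.+ indegree D z)      ≡⟨ exchange (hit q z) (hit u z) _ ⟩
    hit u z ℕ.+ (hit q z ℕ.+ indegree D z)      ≡⟨ cong (hit u z ℕ.+_) (indegree-∷ p q D z) ⟨
    hit u z ℕ.+ indegree ((p , q) ∷ D) z        ∎
    where
    open ≡-Reasoning
    exchange : ∀ i j k → i ℕ.+ (j ℕ.+ k) ≡ j ℕ.+ (i ℕ.+ k)
    exchange = solve-∀ᴺ
    flip : ∀ {e} → (p , q) ≡ e ⊎ (p , q) ≡ swap e → (q , p) ≡ e ⊎ (q , p) ≡ swap e
    flip (inj₁ refl) = inj₂ refl
    flip (inj₂ refl) = inj₁ refl

  orients-∷ʳ⁻ : ∀ L {e} → Orients (L ∷ʳ e) D →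
    ∃ λ D₁ → ∃ λ d → D ≡ D₁ ∷ʳ d × Orients L D₁ × (d ≡ e ⊎ d ≡ swap e)
  orients-∷ʳ⁻ []      (d ∷ []) = [] , _ , refl , [] , d
  orients-∷ʳ⁻ (_ ∷ L) (d ∷ o) with orients-∷ʳ⁻ L o
  ... | _ , _ , refl , o′ , d′ = _ , _ , refl , d ∷ o′ , d′

  orients-∷ʳ⁺ : ∀ {e d} → Orients L D → d ≡ e ⊎ d ≡ swap e → Orients (L ∷ʳ e) (D ∷ʳ d)
  orients-∷ʳ⁺ o d = Pointwise.++⁺ o (d ∷ [])

  minimal-∷ʳ⁺ : ∀ {A x y d} → Orients L D → Minimal A L D →
    (d ≡ (y , x) → ¬ Reaches (D ++ A) x y) → Minimal A (L ∷ʳ (x , y)) (D ∷ʳ d)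
  minimal-∷ʳ⁺ []      m       h = h , tt
  minimal-∷ʳ⁺ {D = _ ∷ D} (_ ∷ o) (i , m) h =
    i , minimal-∷ʳ⁺ o m (λ flipped → h flipped ∘ reach-mono (++-∷-⊆ D))

  minimal-∷ʳ⁻ : ∀ {A x y d} → Orients L D → Minimal A (L ∷ʳ (x , y)) (D ∷ʳ d) →
    Minimal A L D × (d ≡ (y , x) → ¬ Reaches (D ++ A) x y)
  minimal-∷ʳ⁻ []      (h , _) = tt , h
  minimal-∷ʳ⁻ {D = _ ∷ D} (_ ∷ o) (i , m) with minimal-∷ʳ⁻ o m
  ... | m′ , h = (i , m′) , λ flipped → h flipped ∘ reach-mono (++-∷-⊇ D)

  ++[]-⊆ : (D ++ []) ⊆ D
  ++[]-⊆ {D} = subst ((_ , _) ∈_) (++-identityʳ D)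

  -- The least edge is last in the list and is settled first. If it is misdirected and lies on a
  -- directed cycle, the cycle is reversed, which keeps all indegrees. Rearranging the remaining
  -- edges with their indegrees fixed cannot spoil this, since reachability among them stays the
  -- same by `reach-transfer`.
  minimal-exists : Reverse L → All (λ (x , y) → x ≢ y) L → Orients L D →
    ∃ λ D′ → Orients L D′ × Minimal [] L D′ × (∀ z → indegree D′ z ≡ indegree D z)
  minimal-exists [] _ [] = [] , [] , tt , λ _ → refl
  minimal-exists (L ∶ rev ∶ʳ (x , y)) loopless o with orients-∷ʳ⁻ L o | All.++⁻ L loopless
  ... | D , _ , refl , o₁ , inj₁ refl | loopless₁ , x≢y ∷ [] with minimal-exists rev loopless₁ o₁
  ...   | D′ , o′ , m , eq = D′ ∷ʳ (x , y) , orients-∷ʳ⁺ o′ (inj₁ refl) ,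
    minimal-∷ʳ⁺ o′ m (λ flipped → contradiction (cong proj₁ flipped) x≢y) ,
    λ z → trans (indegree-∷ʳ x y D′ z) (trans (cong (hit y z ℕ.+_) (eq z)) (sym (indegree-∷ʳ x y D z)))
  minimal-exists (L ∶ rev ∶ʳ (x , y)) loopless o
      | D , _ , refl , o₁ , inj₂ refl | loopless₁ , x≢y ∷ [] with reaches? D x y
  ... | no ¬xy with minimal-exists rev loopless₁ o₁
  ...   | D′ , o′ , m , eq = D′ ∷ʳ (y , x) , orients-∷ʳ⁺ o′ (inj₂ refl) ,
    minimal-∷ʳ⁺ o′ m (λ _ → ¬xy ∘ reach-transfer o′ o₁ eq ∘ reach-mono ++[]-⊆) ,
    λ z → trans (indegree-∷ʳ y x D′ z) (trans (cong (hit x z ℕ.+_) (eq z)) (sym (indegree-∷ʳ y x D z)))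
  minimal-exists (L ∶ rev ∶ʳ (x , y)) loopless o
      | D , _ , refl , o₁ , inj₂ refl | loopless₁ , x≢y ∷ [] | yes xy with reverse-path L o₁ xy
  ... | D₁ , o₁′ , eq₁ with minimal-exists rev loopless₁ o₁′
  ...   | D′ , o′ , m , eq = D′ ∷ʳ (x , y) , orients-∷ʳ⁺ o′ (inj₁ refl) ,
    minimal-∷ʳ⁺ o′ m (λ flipped → contradiction (cong proj₁ flipped) x≢y) ,
    λ z → trans (indegree-∷ʳ x y D′ z) (trans (cong (hit y z ℕ.+_) (eq z))
            (trans (eq₁ z) (sym (indegree-∷ʳ y x D z))))

  indegree-∷ʳ-cancel : ∀ d (D D′ : Digraph v) →
    (∀ z → indegree (D ∷ʳ d) z ≡ indegree (D′ ∷ʳ d) z) → ∀ z → indegree D z ≡ indegree D′ z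
  indegree-∷ʳ-cancel (u , w) D D′ eq z = ℕ.+-cancelˡ-≡ (hit w z) _ _
    (trans (sym (indegree-∷ʳ u w D z)) (trans (eq z) (indegree-∷ʳ u w D′ z)))

  -- With equal indegrees, reachability of `y` from `x` would carry over from the first orientation
  -- to the second. A path from `x` to `y` need not use the arc (y , x), so that arc would be the
  -- misdirected least edge of a directed cycle.
  minimal-last : Orients L D → Orients L D′ → Minimal [] (L ∷ʳ (x , y)) (D′ ∷ʳ (y , x)) →
                 ¬ (∀ z → indegree (D ∷ʳ (x , y)) z ≡ indegree (D′ ∷ʳ (y , x)) z)
  minimal-last {D = D} {D′} o o′ m eq = minimal-∷ʳ⁻ o′ m .proj₂ refl
    (reach-to-tail (reach-mono (++-∷-⊆ D′)
      (reach-transfer (orients-∷ʳ⁺ o (inj₁ refl)) (orients-∷ʳ⁺ o′ (inj₂ refl)) eq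
        (∈-++⁺ʳ D (here refl) ◅ ε))))

  minimal-unique : Reverse L → Orients L D → Orients L D′ → Minimal [] L D → Minimal [] L D′ →
    (∀ z → indegree D z ≡ indegree D′ z) → D ≡ D′
  minimal-unique [] [] [] _ _ _ = refl
  minimal-unique (L ∶ rev ∶ʳ e) o o′ m m′ eq with orients-∷ʳ⁻ L o | orients-∷ʳ⁻ L o′
  ... | D , _ , refl , o₁ , inj₁ refl | D′ , _ , refl , o₂ , inj₁ refl = cong (_∷ʳ _)
    (minimal-unique rev o₁ o₂ (minimal-∷ʳ⁻ o₁ m .proj₁) (minimal-∷ʳ⁻ o₂ m′ .proj₁) (indegree-∷ʳ-cancel _ D D′ eq))
  ... | D , _ , refl , o₁ , inj₂ refl | D′ , _ , refl , o₂ , inj₂ refl = cong (_∷ʳ _)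
    (minimal-unique rev o₁ o₂ (minimal-∷ʳ⁻ o₁ m .proj₁) (minimal-∷ʳ⁻ o₂ m′ .proj₁) (indegree-∷ʳ-cancel _ D D′ eq))
  ... | _ , _ , refl , o₁ , inj₁ refl | _ , _ , refl , o₂ , inj₂ refl =
    contradiction eq (minimal-last o₁ o₂ m′)
  ... | _ , _ , refl , o₁ , inj₂ refl | _ , _ , refl , o₂ , inj₁ refl =
    contradiction (sym ∘ eq) (minimal-last o₂ o₁ m)

  orientations-complete : Orients L D → D ∈ orientations L
  orientations-complete [] = here refl
  orientations-complete {(x , y) ∷ L} (inj₁ refl ∷ o) =
    ∈-++⁺ˡ (∈-map⁺ ((x , y) ∷_) (orientations-complete o))
  orientations-complete {(x , y) ∷ L} (inj₂ refl ∷ o) =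
    ∈-++⁺ʳ (map ((x , y) ∷_) (orientations L)) (∈-map⁺ ((y , x) ∷_) (orientations-complete o))

  orientations-unique : All (λ (x , y) → x ≢ y) L → Unique (orientations L)
  orientations-unique [] = [] ∷ []
  orientations-unique {(x , y) ∷ L} (x≢y ∷ loopless) = Unique.++⁺
    (Unique.map⁺ ∷-injectiveʳ (orientations-unique loopless))
    (Unique.map⁺ ∷-injectiveʳ (orientations-unique loopless))
    disjoint
    where
    disjoint : D ∈ map ((x , y) ∷_) (orientations L) × D ∈ map ((y , x) ∷_) (orientations L) → ⊥
    disjoint (p , q) with ∈-map⁻ ((x , y) ∷_) p | ∈-map⁻ ((y , x) ∷_) q
    ... | _ , _ , refl | _ , _ , eq = x≢y (cong proj₁ (∷-injectiveˡ eq))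

  map-unique : ∀ {A B : Set} {f : A → B} {xs} →
    (∀ {x y} → x ∈ xs → y ∈ xs → f x ≡ f y → x ≡ y) → Unique xs → Unique (map f xs)
  map-unique inj []         = []
  map-unique {f = f} inj (x∉ ∷ uniq) =
    All.map⁺ (All.tabulate λ y∈ eq → All.lookup x∉ y∈ (inj (here refl) (there y∈) eq)) ∷
    map-unique (λ p q → inj (there p) (there q)) uniq

  indegreeSequence-≡ : ∀ (D E : Digraph v) → indegreeSequence D ≡ indegreeSequence E → ∀ z → indegree D z ≡ indegree E z
  indegreeSequence-≡ D E eq z = trans (sym (lookup∘tabulate (indegree D) z))
    (trans (cong (λ s → lookup s z) eq) (lookup∘tabulate (indegree E) z))

  -- Each indegree sequence of a strongly connected orientation belongs to exactly
  -- one minimal orientation.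
  #stronglyConnectedIndegreeSequences-minimal : ∀ L → All (λ (x , y) → x ≢ y) L →
    #stronglyConnectedIndegreeSequences L ≡ length (filter (minimalStrong? [] L) (orientations L))
  #stronglyConnectedIndegreeSequences-minimal L loopless = trans
    (ℕ.≤-antisym
      (independent≤covering isEquivalence (deduplicate-independent isEquivalence seq≟ sequences)
        (All.tabulate (represent ∘ ∈-deduplicate⁻ seq≟ sequences)))
      (independent≤covering isEquivalence minimals-unique
        (All.tabulate (∈-deduplicate⁺ seq≟ ∘ include))))
    (length-map indegreeSequence minimals)
    where
    seq≟ : DecidableEquality (Vec ℕ v)
    seq≟ = ≡-dec ℕ._≟_
    sequences : List (Vec ℕ v)
    sequences = map indegreeSequence (filter stronglyConnected? (orientations L))
    minimals : List (Digraph v)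
    minimals = filter (minimalStrong? [] L) (orientations L)

    minimal∈⁻ : D ∈ minimals → Orients L D × Minimal [] L D × StronglyConnected D
    minimal∈⁻ {D} D∈ with ∈-filter⁻ (minimalStrong? [] L) D∈
    ... | D∈L , m , σ = All.lookup (orientations-sound L) D∈L , m , subst StronglyConnected (++-identityʳ D) σ

    minimals-unique : Unique (map indegreeSequence minimals)
    minimals-unique = map-unique
      (λ {D} {E} D∈ E∈ eq → let (o , m , _) = minimal∈⁻ D∈ ; (o′ , m′ , _) = minimal∈⁻ E∈ in
         minimal-unique (reverseView L) o o′ m m′ (indegreeSequence-≡ D E eq))
      (Unique.filter⁺ (minimalStrong? [] L) (orientations-unique loopless))

    include : ∀ {s} → s ∈ map indegreeSequence minimals → s ∈ sequences
    include s∈ with ∈-map⁻ indegreeSequence s∈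
    ... | D , D∈ , refl with minimal∈⁻ D∈
    ...   | o , _ , σ = ∈-map⁺ indegreeSequence (∈-filter⁺ stronglyConnected? (orientations-complete o) σ)

    represent : ∀ {s} → s ∈ sequences → s ∈ map indegreeSequence minimals
    represent s∈ with ∈-map⁻ indegreeSequence s∈
    ... | D , D∈ , refl with ∈-filter⁻ stronglyConnected? D∈
    ...   | D∈L , σ with minimal-exists (reverseView L) loopless (All.lookup (orientations-sound L) D∈L)
    ...     | D′ , o′ , m , eq = subst (_∈ map indegreeSequence minimals) (tabulate-cong eq)
      (∈-map⁺ indegreeSequence (∈-filter⁺ (minimalStrong? [] L) (orientations-complete o′)
        (m , subst StronglyConnected (sym (++-identityʳ D′))
          λ x y → reach-transfer (All.lookup (orientations-sound L) D∈L) o′ (sym ∘ eq) (σ x y))))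

  #stronglyConnectedIndegreeSequences-sum : Fin v → ∀ L → All (λ (x , y) → x ≢ y) L →
    (∀ x y → Connected L x y) →
    + #stronglyConnectedIndegreeSequences L ≡ sgn (suc v) * forestSum [] L
  #stronglyConnectedIndegreeSequences-sum r L loopless conn = begin
    + #stronglyConnectedIndegreeSequences L
      ≡⟨ cong +_ (#stronglyConnectedIndegreeSequences-minimal L loopless) ⟩
    + length (filter (minimalStrong? [] L) (orientations L))
      ≡⟨ length-filter-∑ (minimalStrong? [] L) (orientations L) ⟩
    ∑ (orientations L) (λ D → 𝟙 (minimalStrong? [] L D))
      ≡⟨ minimalStrong-sum r [] L loopless (λ x y → conn-mono ∈-++⁺ˡ (conn x y)) ⟩
    sgn (suc (components {v} [])) * forestSum [] L
      ≡⟨ cong (λ k → sgn (suc k) * forestSum [] L) (components-[] {v}) ⟩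
    sgn (suc v) * forestSum [] L ∎
    where open ≡-Reasoning

-- Replacing an edge by a graph

bit : Bool → ℕ
bit β = if β then 1 else 0

edge? : {A : Set} → Bool → A → List A
edge? β e = if β then e ∷ [] else []

mapEdges : ∀ {m v} → (Fin m → Fin v) → Graph m → Graph v
mapEdges g = map (λ (x , y) → g x , g y)

private
  -- This and the next two are the induction steps of `components-weld`. The counts are `c` for the
  -- welded graph, `h` for `H` and `l` for `C` with its possible link; a prime marks the count after
  -- an edge has been added to `H`.
  both-drop : ∀ l i {c c′ h h′ m} → c ≡ suc c′ → h ≡ suc h′ → c ℕ.+ m ≡ l ℕ.+ h ℕ.+ i →
              c′ ℕ.+ m ≡ l ℕ.+ h′ ℕ.+ i
  both-drop l i {h′ = h′} refl refl eq =
    ℕ.suc-injective (trans eq (cong (ℕ._+ i) (ℕ.+-suc l h′)))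

  joined-inside : ∀ {c c′ h h′ l l′ m} → h ≡ suc h′ → c′ ≡ c → l′ ≡ l → c ℕ.+ m ≡ l ℕ.+ h ℕ.+ 0 →
                  c′ ℕ.+ m ≡ l′ ℕ.+ h′ ℕ.+ 1
  joined-inside {h′ = h′} {l} refl refl refl eq = trans eq (shift l h′)
    where
    shift : ∀ i j → i ℕ.+ (1 ℕ.+ j) ℕ.+ 0 ≡ i ℕ.+ j ℕ.+ 1
    shift = solve-∀ᴺ

  all-drop : ∀ {c c′ h h′ l l′ m} → h ≡ suc h′ → c ≡ suc c′ → l ≡ suc l′ → c ℕ.+ m ≡ l ℕ.+ h ℕ.+ 0 →
             c′ ℕ.+ m ≡ l′ ℕ.+ h′ ℕ.+ 1
  all-drop {h′ = h′} {l′ = l′} refl refl refl eq = ℕ.suc-injective (trans eq (shift l′ h′))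
    where
    shift : ∀ i j → 1 ℕ.+ i ℕ.+ (1 ℕ.+ j) ℕ.+ 0 ≡ 1 ℕ.+ (i ℕ.+ j ℕ.+ 1)
    shift = solve-∀ᴺ

-- Welding a graph H on Fin m into a graph C on Fin v along the embedding g, where
-- only the terminals s and t of H are incident with C.
module Weld {m v : ℕ} (g : Fin m → Fin v) (g-injective : ∀ {x y} → g x ≡ g y → x ≡ y)
            {s t : Fin m} (s≢t : s ≢ t) where

  Outer : Fin v → Set
  Outer z = ∀ u → z ≡ g u → u ≡ s ⊎ u ≡ t

  OuterGraph : Graph v → Set
  OuterGraph = All (λ (x , y) → Outer x × Outer y)

  module _ {C : Graph v} (outer : OuterGraph C) where

    -- Connectedness in the welded graph as seen from `H`: all that `C` can offer is a connection
    -- between the two terminals.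
    Linked : Graph m → Fin m → Fin m → Set
    Linked H x y = Connected H x y
                 ⊎ (Connected C (g s) (g t) × Connected H x s × Connected H t y)
                 ⊎ (Connected C (g s) (g t) × Connected H x t × Connected H s y)

    conn-outer : ∀ {x z} → Connected C x z → x ≡ z ⊎ Outer z
    conn-outer ε = inj₁ refl
    conn-outer (e ◅ rest) with conn-outer rest
    ... | inj₂ o    = inj₂ o
    ... | inj₁ refl = inj₂ (target e)
      where
      target : ∀ {x y} → SymClosure (λ x y → (x , y) ∈ C) x y → Outer y
      target (fwd e) = All.lookup outer e .proj₂
      target (bwd e) = All.lookup outer e .proj₁

    module _ {H : Graph m} where

      linked-extend : ∀ {x y z} → Linked H x y → Connected H y z → Linked H x z
      linked-extend (inj₁ xy)                    yz = inj₁ (xy ◅◅ yz)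
      linked-extend (inj₂ (inj₁ (st , xs , ty))) yz = inj₂ (inj₁ (st , xs , ty ◅◅ yz))
      linked-extend (inj₂ (inj₂ (st , xt , sy))) yz = inj₂ (inj₂ (st , xt , sy ◅◅ yz))

      linked-st : ∀ {x} → Connected C (g s) (g t) → Linked H x s → Linked H x t
      linked-st st (inj₁ xs)                   = inj₂ (inj₁ (st , xs , ε))
      linked-st st (inj₂ (inj₁ (_ , xs , ts))) = inj₁ (xs ◅◅ conn-sym ts)
      linked-st st (inj₂ (inj₂ (_ , xt , _)))  = inj₁ xt

      linked-ts : ∀ {x} → Connected C (g s) (g t) → Linked H x t → Linked H x s
      linked-ts st (inj₁ xt)                   = inj₂ (inj₂ (st , xt , ε))
      linked-ts st (inj₂ (inj₁ (_ , xs , _)))  = inj₁ xs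
      linked-ts st (inj₂ (inj₂ (_ , xt , st′))) = inj₁ (xt ◅◅ conn-sym st′)

      linked-via-s : ∀ {x u} → Linked H x s → Connected C (g s) (g u) → Linked H x u
      linked-via-s xs su with conn-outer su
      ... | inj₁ eq rewrite g-injective eq = xs
      ... | inj₂ o with o _ refl
      ...   | inj₁ refl = xs
      ...   | inj₂ refl = linked-st su xs

      linked-via-t : ∀ {x u} → Linked H x t → Connected C (g t) (g u) → Linked H x u
      linked-via-t xt tu with conn-outer tu
      ... | inj₁ eq rewrite g-injective eq = xt
      ... | inj₂ o with o _ refl
      ...   | inj₂ refl = xt
      ...   | inj₁ refl = linked-ts (conn-sym tu) xt

      -- The invariant along a walk in the welded graph. The walk may be at a vertex outside the
      -- image of `g`, and then the terminal through which it last entered `C` is recorded.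
      Visited : Fin m → Fin v → Set
      Visited x z = (∃ λ u → z ≡ g u × Linked H x u)
                  ⊎ (Linked H x s × Connected C (g s) z)
                  ⊎ (Linked H x t × Connected C (g t) z)

      visited-linked : ∀ {x u} → Visited x (g u) → Linked H x u
      visited-linked (inj₁ (_ , eq , xu)) rewrite g-injective eq = xu
      visited-linked (inj₂ (inj₁ (xs , su))) = linked-via-s xs su
      visited-linked (inj₂ (inj₂ (xt , tu))) = linked-via-t xt tu

      visited-outer : ∀ {x z} → Outer z → Visited x z →
                      (Linked H x s × Connected C (g s) z) ⊎ (Linked H x t × Connected C (g t) z)
      visited-outer o (inj₂ visited) = visited
      visited-outer o (inj₁ (u , refl , xu)) with o u refl
      ... | inj₁ refl = inj₁ (xu , ε)
      ... | inj₂ refl = inj₂ (xu , ε)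

      visited-step : ∀ {x z z′} → SymClosure (λ x y → (x , y) ∈ mapEdges g H ++ C) z z′ →
                     Visited x z → Visited x z′
      visited-step (fwd e) visited with ∈-++⁻ (mapEdges g H) e
      ... | inj₁ h with ∈-map⁻ _ h
      ...   | _ , h′ , refl = inj₁ (_ , refl , linked-extend (visited-linked visited) (fwd h′ ◅ ε))
      visited-step (fwd e) visited | inj₂ c with visited-outer (All.lookup outer c .proj₁) visited
      ...   | inj₁ (xs , sz) = inj₂ (inj₁ (xs , sz ◅◅ fwd c ◅ ε))
      ...   | inj₂ (xt , tz) = inj₂ (inj₂ (xt , tz ◅◅ fwd c ◅ ε))
      visited-step (bwd e) visited with ∈-++⁻ (mapEdges g H) e
      ... | inj₁ h with ∈-map⁻ _ h
      ...   | _ , h′ , refl = inj₁ (_ , refl , linked-extend (visited-linked visited) (bwd h′ ◅ ε))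
      visited-step (bwd e) visited | inj₂ c with visited-outer (All.lookup outer c .proj₂) visited
      ...   | inj₁ (xs , sz) = inj₂ (inj₁ (xs , sz ◅◅ bwd c ◅ ε))
      ...   | inj₂ (xt , tz) = inj₂ (inj₂ (xt , tz ◅◅ bwd c ◅ ε))

      conn-weld⁻ : ∀ {x y} → Connected (mapEdges g H ++ C) (g x) (g y) → Linked H x y
      conn-weld⁻ {x} r = visited-linked (walk (inj₁ (x , refl , inj₁ ε)) r)
        where
        walk : ∀ {z w} → Visited x z → Connected (mapEdges g H ++ C) z w → Visited x w
        walk visited ε        = visited
        walk visited (e ◅ es) = walk (visited-step e visited) es

      conn-inside : ∀ {x y} → Connected H x y → Connected (mapEdges g H ++ C) (g x) (g y)
      conn-inside = Eq.gmap g (∈-++⁺ˡ ∘ ∈-map⁺ _)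

      conn-outside : ∀ {x y} → Connected C x y → Connected (mapEdges g H ++ C) x y
      conn-outside = conn-mono (∈-++⁺ʳ (mapEdges g H))

      conn-weld⁺ : ∀ {x y} → Linked H x y → Connected (mapEdges g H ++ C) (g x) (g y)
      conn-weld⁺ (inj₁ xy) = conn-inside xy
      conn-weld⁺ (inj₂ (inj₁ (st , xs , ty))) =
        conn-inside xs ◅◅ conn-outside st ◅◅ conn-inside ty
      conn-weld⁺ (inj₂ (inj₂ (st , xt , sy))) =
        conn-inside xt ◅◅ conn-outside (conn-sym st) ◅◅ conn-inside sy

    -- To the rest of the graph, `H` acts like an edge between its terminals if it joins them, and
    -- like nothing if it does not. The edges of `H` are added one at a time to `m` isolated
    -- vertices, and the changes on the two sides compared.
    components-weld : ∀ H (st? : Dec (Connected H s t)) →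
      components (mapEdges g H ++ C) ℕ.+ m ≡
      components (edge? (does st?) (g s , g t) ++ C) ℕ.+ components H ℕ.+ bit (does st?)
    components-weld [] (yes st) = contradiction st (no-edges s≢t)
    components-weld [] (no _) = trans (cong (components C ℕ.+_) (sym (components-[] {m}))) (sym (ℕ.+-identityʳ _))
    components-weld ((x , y) ∷ H) st? with components-∷ H x y | connected? H s t | st?
    ... | inj₁ (xy , eq) | yes st | no ¬st = contradiction (conn-mono there st) ¬st
    ... | inj₁ (xy , eq) | no ¬st | yes st = contradiction (conn-∷-redundant xy st) ¬st
    ... | inj₁ (xy , eq) | yes st | yes _ rewrite eq | components-redundant (conn-weld⁺ {H} (inj₁ xy)) =
      components-weld H (yes st)
    ... | inj₁ (xy , eq) | no ¬st | no _ rewrite eq | components-redundant (conn-weld⁺ {H} (inj₁ xy)) =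
      components-weld H (no ¬st)
    ... | inj₂ (x≁y , eq) | yes st | no ¬st = contradiction (conn-mono there st) ¬st
    ... | inj₂ (x≁y , eq) | yes st | yes _ =
      both-drop (components ((g s , g t) ∷ C)) 1 (components-bridge apart′) eq (components-weld H (yes st))
      where
      apart′ : ¬ Connected (mapEdges g H ++ C) (g x) (g y)
      apart′ r with conn-weld⁻ r
      ... | inj₁ xy                   = x≁y xy
      ... | inj₂ (inj₁ (_ , xs , ty)) = x≁y (xs ◅◅ st ◅◅ ty)
      ... | inj₂ (inj₂ (_ , xt , sy)) = x≁y (xt ◅◅ conn-sym st ◅◅ sy)
    -- The ends of the new edge are not linked through `C` either, for then the edge would join the
    -- terminals within `H`.
    ... | inj₂ (x≁y , eq) | no ¬st | no ¬st′ =
      both-drop (components C) 0 (components-bridge apart′) eq (components-weld H (no ¬st))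
      where
      apart′ : ¬ Connected (mapEdges g H ++ C) (g x) (g y)
      apart′ r with conn-weld⁻ r
      ... | inj₁ xy                   = x≁y xy
      ... | inj₂ (inj₁ (_ , xs , ty)) = ¬st′
        (conn-sym (conn-mono there xs) ◅◅ fwd (here refl) ◅ conn-mono there (conn-sym ty))
      ... | inj₂ (inj₂ (_ , xt , sy)) = ¬st′
        (conn-mono there sy ◅◅ bwd (here refl) ◅ conn-mono there xt)
    -- Here the new edge joins the terminals. It merges components of the welded graph just when `C`
    -- has not connected the terminals already.
    ... | inj₂ (x≁y , eq) | no ¬st | yes st′ with conn-∷⁻ st′ | connected? C (g s) (g t)
    ...   | inj₁ st                | _        = contradiction st ¬st
    ...   | inj₂ (inj₁ (sx , yt)) | yes gst =
      joined-inside eq (components-redundant (conn-weld⁺ (inj₂ (inj₁ (gst , conn-sym sx , conn-sym yt)))))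
        (components-redundant gst) (components-weld H (no ¬st))
    ...   | inj₂ (inj₂ (sy , xt)) | yes gst =
      joined-inside eq (components-redundant (conn-weld⁺ (inj₂ (inj₂ (gst , xt , sy)))))
        (components-redundant gst) (components-weld H (no ¬st))
    ...   | inj₂ _ | no ¬gst = all-drop eq (components-bridge apart′) (components-bridge ¬gst) (components-weld H (no ¬st))
      where
      apart′ : ¬ Connected (mapEdges g H ++ C) (g x) (g y)
      apart′ r with conn-weld⁻ r
      ... | inj₁ xy               = x≁y xy
      ... | inj₂ (inj₁ (gst , _)) = ¬gst gst
      ... | inj₂ (inj₂ (gst , _)) = ¬gst gst

-- The Tutte polynomial at (1,0) and (0,1)

sgn² : ∀ k → sgn k * sgn k ≡ 1ℤ
sgn² zero    = refl
sgn² (suc k) = trans (square (sgn k)) (sgn² k)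
  where
  square : ∀ i → (-1ℤ * i) * (-1ℤ * i) ≡ i * i
  square = solve-∀

sgn-+ : ∀ j k → sgn (j ℕ.+ k) ≡ sgn j * sgn k
sgn-+ = ℤ.^-distribˡ-+-* -1ℤ

0^suc : ∀ k → 0ℤ ^ suc k ≡ 0ℤ
0^suc k = ℤ.*-zeroˡ (0ℤ ^ k)

private
  sgn-parity : ∀ {v l c k} → v ℕ.+ k ≡ l ℕ.+ c → sgn k ≡ sgn (v ℕ.+ c) * sgn l
  sgn-parity {v} {l} {c} {k} eq = begin
    sgn k                                     ≡⟨ ℤ.*-identityˡ (sgn k) ⟨
    1ℤ * sgn k                                ≡⟨ cong (_* sgn k) (sgn² v) ⟨
    sgn v * sgn v * sgn k                     ≡⟨ ℤ.*-assoc (sgn v) (sgn v) (sgn k) ⟩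
    sgn v * (sgn v * sgn k)                   ≡⟨ cong (sgn v *_) (sgn-+ v k) ⟨
    sgn v * sgn (v ℕ.+ k)                     ≡⟨ cong (λ j → sgn v * sgn j) eq ⟩
    sgn v * sgn (l ℕ.+ c)                     ≡⟨ cong (sgn v *_) (sgn-+ l c) ⟩
    sgn v * (sgn l * sgn c)                   ≡⟨ rearrange (sgn v) (sgn l) (sgn c) ⟩
    sgn v * sgn c * sgn l                     ≡⟨ cong (_* sgn l) (sgn-+ v c) ⟨
    sgn (v ℕ.+ c) * sgn l                     ∎
    where
    open ≡-Reasoning
    rearrange : ∀ i j k → i * (j * k) ≡ i * k * j
    rearrange = solve-∀

  zeroˡʳ : ∀ {i} j k l → i ≡ 0ℤ → i * j ≡ k * (l * 0ℤ)
  zeroˡʳ j k l refl = trans (ℤ.*-zeroˡ j) (sym (trans (cong (k *_) (ℤ.*-zeroʳ l)) (ℤ.*-zeroʳ k)))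

  -- The power of 0 selects the connected subgraphs, whose nullity has the parity of v + 1 + l.
  term-1-0 : ∀ v l c k → 1 ℕ.≤ c → v ℕ.+ k ≡ l ℕ.+ c →
             0ℤ ^ (c ∸ 1) * sgn k ≡ sgn (suc v) * (sgn l * 𝟙 (c ℕ.≟ 1))
  term-1-0 v l 1 k _ eq = begin
    1ℤ * sgn k                    ≡⟨ ℤ.*-identityˡ (sgn k) ⟩
    sgn k                         ≡⟨ sgn-parity {v} {l} {1} eq ⟩
    sgn (v ℕ.+ 1) * sgn l         ≡⟨ cong (λ j → sgn j * sgn l) (ℕ.+-comm v 1) ⟩
    sgn (suc v) * sgn l           ≡⟨ cong (sgn (suc v) *_) (ℤ.*-identityʳ (sgn l)) ⟨
    sgn (suc v) * (sgn l * 1ℤ)    ∎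
    where open ≡-Reasoning
  term-1-0 v l (suc (suc c)) k _ _ = zeroˡʳ (sgn k) (sgn (suc v)) (sgn l) (0^suc c)

  -- Only forests contribute, and for them c = v - l, so that c - 1 has the parity of v + 1 + l.
  term-0-1 : ∀ v l c k → 1 ℕ.≤ c → v ℕ.+ k ≡ l ℕ.+ c →
             sgn (c ∸ 1) * 0ℤ ^ k ≡ sgn (suc v) * (sgn l * 0ℤ ^ k)
  term-0-1 v l (suc c) zero _ eq = trans (cong (_* 1ℤ) (begin
    sgn c                         ≡⟨ double-negation (sgn c) ⟩
    -1ℤ * sgn (suc c)             ≡⟨ cong (-1ℤ *_) (sgn-parity {l} {v} {0} (sym eq)) ⟩
    -1ℤ * (sgn (l ℕ.+ 0) * sgn v) ≡⟨ cong (λ j → -1ℤ * (sgn j * sgn v)) (ℕ.+-identityʳ l) ⟩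
    -1ℤ * (sgn l * sgn v)         ≡⟨ rearrange (sgn l) (sgn v) ⟩
    sgn (suc v) * sgn l           ∎)) (ℤ.*-assoc (sgn (suc v)) (sgn l) 1ℤ)
    where
    open ≡-Reasoning
    double-negation : ∀ i → i ≡ -1ℤ * (-1ℤ * i)
    double-negation = solve-∀
    rearrange : ∀ i j → -1ℤ * (i * j) ≡ -1ℤ * j * i
    rearrange = solve-∀
  term-0-1 v l (suc c) (suc k) _ _ = trans (ℤ.*-comm (sgn c) (0ℤ ^ suc k))
    (trans (zeroˡʳ (sgn c) (sgn (suc v)) (sgn l) (0^suc k))
      (cong (λ i → sgn (suc v) * (sgn l * i)) (sym (0^suc k))))

module _ {v : ℕ} where

  private variable
    H L : Graph v

  v+nullity : ∀ (H : Graph v) → v ℕ.+ nullity H ≡ length H ℕ.+ components H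
  v+nullity H = ℕ.m+[n∸m]≡n (subst₂ ℕ._≤_ (components-[] {v}) (cong (λ A → length H ℕ.+ components A) (++-identityʳ H))
    (components-++-≤ {C = []} H))

  rank-deficit : components L ≡ 1 → ∀ (H : Graph v) → rank L ∸ rank H ≡ components H ∸ 1
  rank-deficit {L} c≡1 H = begin
    v ∸ components L ∸ (v ∸ components H)    ≡⟨ cong (λ c → v ∸ c ∸ (v ∸ components H)) c≡1 ⟩
    v ∸ 1 ∸ (v ∸ components H)               ≡⟨ ℕ.∸-+-assoc v 1 _ ⟩
    v ∸ (1 ℕ.+ (v ∸ components H))           ≡⟨ cong (v ∸_) (ℕ.+-comm 1 _) ⟩
    v ∸ ((v ∸ components H) ℕ.+ 1)           ≡⟨ ℕ.∸-+-assoc v (v ∸ components H) 1 ⟨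
    v ∸ (v ∸ components H) ∸ 1               ≡⟨ cong (_∸ 1) (ℕ.m∸[m∸n]≡n (components≤v H)) ⟩
    components H ∸ 1                         ∎
    where open ≡-Reasoning

  tutte-1-0 : Fin v → components L ≡ 1 → tutte L 1ℤ 0ℤ ≡ sgn (suc v) * connectedSum [] L
  tutte-1-0 {L} r c≡1 = trans
    (∑-cong (spanningSubgraphs L)
      {g = λ H → sgn (suc v) * (sgn (length H) * 𝟙 (components (H ++ []) ℕ.≟ 1))} λ H →
      trans (cong (λ j → 0ℤ ^ j * sgn (nullity H)) (rank-deficit {L} c≡1 H))
      (trans (term-1-0 v (length H) (components H) (nullity H) (components-positive r H) (v+nullity H))
             (cong (λ A → sgn (suc v) * (sgn (length H) * 𝟙 (components A ℕ.≟ 1))) (sym (++-identityʳ H)))))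
    (∑-* (spanningSubgraphs L) (sgn (suc v)) _)

  0^nullity : ∀ (H : Graph v) → 0ℤ ^ nullity H ≡
              𝟙 (length H ℕ.+ components (H ++ []) ℕ.≟ components {v} [])
  0^nullity H rewrite ++-identityʳ H | components-[] {v} = case (nullity H) (v+nullity H)
    where
    case : ∀ {j} k → v ℕ.+ k ≡ j → 0ℤ ^ k ≡ 𝟙 (j ℕ.≟ v)
    case {j} zero    eq = sym (𝟙-yes (j ℕ.≟ v) (trans (sym eq) (ℕ.+-identityʳ v)))
    case {j} (suc k) eq = trans (0^suc k) (sym (𝟙-no (j ℕ.≟ v) λ j≡v →
      ℕ.m≢1+m+n v (trans (sym j≡v) (trans (sym eq) (ℕ.+-suc v k)))))

  tutte-0-1 : Fin v → components L ≡ 1 → tutte L 0ℤ 1ℤ ≡ sgn (suc v) * forestSum [] L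
  tutte-0-1 {L} r c≡1 = trans
    (∑-cong (spanningSubgraphs L)
      {g = λ H → sgn (suc v) * (sgn (length H) *
                   𝟙 (length H ℕ.+ components (H ++ []) ℕ.≟ components {v} []))} λ H →
      trans (cong (λ j → sgn j * 0ℤ ^ nullity H) (rank-deficit {L} c≡1 H))
      (trans (term-0-1 v (length H) (components H) (nullity H) (components-positive r H) (v+nullity H))
             (cong (λ i → sgn (suc v) * (sgn (length H) * i)) (0^nullity H))))
    (∑-* (spanningSubgraphs L) (sgn (suc v)) _)

-- Abstract, since on Fin (suc _) these counts would unfold to the reachability
-- algorithm whenever two of them are compared.
abstract

  κ : ∀ {v} → Graph v → ℕ
  κ = components

  ν : ∀ {v} → Graph v → ℕ
  ν = nullity

  joined? : ∀ {k} (H : Graph (2 ℕ.+ k)) → Dec (Connected H X Y)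
  joined? H = connected? H X Y

  κ≡components : ∀ {v} (H : Graph v) → κ H ≡ components H
  κ≡components H = refl

  ν≡nullity : ∀ {v} (H : Graph v) → ν H ≡ nullity H
  ν≡nullity H = refl

  v+ν : ∀ {v} (H : Graph v) → v ℕ.+ ν H ≡ length H ℕ.+ κ H
  v+ν = v+nullity

  κ-[] : ∀ {v} → κ {v} [] ≡ v
  κ-[] = components-[]

  κ-positive : ∀ {v} → Fin v → (H : Graph v) → 1 ℕ.≤ κ H
  κ-positive = components-positive

  κ-∷ : ∀ {v} (H : Graph v) x y → (Connected H x y × κ ((x , y) ∷ H) ≡ κ H)
                                ⊎ (¬ Connected H x y × κ H ≡ suc (κ ((x , y) ∷ H)))
  κ-∷ = components-∷

  κ-bridge : ∀ {v} {H : Graph v} {x y} → ¬ Connected H x y → κ H ≡ suc (κ ((x , y) ∷ H))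
  κ-bridge = components-bridge

  κ-resp-⊆ : ∀ {v} {A B : Graph v} → A ⊆ B → B ⊆ A → κ A ≡ κ B
  κ-resp-⊆ = components-resp-⊆

  κ-weld : ∀ {m v} (g : Fin m → Fin v) (g-injective : ∀ {x y} → g x ≡ g y → x ≡ y)
    {s t : Fin m} (s≢t : s ≢ t) {C : Graph v} → Weld.OuterGraph g g-injective s≢t C →
    ∀ H (st? : Dec (Connected H s t)) →
    κ (mapEdges g H ++ C) ℕ.+ m ≡ κ (edge? (does st?) (g s , g t) ++ C) ℕ.+ κ H ℕ.+ bit (does st?)
  κ-weld g g-injective s≢t = Weld.components-weld g g-injective s≢t

-- Component counts relative to the two special vertices

κ-exchange : ∀ {v} (A M B : Graph v) → κ (A ++ M ++ B) ≡ κ (M ++ A ++ B)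
κ-exchange A M B = κ-resp-⊆ (forth A M) (forth M A)
  where
  forth : ∀ A M → (A ++ M ++ B) ⊆ (M ++ A ++ B)
  forth A M e with ∈-++⁻ A e
  ... | inj₁ e∈A = ∈-++⁺ʳ M (∈-++⁺ˡ e∈A)
  ... | inj₂ e∈MB with ∈-++⁻ M e∈MB
  ...   | inj₁ e∈M = ∈-++⁺ˡ e∈M
  ...   | inj₂ e∈B = ∈-++⁺ʳ M (∈-++⁺ʳ A e∈B)

κ-regroup : ∀ {v} (L A B : Graph v) → κ (L ++ A ++ B) ≡ κ ((A ++ L) ++ B)
κ-regroup L A B = trans (κ-exchange L A B) (cong κ (sym (++-assoc A L B)))

κ-edge? : ∀ {v} {x y : Fin v} → x ≢ y → ∀ β → κ (edge? β (x , y) ++ []) ℕ.+ bit β ≡ v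
κ-edge? x≢y false = trans (ℕ.+-identityʳ _) κ-[]
κ-edge? x≢y true  = trans (ℕ.+-comm _ 1) (trans (sym (κ-bridge (no-edges x≢y))) κ-[])

κ-mapEdges : ∀ {m v} (g : Fin m → Fin v) (g-injective : ∀ {x y} → g x ≡ g y → x ≡ y) {s t : Fin m} → s ≢ t →
  ∀ H → κ (mapEdges g H) ℕ.+ m ≡ v ℕ.+ κ H
κ-mapEdges {m} {v} g g-injective {s} {t} s≢t H = begin
  κ (mapEdges g H) ℕ.+ m
    ≡⟨ cong (λ A → κ A ℕ.+ m) (++-identityʳ (mapEdges g H)) ⟨
  κ (mapEdges g H ++ []) ℕ.+ m
    ≡⟨ κ-weld g g-injective s≢t [] H (connected? H s t) ⟩
  l ℕ.+ κ H ℕ.+ i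
    ≡⟨ rearrange l (κ H) i ⟩
  l ℕ.+ i ℕ.+ κ H
    ≡⟨ cong (ℕ._+ κ H) (κ-edge? (λ eq → s≢t (g-injective eq)) (does (connected? H s t))) ⟩
  v ℕ.+ κ H ∎
  where
  open ≡-Reasoning
  l i : ℕ
  l = κ (edge? (does (connected? H s t)) (g s , g t) ++ [])
  i = bit (does (connected? H s t))
  rearrange : ∀ i j k → i ℕ.+ j ℕ.+ k ≡ i ℕ.+ k ℕ.+ j
  rearrange = solve-∀ᴺ

joined : ∀ {k} → Graph (2 ℕ.+ k) → Bool
joined H = does (joined? H)

-- The number of components that contain neither `X` nor `Y`. These are untouched when copies are
-- glued together.
excess : ∀ {k} → Graph (2 ℕ.+ k) → ℕ
excess H = κ H ℕ.+ bit (joined H) ∸ 2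

2+excess : ∀ {k} (H : Graph (2 ℕ.+ k)) → κ H ℕ.+ bit (joined H) ≡ 2 ℕ.+ excess H
2+excess H = sym (ℕ.m+[n∸m]≡n (two (joined? H)))
  where
  two : (d : Dec (Connected H X Y)) → 2 ℕ.≤ κ H ℕ.+ bit (does d)
  two (yes _)   = ℕ.+-monoˡ-≤ 1 (κ-positive X H)
  two (no X≁Y) = subst (λ c → 2 ℕ.≤ c ℕ.+ 0) (sym (κ-bridge X≁Y))
    (ℕ.s≤s (ℕ.≤-trans (κ-positive X ((X , Y) ∷ H)) (ℕ.m≤m+n _ 0)))

-- The number c₀ counts the components of the glued graph, cⱼ those left after the first j copies
-- have been replaced by links. A replacement isolates the `i` inner vertices of a copy and removes
-- its excess; the last graph is the one on four vertices with 4i isolated vertices added.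
weld-arithmetic : ∀ i {c₀ c₁ c₂ c₃ c₄ c d₁ d₂ d₃ d₄ e₁ e₂ e₃ e₄} →
  c₀ ℕ.+ (2 ℕ.+ i) ≡ c₁ ℕ.+ d₁ → c₁ ℕ.+ (2 ℕ.+ i) ≡ c₂ ℕ.+ d₂ →
  c₂ ℕ.+ (2 ℕ.+ i) ≡ c₃ ℕ.+ d₃ → c₃ ℕ.+ (2 ℕ.+ i) ≡ c₄ ℕ.+ d₄ →
  d₁ ≡ 2 ℕ.+ e₁ → d₂ ≡ 2 ℕ.+ e₂ → d₃ ≡ 2 ℕ.+ e₃ → d₄ ≡ 2 ℕ.+ e₄ →
  c₄ ≡ c ℕ.+ 4 ℕ.* i → c₀ ≡ c ℕ.+ (e₁ ℕ.+ e₂ ℕ.+ e₃ ℕ.+ e₄)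
weld-arithmetic i {c₀} {c₁} {c₂} {c₃} {c₄} {c} {e₁ = e₁} {e₂} {e₃} {e₄} eq₁ eq₂ eq₃ eq₄ refl refl refl refl refl =
  ℕ.+-cancelʳ-≡ (4 ℕ.* i ℕ.+ 8) _ _ (begin
    c₀ ℕ.+ (4 ℕ.* i ℕ.+ 8)
      ≡⟨ ring₁ c₀ i ⟩
    c₀ ℕ.+ (2 ℕ.+ i) ℕ.+ (3 ℕ.* i ℕ.+ 6)
      ≡⟨ cong (ℕ._+ (3 ℕ.* i ℕ.+ 6)) eq₁ ⟩
    c₁ ℕ.+ (2 ℕ.+ e₁) ℕ.+ (3 ℕ.* i ℕ.+ 6)
      ≡⟨ ring₂ c₁ e₁ i ⟩
    c₁ ℕ.+ (2 ℕ.+ i) ℕ.+ (2 ℕ.* i ℕ.+ 6 ℕ.+ e₁)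
      ≡⟨ cong (ℕ._+ (2 ℕ.* i ℕ.+ 6 ℕ.+ e₁)) eq₂ ⟩
    c₂ ℕ.+ (2 ℕ.+ e₂) ℕ.+ (2 ℕ.* i ℕ.+ 6 ℕ.+ e₁)
      ≡⟨ ring₃ c₂ e₁ e₂ i ⟩
    c₂ ℕ.+ (2 ℕ.+ i) ℕ.+ (i ℕ.+ 6 ℕ.+ e₁ ℕ.+ e₂)
      ≡⟨ cong (ℕ._+ (i ℕ.+ 6 ℕ.+ e₁ ℕ.+ e₂)) eq₃ ⟩
    c₃ ℕ.+ (2 ℕ.+ e₃) ℕ.+ (i ℕ.+ 6 ℕ.+ e₁ ℕ.+ e₂)
      ≡⟨ ring₄ c₃ e₁ e₂ e₃ i ⟩
    c₃ ℕ.+ (2 ℕ.+ i) ℕ.+ (6 ℕ.+ e₁ ℕ.+ e₂ ℕ.+ e₃)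
      ≡⟨ cong (ℕ._+ (6 ℕ.+ e₁ ℕ.+ e₂ ℕ.+ e₃)) eq₄ ⟩
    c ℕ.+ 4 ℕ.* i ℕ.+ (2 ℕ.+ e₄) ℕ.+ (6 ℕ.+ e₁ ℕ.+ e₂ ℕ.+ e₃)
      ≡⟨ ring₅ c e₁ e₂ e₃ e₄ i ⟩
    c ℕ.+ (e₁ ℕ.+ e₂ ℕ.+ e₃ ℕ.+ e₄) ℕ.+ (4 ℕ.* i ℕ.+ 8) ∎)
  where
  open ≡-Reasoning
  ring₁ : ∀ c i → c ℕ.+ (4 ℕ.* i ℕ.+ 8) ≡ c ℕ.+ (2 ℕ.+ i) ℕ.+ (3 ℕ.* i ℕ.+ 6)
  ring₁ = solve-∀ᴺ
  ring₂ : ∀ c e i → c ℕ.+ (2 ℕ.+ e) ℕ.+ (3 ℕ.* i ℕ.+ 6) ≡ c ℕ.+ (2 ℕ.+ i) ℕ.+ (2 ℕ.* i ℕ.+ 6 ℕ.+ e)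
  ring₂ = solve-∀ᴺ
  ring₃ : ∀ c e e′ i → c ℕ.+ (2 ℕ.+ e′) ℕ.+ (2 ℕ.* i ℕ.+ 6 ℕ.+ e) ≡ c ℕ.+ (2 ℕ.+ i) ℕ.+ (i ℕ.+ 6 ℕ.+ e ℕ.+ e′)
  ring₃ = solve-∀ᴺ
  ring₄ : ∀ c e e′ e″ i → c ℕ.+ (2 ℕ.+ e″) ℕ.+ (i ℕ.+ 6 ℕ.+ e ℕ.+ e′) ≡ c ℕ.+ (2 ℕ.+ i) ℕ.+ (6 ℕ.+ e ℕ.+ e′ ℕ.+ e″)
  ring₄ = solve-∀ᴺ
  ring₅ : ∀ c e e′ e″ e‴ i → c ℕ.+ 4 ℕ.* i ℕ.+ (2 ℕ.+ e‴) ℕ.+ (6 ℕ.+ e ℕ.+ e′ ℕ.+ e″) ≡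
                              c ℕ.+ (e ℕ.+ e′ ℕ.+ e″ ℕ.+ e‴) ℕ.+ (4 ℕ.* i ℕ.+ 8)
  ring₅ = solve-∀ᴺ

private
  sum₄ : ∀ {w x y z w′ x′ y′ z′ : ℕ} → w ≡ w′ → x ≡ x′ → y ≡ y′ → z ≡ z′ →
         w ℕ.+ x ℕ.+ y ℕ.+ z ≡ w′ ℕ.+ x′ ℕ.+ y′ ℕ.+ z′
  sum₄ refl refl refl refl = refl

-- Adding Σ (κ Hᵢ + bᵢ) = Σ (2 + eᵢ) and Σ (2 + i + νᵢ) = Σ (lᵢ + κ Hᵢ) to the two
-- equations for the nullities, the terms in lᵢ, κ Hᵢ, bᵢ and eᵢ cancel.
ν-arithmetic : ∀ i ch {ν′ ν₀ k b₁ b₂ b₃ b₄ l₁ l₂ l₃ l₄ e₁ e₂ e₃ e₄ k₁ k₂ k₃ k₄ ν₁ ν₂ ν₃ ν₄} →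
  4 ℕ.+ 4 ℕ.* i ℕ.+ ν′ ≡ ch ℕ.+ (l₁ ℕ.+ (l₂ ℕ.+ (l₃ ℕ.+ (l₄ ℕ.+ 0)))) ℕ.+ (k ℕ.+ (e₁ ℕ.+ e₂ ℕ.+ e₃ ℕ.+ e₄)) →
  4 ℕ.+ ν₀ ≡ ch ℕ.+ (b₁ ℕ.+ (b₂ ℕ.+ (b₃ ℕ.+ b₄))) ℕ.+ k →
  k₁ ℕ.+ b₁ ≡ 2 ℕ.+ e₁ → k₂ ℕ.+ b₂ ≡ 2 ℕ.+ e₂ → k₃ ℕ.+ b₃ ≡ 2 ℕ.+ e₃ → k₄ ℕ.+ b₄ ≡ 2 ℕ.+ e₄ →
  2 ℕ.+ i ℕ.+ ν₁ ≡ l₁ ℕ.+ k₁ → 2 ℕ.+ i ℕ.+ ν₂ ≡ l₂ ℕ.+ k₂ →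
  2 ℕ.+ i ℕ.+ ν₃ ≡ l₃ ℕ.+ k₃ → 2 ℕ.+ i ℕ.+ ν₄ ≡ l₄ ℕ.+ k₄ →
  ν′ ≡ ν₀ ℕ.+ (ν₁ ℕ.+ ν₂ ℕ.+ ν₃ ℕ.+ ν₄)
ν-arithmetic i ch {ν′} {ν₀} {k} {b₁} {b₂} {b₃} {b₄} {l₁} {l₂} {l₃} {l₄} {e₁} {e₂} {e₃} {e₄}
  {k₁} {k₂} {k₃} {k₄} {ν₁} {ν₂} {ν₃} {ν₄}
  eq′ eq₀ x₁ x₂ x₃ x₄ y₁ y₂ y₃ y₄ =
  ℕ.+-cancelʳ-≡ (4 ℕ.+ 4 ℕ.* i ℕ.+ (k₁ ℕ.+ b₁ ℕ.+ (k₂ ℕ.+ b₂) ℕ.+ (k₃ ℕ.+ b₃) ℕ.+ (k₄ ℕ.+ b₄))) ν′ _ (begin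
    ν′ ℕ.+ (4 ℕ.+ 4 ℕ.* i ℕ.+ B)
      ≡⟨ ring₁ ν′ i B ⟩
    4 ℕ.+ 4 ℕ.* i ℕ.+ ν′ ℕ.+ B
      ≡⟨ cong (ℕ._+ B) eq′ ⟩
    ch ℕ.+ (l₁ ℕ.+ (l₂ ℕ.+ (l₃ ℕ.+ (l₄ ℕ.+ 0)))) ℕ.+ (k ℕ.+ (e₁ ℕ.+ e₂ ℕ.+ e₃ ℕ.+ e₄)) ℕ.+ B
      ≡⟨ ring₂ ch l₁ l₂ l₃ l₄ k (e₁ ℕ.+ e₂ ℕ.+ e₃ ℕ.+ e₄) k₁ k₂ k₃ k₄ b₁ b₂ b₃ b₄ ⟩
    ch ℕ.+ (b₁ ℕ.+ (b₂ ℕ.+ (b₃ ℕ.+ b₄))) ℕ.+ k ℕ.+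
      (l₁ ℕ.+ k₁ ℕ.+ (l₂ ℕ.+ k₂) ℕ.+ (l₃ ℕ.+ k₃) ℕ.+ (l₄ ℕ.+ k₄)) ℕ.+ (e₁ ℕ.+ e₂ ℕ.+ e₃ ℕ.+ e₄)
      ≡⟨ cong₂ (λ j l → j ℕ.+ l ℕ.+ (e₁ ℕ.+ e₂ ℕ.+ e₃ ℕ.+ e₄)) (sym eq₀) (sym (sum₄ y₁ y₂ y₃ y₄)) ⟩
    4 ℕ.+ ν₀ ℕ.+ (2 ℕ.+ i ℕ.+ ν₁ ℕ.+ (2 ℕ.+ i ℕ.+ ν₂) ℕ.+ (2 ℕ.+ i ℕ.+ ν₃) ℕ.+ (2 ℕ.+ i ℕ.+ ν₄)) ℕ.+ (e₁ ℕ.+ e₂ ℕ.+ e₃ ℕ.+ e₄)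
      ≡⟨ ring₃ ν₀ i ν₁ ν₂ ν₃ ν₄ e₁ e₂ e₃ e₄ ⟩
    ν₀ ℕ.+ (ν₁ ℕ.+ ν₂ ℕ.+ ν₃ ℕ.+ ν₄) ℕ.+ (4 ℕ.+ 4 ℕ.* i ℕ.+ (2 ℕ.+ e₁ ℕ.+ (2 ℕ.+ e₂) ℕ.+ (2 ℕ.+ e₃) ℕ.+ (2 ℕ.+ e₄)))
      ≡⟨ cong (λ j → ν₀ ℕ.+ (ν₁ ℕ.+ ν₂ ℕ.+ ν₃ ℕ.+ ν₄) ℕ.+ (4 ℕ.+ 4 ℕ.* i ℕ.+ j)) (sum₄ x₁ x₂ x₃ x₄) ⟨
    ν₀ ℕ.+ (ν₁ ℕ.+ ν₂ ℕ.+ ν₃ ℕ.+ ν₄) ℕ.+ (4 ℕ.+ 4 ℕ.* i ℕ.+ B) ∎)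
  where
  open ≡-Reasoning
  B : ℕ
  B = k₁ ℕ.+ b₁ ℕ.+ (k₂ ℕ.+ b₂) ℕ.+ (k₃ ℕ.+ b₃) ℕ.+ (k₄ ℕ.+ b₄)
  ring₁ : ∀ n i B → n ℕ.+ (4 ℕ.+ 4 ℕ.* i ℕ.+ B) ≡ 4 ℕ.+ 4 ℕ.* i ℕ.+ n ℕ.+ B
  ring₁ = solve-∀ᴺ
  ring₂ : ∀ ch l₁ l₂ l₃ l₄ k e k₁ k₂ k₃ k₄ b₁ b₂ b₃ b₄ →
    ch ℕ.+ (l₁ ℕ.+ (l₂ ℕ.+ (l₃ ℕ.+ (l₄ ℕ.+ 0)))) ℕ.+ (k ℕ.+ e) ℕ.+
      (k₁ ℕ.+ b₁ ℕ.+ (k₂ ℕ.+ b₂) ℕ.+ (k₃ ℕ.+ b₃) ℕ.+ (k₄ ℕ.+ b₄)) ≡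
    ch ℕ.+ (b₁ ℕ.+ (b₂ ℕ.+ (b₃ ℕ.+ b₄))) ℕ.+ k ℕ.+ (l₁ ℕ.+ k₁ ℕ.+ (l₂ ℕ.+ k₂) ℕ.+ (l₃ ℕ.+ k₃) ℕ.+ (l₄ ℕ.+ k₄)) ℕ.+ e
  ring₂ = solve-∀ᴺ
  ring₃ : ∀ n i n₁ n₂ n₃ n₄ e₁ e₂ e₃ e₄ →
    4 ℕ.+ n ℕ.+ (2 ℕ.+ i ℕ.+ n₁ ℕ.+ (2 ℕ.+ i ℕ.+ n₂) ℕ.+ (2 ℕ.+ i ℕ.+ n₃) ℕ.+ (2 ℕ.+ i ℕ.+ n₄)) ℕ.+ (e₁ ℕ.+ e₂ ℕ.+ e₃ ℕ.+ e₄) ≡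
    n ℕ.+ (n₁ ℕ.+ n₂ ℕ.+ n₃ ℕ.+ n₄) ℕ.+ (4 ℕ.+ 4 ℕ.* i ℕ.+ (2 ℕ.+ e₁ ℕ.+ (2 ℕ.+ e₂) ℕ.+ (2 ℕ.+ e₃) ℕ.+ (2 ℕ.+ e₄)))
  ring₃ = solve-∀ᴺ

-- `X` and `Y` are joined exactly if an additional edge between them leaves the count unchanged.
-- This allows graphs on different vertex sets to be compared through their counts alone.
joined-transfer : ∀ {k l} (H : Graph (2 ℕ.+ k)) (K : Graph (2 ℕ.+ l)) e → κ H ≡ κ K ℕ.+ e →
  κ ((X , Y) ∷ H) ≡ κ ((X , Y) ∷ K) ℕ.+ e → joined H ≡ joined K
joined-transfer H K e eq eq′ = case (joined? H) (joined? K) (κ-∷ H X Y) (κ-∷ K X Y)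
  where
  case : (h : Dec (Connected H X Y)) (k : Dec (Connected K X Y)) →
    (Connected H X Y × κ ((X , Y) ∷ H) ≡ κ H) ⊎ (¬ Connected H X Y × κ H ≡ suc (κ ((X , Y) ∷ H))) →
    (Connected K X Y × κ ((X , Y) ∷ K) ≡ κ K) ⊎ (¬ Connected K X Y × κ K ≡ suc (κ ((X , Y) ∷ K))) →
    does h ≡ does k
  case (yes _) (yes _) _ _ = refl
  case (no _)  (no _)  _ _ = refl
  case (yes p) (no ¬p) (inj₂ (¬p′ , _)) _ = contradiction p ¬p′
  case (yes p) (no ¬p) _ (inj₁ (p′ , _)) = contradiction p′ ¬p
  case (yes p) (no ¬p) (inj₁ (_ , h)) (inj₂ (_ , k)) = contradiction
    (trans (sym eq′) (trans h (trans eq (cong (ℕ._+ e) k)))) (ℕ.1+n≢n ∘ sym)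
  case (no ¬p) (yes p) _ (inj₂ (¬p′ , _)) = contradiction p ¬p′
  case (no ¬p) (yes p) (inj₁ (p′ , _)) _ = contradiction p′ ¬p
  case (no ¬p) (yes p) (inj₂ (_ , h)) (inj₁ (_ , k)) = contradiction
    (trans (sym h) (trans eq (trans (cong (ℕ._+ e) (sym k)) (sym eq′)))) ℕ.1+n≢n

-- The copies of Gₙ in Gₙ₊₁

module Step (n : ℕ) where

  Boundary : Vertex (suc n) → Set
  Boundary (other _) = ⊥
  Boundary _         = ⊤

  glue-X-boundary : ∀ i → Boundary (glue n i X)
  glue-X-boundary copy₁ = tt
  glue-X-boundary copy₂ = tt
  glue-X-boundary copy₃ = tt
  glue-X-boundary copy₄ = tt

  glue-Y-boundary : ∀ i → Boundary (glue n i Y)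
  glue-Y-boundary copy₁ = tt
  glue-Y-boundary copy₂ = tt
  glue-Y-boundary copy₃ = tt
  glue-Y-boundary copy₄ = tt

  glue-X≢Y : ∀ i → glue n i X ≢ glue n i Y
  glue-X≢Y copy₁ ()
  glue-X≢Y copy₂ ()
  glue-X≢Y copy₃ ()
  glue-X≢Y copy₄ ()

  glue-inner : ∀ i w → glue n i (suc (suc w)) ≡ other (combine i w)
  glue-inner copy₁ w = refl
  glue-inner copy₂ w = refl
  glue-inner copy₃ w = refl
  glue-inner copy₄ w = refl

  boundary≢other : ∀ {z w} → Boundary z → z ≢ other w
  boundary≢other () refl

  other-injective : ∀ {w w′} → _≡_ {A = Vertex (suc n)} (other w) (other w′) → w ≡ w′
  other-injective refl = refl

  glue-injective : ∀ i {x y} → glue n i x ≡ glue n i y → x ≡ y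
  glue-injective i {X} {X} eq = refl
  glue-injective i {X} {Y} eq = contradiction eq (glue-X≢Y i)
  glue-injective i {Y} {X} eq = contradiction (sym eq) (glue-X≢Y i)
  glue-injective i {Y} {Y} eq = refl
  glue-injective i {X} {suc (suc w)} eq =
    contradiction (trans eq (glue-inner i w)) (boundary≢other (glue-X-boundary i))
  glue-injective i {Y} {suc (suc w)} eq =
    contradiction (trans eq (glue-inner i w)) (boundary≢other (glue-Y-boundary i))
  glue-injective i {suc (suc w)} {X} eq =
    contradiction (trans (sym eq) (glue-inner i w)) (boundary≢other (glue-X-boundary i))
  glue-injective i {suc (suc w)} {Y} eq =
    contradiction (trans (sym eq) (glue-inner i w)) (boundary≢other (glue-Y-boundary i))
  glue-injective i {suc (suc w)} {suc (suc w′)} eq = cong (λ w → suc (suc w))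
    (Fin.combine-injectiveʳ i w i w′
      (other-injective (trans (sym (glue-inner i w)) (trans eq (glue-inner i w′)))))

  X≢Y : _≢_ {A = Vertex n} X Y
  X≢Y ()

  module Copy (i : Fin 4) = Weld (glue n i) (glue-injective i) {X} {Y} X≢Y

  boundary-outer : ∀ i {z} → Boundary z → Copy.Outer i z
  boundary-outer i β X eq = inj₁ refl
  boundary-outer i β Y eq = inj₂ refl
  boundary-outer i β (suc (suc w)) eq =
    contradiction (trans eq (glue-inner i w)) (boundary≢other β)

  copy-outer : ∀ {i j} → i ≢ j → ∀ u → Copy.Outer i (glue n j u)
  copy-outer {i} {j} i≢j X = boundary-outer i (glue-X-boundary j)
  copy-outer {i} {j} i≢j Y = boundary-outer i (glue-Y-boundary j)
  copy-outer {i} {j} i≢j (suc (suc w)) X eq = inj₁ refl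
  copy-outer {i} {j} i≢j (suc (suc w)) Y eq = inj₂ refl
  copy-outer {i} {j} i≢j (suc (suc w)) (suc (suc w′)) eq =
    contradiction (Fin.combine-injectiveˡ i w′ j w (other-injective
      (trans (sym (glue-inner i w′)) (trans (sym eq) (glue-inner j w))))) i≢j

  copy-outerGraph : ∀ {i j} → i ≢ j → ∀ H → Copy.OuterGraph i (mapEdges (glue n j) H)
  copy-outerGraph i≢j H = All.map⁺ (All.universal (λ (x , y) → copy-outer i≢j x , copy-outer i≢j y) H)

  BoundaryGraph : Graph (2 ℕ.+ inner (suc n)) → Set
  BoundaryGraph = All (λ (x , y) → Boundary x × Boundary y)

  private
    m : ℕ
    m = 2 ℕ.+ inner n

  embed : Fin 4 → Vertex (suc n)
  embed x = x ↑ˡ (4 ℕ.* inner n)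

  link : Fin 4 → Graph m → Graph (2 ℕ.+ inner (suc n))
  link i H = edge? (joined H) (glue n i X , glue n i Y)

  -- To be applied with `A` holding the links of the copies already replaced and `B` the copies
  -- still to come.
  κ-copy : ∀ i A H B → Copy.OuterGraph i A → Copy.OuterGraph i B →
    (d : Dec (Connected H X Y)) →
    κ (A ++ mapEdges (glue n i) H ++ B) ℕ.+ m ≡
    κ ((A ++ edge? (does d) (glue n i X , glue n i Y)) ++ B) ℕ.+ (κ H ℕ.+ bit (does d))
  κ-copy i A H B oA oB d = trans
    (cong (ℕ._+ m) (κ-exchange A (mapEdges (glue n i) H) B))
    (trans (κ-weld (glue n i) (glue-injective i) {X} {Y} X≢Y {C = A ++ B} (All.++⁺ oA oB) H d)
    (trans (ℕ.+-assoc (κ (edge? (does d) (glue n i X , glue n i Y) ++ A ++ B)) (κ H) (bit (does d)))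
           (cong (ℕ._+ (κ H ℕ.+ bit (does d)))
             (κ-regroup (edge? (does d) (glue n i X , glue n i Y)) A B))))

  boundary-outerGraph : ∀ i {A} → BoundaryGraph A → Copy.OuterGraph i A
  boundary-outerGraph i = All.map λ (βx , βy) → boundary-outer i βx , boundary-outer i βy

  boundary-++-link : ∀ i {A} H → BoundaryGraph A → BoundaryGraph (A ++ link i H)
  boundary-++-link i H β = All.++⁺ β (link-boundary (joined H))
    where
    link-boundary : ∀ β → BoundaryGraph (edge? β (glue n i X , glue n i Y))
    link-boundary true  = (glue-X-boundary i , glue-Y-boundary i) ∷ []
    link-boundary false = []

  welded : (H₁ H₂ H₃ H₄ : Graph m) → Graph (2 ℕ.+ inner (suc n))
  welded H₁ H₂ H₃ H₄ =
    mapEdges (glue n copy₁) H₁ ++ mapEdges (glue n copy₂) H₂ ++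
    mapEdges (glue n copy₃) H₃ ++ mapEdges (glue n copy₄) H₄ ++ []

  -- The 4-cycle X a Y b in which each copy of Gₙ is shrunk to an edge or deleted.
  cycle : Bool → Bool → Bool → Bool → Graph 4
  cycle s₁ s₂ s₃ s₄ = edge? s₁ (X , a) ++ edge? s₂ (X , b) ++ edge? s₃ (a , Y) ++ edge? s₄ (b , Y)

  module _ (H₁ H₂ H₃ H₄ : Graph m) where

    private
      K : Graph 4
      K = cycle (joined H₁) (joined H₂) (joined H₃) (joined H₄)
      E : ℕ
      E = excess H₁ ℕ.+ excess H₂ ℕ.+ excess H₃ ℕ.+ excess H₄

    embed-links : ∀ A s₁ s₂ s₃ s₄ →
      ((((mapEdges embed A ++ edge? s₁ (X , a)) ++ edge? s₂ (X , b)) ++ edge? s₃ (a , Y)) ++ edge? s₄ (b , Y)) ++ []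
      ≡ mapEdges embed (A ++ cycle s₁ s₂ s₃ s₄)
    embed-links A s₁ s₂ s₃ s₄ = begin
      ((((A′ ++ E₁) ++ E₂) ++ E₃) ++ E₄) ++ []
        ≡⟨ ++-identityʳ _ ⟩
      (((A′ ++ E₁) ++ E₂) ++ E₃) ++ E₄
        ≡⟨ trans (++-assoc ((A′ ++ E₁) ++ E₂) E₃ E₄)
             (trans (++-assoc (A′ ++ E₁) E₂ (E₃ ++ E₄)) (++-assoc A′ E₁ (E₂ ++ E₃ ++ E₄))) ⟩
      A′ ++ E₁ ++ E₂ ++ E₃ ++ E₄
        ≡⟨ cong (A′ ++_) (cong₂ _++_ (push s₁) (cong₂ _++_ (push s₂) (cong₂ _++_ (push s₃) (push s₄)))) ⟩
      A′ ++ emb (edge? s₁ (X , a)) ++ emb (edge? s₂ (X , b)) ++ emb (edge? s₃ (a , Y)) ++ emb (edge? s₄ (b , Y))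
        ≡⟨ cong (A′ ++_) (trans (map-++ _ (edge? s₁ (X , a)) _)
             (cong (emb (edge? s₁ (X , a)) ++_) (trans (map-++ _ (edge? s₂ (X , b)) _)
               (cong (emb (edge? s₂ (X , b)) ++_) (map-++ _ (edge? s₃ (a , Y)) _))))) ⟨
      A′ ++ emb (cycle s₁ s₂ s₃ s₄)
        ≡⟨ map-++ _ A _ ⟨
      emb (A ++ cycle s₁ s₂ s₃ s₄) ∎
      where
      open ≡-Reasoning
      emb : Graph 4 → Graph (2 ℕ.+ inner (suc n))
      emb = mapEdges embed
      A′ E₁ E₂ E₃ E₄ : Graph (2 ℕ.+ inner (suc n))
      A′ = emb A
      E₁ = edge? s₁ (X , a)
      E₂ = edge? s₂ (X , b)
      E₃ = edge? s₃ (a , Y)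
      E₄ = edge? s₄ (b , Y)
      push : ∀ s {e} → edge? s (embed (proj₁ e) , embed (proj₂ e)) ≡ emb (edge? s e)
      push true  = refl
      push false = refl

    embed-boundary : ∀ A → BoundaryGraph (mapEdges embed A)
    embed-boundary A = All.map⁺ (All.universal (λ (x , y) → β x , β y) A)
      where
      β : ∀ x → Boundary (embed x)
      β zero                   = tt
      β (suc zero)             = tt
      β (suc (suc zero))       = tt
      β (suc (suc (suc zero))) = tt

    κ-embed : ∀ (A : Graph 4) → κ (mapEdges embed A) ≡ κ A ℕ.+ 4 ℕ.* inner n
    κ-embed A = shift (κ (mapEdges embed A)) (κ A)
      (κ-mapEdges embed (λ {x} {y} → Fin.↑ˡ-injective (4 ℕ.* inner n) x y) {X} {Y} (λ ()) A)
      where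
      shift : ∀ i j → i ℕ.+ 4 ≡ 4 ℕ.+ 4 ℕ.* inner n ℕ.+ j → i ≡ j ℕ.+ 4 ℕ.* inner n
      shift i j eq = ℕ.+-cancelʳ-≡ 4 i (j ℕ.+ 4 ℕ.* inner n) (trans eq (rearrange (4 ℕ.* inner n) j))
        where
        rearrange : ∀ i j → 4 ℕ.+ i ℕ.+ j ≡ j ℕ.+ i ℕ.+ 4
        rearrange = solve-∀ᴺ

    -- The graph `A` on the four outer vertices is left general because two choices are needed: the
    -- optional chord, and the chord together with an edge `X` `Y`, from which `joined-transfer`
    -- detects whether the special vertices are joined.
    κ-welded : ∀ A → κ (mapEdges embed A ++ welded H₁ H₂ H₃ H₄) ≡
                              κ (A ++ K) ℕ.+ E
    κ-welded A = weld-arithmetic (inner n) {c = κ (A ++ K)}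
      (κ-copy copy₁ A₀ H₁ _ (boundary-outerGraph copy₁ β₀)
        (All.++⁺ (copy-outerGraph (λ ()) H₂) (All.++⁺ (copy-outerGraph (λ ()) H₃)
          (All.++⁺ (copy-outerGraph (λ ()) H₄) []))) (joined? H₁))
      (κ-copy copy₂ A₁ H₂ _ (boundary-outerGraph copy₂ β₁)
        (All.++⁺ (copy-outerGraph (λ ()) H₃) (All.++⁺ (copy-outerGraph (λ ()) H₄) [])) (joined? H₂))
      (κ-copy copy₃ A₂ H₃ _ (boundary-outerGraph copy₃ β₂)
        (All.++⁺ (copy-outerGraph (λ ()) H₄) []) (joined? H₃))
      (κ-copy copy₄ A₃ H₄ _ (boundary-outerGraph copy₄ β₃) [] (joined? H₄))
      (2+excess H₁) (2+excess H₂) (2+excess H₃) (2+excess H₄)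
      (trans (cong κ (embed-links A (joined H₁) (joined H₂) (joined H₃) (joined H₄)))
             (κ-embed (A ++ K)))
      where
      A₀ A₁ A₂ A₃ : Graph (2 ℕ.+ inner (suc n))
      A₀ = mapEdges embed A
      A₁ = A₀ ++ link copy₁ H₁
      A₂ = A₁ ++ link copy₂ H₂
      A₃ = A₂ ++ link copy₃ H₃
      β₀ : BoundaryGraph A₀
      β₀ = embed-boundary A
      β₁ : BoundaryGraph A₁
      β₁ = boundary-++-link copy₁ H₁ β₀
      β₂ : BoundaryGraph A₂
      β₂ = boundary-++-link copy₂ H₂ β₁
      β₃ : BoundaryGraph A₃
      β₃ = boundary-++-link copy₃ H₃ β₂

    embed-chord : ∀ ch → mapEdges embed (edge? ch (a , b)) ≡ edge? ch (a , b)
    embed-chord true  = refl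
    embed-chord false = refl

    assemble : Bool → Graph (2 ℕ.+ inner (suc n))
    assemble ch = edge? ch (a , b) ++ welded H₁ H₂ H₃ H₄

    core : Bool → Graph 4
    core ch = edge? ch (a , b) ++ K

    κ-assemble : ∀ ch → κ (assemble ch) ≡ κ (core ch) ℕ.+ E
    κ-assemble ch = trans (cong (λ A → κ (A ++ welded H₁ H₂ H₃ H₄)) (sym (embed-chord ch)))
                          (κ-welded (edge? ch (a , b)))

    joined-assemble : ∀ ch → joined (assemble ch) ≡ joined (core ch)
    joined-assemble ch = joined-transfer (assemble ch) (core ch) E (κ-assemble ch)
      (trans (cong (λ A → κ ((X , Y) ∷ A ++ welded H₁ H₂ H₃ H₄)) (sym (embed-chord ch)))
             (κ-welded ((X , Y) ∷ edge? ch (a , b))))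

    excess-assemble : ∀ ch → excess (assemble ch) ≡ excess (core ch) ℕ.+ E
    excess-assemble ch = ℕ.+-cancelˡ-≡ 2 (excess (assemble ch)) (excess (core ch) ℕ.+ E) (begin
      2 ℕ.+ excess (assemble ch)
        ≡⟨ 2+excess (assemble ch) ⟨
      κ (assemble ch) ℕ.+ bit (joined (assemble ch))
        ≡⟨ cong₂ (λ i j → i ℕ.+ bit j) (κ-assemble ch) (joined-assemble ch) ⟩
      κ (core ch) ℕ.+ E ℕ.+ bit (joined (core ch))
        ≡⟨ rearrange (κ (core ch)) E (bit (joined (core ch))) ⟩
      κ (core ch) ℕ.+ bit (joined (core ch)) ℕ.+ E
        ≡⟨ cong (ℕ._+ E) (2+excess (core ch)) ⟩
      2 ℕ.+ (excess (core ch) ℕ.+ E) ∎)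
      where
      open ≡-Reasoning
      rearrange : ∀ i j k → i ℕ.+ j ℕ.+ k ≡ i ℕ.+ k ℕ.+ j
      rearrange = solve-∀ᴺ

    length-welded : length (welded H₁ H₂ H₃ H₄) ≡ length H₁ ℕ.+ (length H₂ ℕ.+ (length H₃ ℕ.+ (length H₄ ℕ.+ 0)))
    length-welded = step H₁ (step H₂ (step H₃ (step H₄ refl)))
      where
      step : ∀ {i} H {B : Graph (2 ℕ.+ inner (suc n))} {l} → length B ≡ l →
             length (mapEdges (glue n i) H ++ B) ≡ length H ℕ.+ l
      step {i} H {B} eq = trans (length-++ (mapEdges (glue n i) H))
        (cong₂ ℕ._+_ (length-map _ H) eq)

    length-core : ∀ ch → length (core ch) ≡
      bit ch ℕ.+ (bit (joined H₁) ℕ.+ (bit (joined H₂) ℕ.+ (bit (joined H₃) ℕ.+ bit (joined H₄))))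
    length-core ch = step ch (step (joined H₁) (step (joined H₂) (step (joined H₃) (length-edge? (joined H₄)))))
      where
      length-edge? : ∀ s {e : Fin 4 × Fin 4} → length (edge? s e) ≡ bit s
      length-edge? true  = refl
      length-edge? false = refl
      step : ∀ s {e} {B : Graph 4} {l} → length B ≡ l → length (edge? s e ++ B) ≡ bit s ℕ.+ l
      step s {e} eq = trans (length-++ (edge? s e)) (cong₂ ℕ._+_ (length-edge? s) eq)

    length-assemble : ∀ ch → length (assemble ch) ≡
      bit ch ℕ.+ (length H₁ ℕ.+ (length H₂ ℕ.+ (length H₃ ℕ.+ (length H₄ ℕ.+ 0))))
    length-assemble true  = cong suc length-welded
    length-assemble false = length-welded

    ν-assemble : ∀ ch → ν (assemble ch) ≡ ν (core ch) ℕ.+ (ν H₁ ℕ.+ ν H₂ ℕ.+ ν H₃ ℕ.+ ν H₄)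
    ν-assemble ch = ν-arithmetic (inner n) (bit ch)
      {b₁ = bit (joined H₁)} {bit (joined H₂)} {bit (joined H₃)} {bit (joined H₄)}
      {length H₁} {length H₂} {length H₃} {length H₄} {k₁ = κ H₁} {κ H₂} {κ H₃} {κ H₄}
      (trans (v+ν (assemble ch)) (cong₂ ℕ._+_ (length-assemble ch) (κ-assemble ch)))
      (trans (v+ν (core ch)) (cong (ℕ._+ κ (core ch)) (length-core ch)))
      (2+excess H₁) (2+excess H₂) (2+excess H₃) (2+excess H₄)
      (v+ν H₁) (v+ν H₂) (v+ν H₃) (v+ν H₄)

-- Sums over the spanning subgraphs of Gₙ

module _ {v : ℕ} where

  ∑-spanningSubgraphs-++ : ∀ (L₁ : Graph v) {L₂} (f : Graph v → ℤ) → ∑ (spanningSubgraphs (L₁ ++ L₂)) f ≡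
    ∑ (spanningSubgraphs L₁) (λ H₁ → ∑ (spanningSubgraphs L₂) (λ H₂ → f (H₁ ++ H₂)))
  ∑-spanningSubgraphs-++ []       f = sym (ℤ.+-identityʳ _)
  ∑-spanningSubgraphs-++ (e ∷ L₁) {L₂} f = begin
    ∑ (spanningSubgraphs (e ∷ L₁ ++ L₂)) f
      ≡⟨ ∑-spanningSubgraphs-∷ e (L₁ ++ L₂) f ⟩
    ∑ (spanningSubgraphs (L₁ ++ L₂)) (f ∘ (e ∷_)) + ∑ (spanningSubgraphs (L₁ ++ L₂)) f
      ≡⟨ cong₂ _+_ (∑-spanningSubgraphs-++ L₁ (f ∘ (e ∷_))) (∑-spanningSubgraphs-++ L₁ f) ⟩
    ∑ (spanningSubgraphs L₁) (g ∘ (e ∷_)) + ∑ (spanningSubgraphs L₁) g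
      ≡⟨ ∑-spanningSubgraphs-∷ e L₁ g ⟨
    ∑ (spanningSubgraphs (e ∷ L₁)) g ∎
    where
    open ≡-Reasoning
    g : Graph v → ℤ
    g H₁ = ∑ (spanningSubgraphs L₂) (λ H₂ → f (H₁ ++ H₂))

  ∑-spanningSubgraphs-mapEdges : ∀ {m} (g : Fin m → Fin v) L (f : Graph v → ℤ) →
    ∑ (spanningSubgraphs (mapEdges g L)) f ≡ ∑ (spanningSubgraphs L) (f ∘ mapEdges g)
  ∑-spanningSubgraphs-mapEdges g []            f = refl
  ∑-spanningSubgraphs-mapEdges g ((x , y) ∷ L) f = begin
    ∑ (spanningSubgraphs ((g x , g y) ∷ mapEdges g L)) f
      ≡⟨ ∑-spanningSubgraphs-∷ (g x , g y) (mapEdges g L) f ⟩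
    ∑ (spanningSubgraphs (mapEdges g L)) (f ∘ ((g x , g y) ∷_)) + ∑ (spanningSubgraphs (mapEdges g L)) f
      ≡⟨ cong₂ _+_ (∑-spanningSubgraphs-mapEdges g L _) (∑-spanningSubgraphs-mapEdges g L f) ⟩
    ∑ (spanningSubgraphs L) (λ H → f ((g x , g y) ∷ mapEdges g H)) + ∑ (spanningSubgraphs L) (f ∘ mapEdges g)
      ≡⟨ ∑-spanningSubgraphs-∷ (x , y) L (f ∘ mapEdges g) ⟨
    ∑ (spanningSubgraphs ((x , y) ∷ L)) (f ∘ mapEdges g) ∎
    where open ≡-Reasoning

diamond : Bool → Bool → Bool → Bool → Bool → Graph 4
diamond ch s₁ s₂ s₃ s₄ =
  edge? ch (a , b) ++ edge? s₁ (X , a) ++ edge? s₂ (X , b) ++ edge? s₃ (a , Y) ++ edge? s₄ (b , Y)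

module _ (n : ℕ) where
  open Step n using (welded)

  private
    S : List (Graph (2 ℕ.+ inner n))
    S = spanningSubgraphs (G n)

  ∑₄ : (Graph (2 ℕ.+ inner (suc n)) → ℤ) → ℤ
  ∑₄ f = ∑ S λ H₁ → ∑ S λ H₂ → ∑ S λ H₃ → ∑ S λ H₄ → f (welded H₁ H₂ H₃ H₄)

  ∑-copies : ∀ f → ∑ (spanningSubgraphs (G (suc n))) f ≡ ∑₄ (λ H → f ((a , b) ∷ H)) + ∑₄ f
  -- By computation `G (suc n)` is the chord followed by the four welded copies of `G n`.
  ∑-copies f = trans (∑-spanningSubgraphs-∷ (a , b) (welded (G n) (G n) (G n) (G n)) f)
                     (cong₂ _+_ (copies (λ H → f ((a , b) ∷ H))) (copies f))
    where
    peel : ∀ i L f → ∑ (spanningSubgraphs (mapEdges (glue n i) (G n) ++ L)) f ≡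
                     ∑ S (λ H → ∑ (spanningSubgraphs L) (λ H′ → f (mapEdges (glue n i) H ++ H′)))
    peel i L f = trans (∑-spanningSubgraphs-++ (mapEdges (glue n i) (G n)) f)
                       (∑-spanningSubgraphs-mapEdges (glue n i) (G n) _)
    copies : ∀ f → ∑ (spanningSubgraphs (welded (G n) (G n) (G n) (G n))) f ≡ ∑₄ f
    copies f = trans (peel copy₁ _ f) (∑-cong S λ H₁ →
               trans (peel copy₂ _ _) (∑-cong S λ H₂ →
               trans (peel copy₃ _ _) (∑-cong S λ H₃ →
               -- The empty list that ends `welded` has a single subgraph and leaves a sum of one
               -- term.
               trans (peel copy₄ _ _) (∑-cong S λ H₄ → ℤ.+-identityʳ _))))

δ : Bool → Bool → ℤ
δ true  β = + bit β
δ false β = + bit (not β)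

-- Here `c` and `d` stand for the total weights of the joined and of the separated subgraphs of one
-- copy.
evaluate : ℤ → ℤ → (Bool → ℤ) → ℤ
evaluate c d χ = c * χ true + d * χ false

evaluate₄ : ℤ → ℤ → (Bool → Bool → Bool → Bool → ℤ) → ℤ
evaluate₄ c d ψ = evaluate c d λ s₁ → evaluate c d λ s₂ → evaluate c d λ s₃ → evaluate c d λ s₄ → ψ s₁ s₂ s₃ s₄

-- The factor 0ℤ ^ defect H is the indicator of defect H = 0. For the excess it selects
-- the H in which every vertex is joined to Xₙ or Yₙ, for the nullity the forests.
module StateSum (defect : ∀ {k} → Graph (2 ℕ.+ k) → ℕ)
  (additive : ∀ n H₁ H₂ H₃ H₄ ch → defect (Step.assemble n H₁ H₂ H₃ H₄ ch) ≡
    defect (diamond ch (joined H₁) (joined H₂) (joined H₃) (joined H₄)) ℕ.+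
    (defect H₁ ℕ.+ defect H₂ ℕ.+ defect H₃ ℕ.+ defect H₄)) where

  weight : ∀ {k} → Graph (2 ℕ.+ k) → ℤ
  weight H = sgn (length H) * 0ℤ ^ defect H

  stateSum : ℕ → Bool → ℤ
  stateSum n j = ∑ (spanningSubgraphs (G n)) (λ H → weight H * δ j (joined H))

  ∑-by-state : ∀ n χ → ∑ (spanningSubgraphs (G n)) (λ H → weight H * χ (joined H)) ≡
                       evaluate (stateSum n true) (stateSum n false) χ
  ∑-by-state n χ = begin
    ∑ S (λ H → weight H * χ (joined H))
      ≡⟨ ∑-cong S (λ H → split (weight H) (joined H)) ⟩
    ∑ S (λ H → χ true * (weight H * δ true (joined H)) + χ false * (weight H * δ false (joined H)))
      ≡⟨ ∑-+ S _ _ ⟩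
    ∑ S (λ H → χ true * (weight H * δ true (joined H))) + ∑ S (λ H → χ false * (weight H * δ false (joined H)))
      ≡⟨ cong₂ _+_ (∑-* S (χ true) _) (∑-* S (χ false) _) ⟩
    χ true * stateSum n true + χ false * stateSum n false
      ≡⟨ cong₂ _+_ (ℤ.*-comm (χ true) (stateSum n true)) (ℤ.*-comm (χ false) (stateSum n false)) ⟩
    evaluate (stateSum n true) (stateSum n false) χ ∎
    where
    open ≡-Reasoning
    S : List (Graph (2 ℕ.+ inner n))
    S = spanningSubgraphs (G n)
    split : ∀ w j → w * χ j ≡ χ true * (w * δ true j) + χ false * (w * δ false j)
    split w true  = ring w (χ true) (χ false)
      where
      ring : ∀ w t f → w * t ≡ t * (w * 1ℤ) + f * (w * 0ℤ)
      ring = solve-∀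
    split w false = ring w (χ true) (χ false)
      where
      ring : ∀ w t f → w * f ≡ t * (w * 0ℤ) + f * (w * 1ℤ)
      ring = solve-∀

  -- The factor that remains after the weights of the four copies are split off. Only the chord has
  -- a sign here: the links stand for copies, whose weights include theirs.
  leaf : Bool → Bool → Bool → Bool → Bool → Bool → ℤ
  leaf j ch s₁ s₂ s₃ s₄ = sgn (bit ch) * (0ℤ ^ defect D * δ j (joined D))
    where
    D : Graph 4
    D = diamond ch s₁ s₂ s₃ s₄

  weight-assemble : ∀ n j H₁ H₂ H₃ H₄ ch →
    weight (Step.assemble n H₁ H₂ H₃ H₄ ch) * δ j (joined (Step.assemble n H₁ H₂ H₃ H₄ ch)) ≡
    weight H₁ * (weight H₂ * (weight H₃ * (weight H₄ * leaf j ch (joined H₁) (joined H₂) (joined H₃) (joined H₄))))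
  weight-assemble n j H₁ H₂ H₃ H₄ ch = begin
    sgn (length A) * 0ℤ ^ defect A * δ j (joined A)
      ≡⟨ cong₂ (λ l e → sgn l * 0ℤ ^ e * δ j (joined A)) (Step.length-assemble n H₁ H₂ H₃ H₄ ch) (additive n H₁ H₂ H₃ H₄ ch) ⟩
    sgn (bit ch ℕ.+ (l₁ ℕ.+ (l₂ ℕ.+ (l₃ ℕ.+ (l₄ ℕ.+ 0))))) *
      0ℤ ^ (defect D ℕ.+ (defect H₁ ℕ.+ defect H₂ ℕ.+ defect H₃ ℕ.+ defect H₄)) * δ j (joined A)
      ≡⟨ cong₂ (λ s z → s * z * δ j (joined A)) (power₁ -1ℤ (bit ch) l₁ l₂ l₃ l₄)
           (power₂ 0ℤ (defect D) (defect H₁) (defect H₂) (defect H₃) (defect H₄)) ⟩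
    sgn (bit ch) * (sgn l₁ * (sgn l₂ * (sgn l₃ * (sgn l₄ * 1ℤ)))) *
      (0ℤ ^ defect D * (0ℤ ^ defect H₁ * 0ℤ ^ defect H₂ * 0ℤ ^ defect H₃ * 0ℤ ^ defect H₄)) * δ j (joined A)
      ≡⟨ cong (λ i → sgn (bit ch) * (sgn l₁ * (sgn l₂ * (sgn l₃ * (sgn l₄ * 1ℤ)))) *
           (0ℤ ^ defect D * (0ℤ ^ defect H₁ * 0ℤ ^ defect H₂ * 0ℤ ^ defect H₃ * 0ℤ ^ defect H₄)) * δ j i)
           (Step.joined-assemble n H₁ H₂ H₃ H₄ ch) ⟩
    sgn (bit ch) * (sgn l₁ * (sgn l₂ * (sgn l₃ * (sgn l₄ * 1ℤ)))) *
      (0ℤ ^ defect D * (0ℤ ^ defect H₁ * 0ℤ ^ defect H₂ * 0ℤ ^ defect H₃ * 0ℤ ^ defect H₄)) * δ j (joined D)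
      ≡⟨ rearrange (sgn (bit ch)) (sgn l₁) (sgn l₂) (sgn l₃) (sgn l₄)
           (0ℤ ^ defect D) (0ℤ ^ defect H₁) (0ℤ ^ defect H₂) (0ℤ ^ defect H₃) (0ℤ ^ defect H₄) (δ j (joined D)) ⟩
    weight H₁ * (weight H₂ * (weight H₃ * (weight H₄ * (sgn (bit ch) * (0ℤ ^ defect D * δ j (joined D)))))) ∎
    where
    open ≡-Reasoning
    A : Graph (2 ℕ.+ inner (suc n))
    A = Step.assemble n H₁ H₂ H₃ H₄ ch
    D : Graph 4
    D = diamond ch (joined H₁) (joined H₂) (joined H₃) (joined H₄)
    l₁ l₂ l₃ l₄ : ℕ
    l₁ = length H₁
    l₂ = length H₂
    l₃ = length H₃
    l₄ = length H₄
    pow : ∀ i j k → i ^ (j ℕ.+ k) ≡ i ^ j * i ^ k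
    pow = ℤ.^-distribˡ-+-*
    power₁ : ∀ i c j k l m → i ^ (c ℕ.+ (j ℕ.+ (k ℕ.+ (l ℕ.+ (m ℕ.+ 0))))) ≡ i ^ c * (i ^ j * (i ^ k * (i ^ l * (i ^ m * 1ℤ))))
    power₁ i c j k l m = trans (pow i c _) (cong (i ^ c *_) (trans (pow i j _) (cong (i ^ j *_)
      (trans (pow i k _) (cong (i ^ k *_) (trans (pow i l _) (cong (i ^ l *_) (pow i m 0))))))))
    power₂ : ∀ i c j k l m → i ^ (c ℕ.+ (j ℕ.+ k ℕ.+ l ℕ.+ m)) ≡ i ^ c * (i ^ j * i ^ k * i ^ l * i ^ m)
    power₂ i c j k l m = trans (pow i c _) (cong (i ^ c *_) (trans (pow i (j ℕ.+ k ℕ.+ l) m) (cong (_* i ^ m)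
      (trans (pow i (j ℕ.+ k) l) (cong (_* i ^ l) (pow i j k))))))
    rearrange : ∀ c s₁ s₂ s₃ s₄ z z₁ z₂ z₃ z₄ d →
      c * (s₁ * (s₂ * (s₃ * (s₄ * 1ℤ)))) * (z * (z₁ * z₂ * z₃ * z₄)) * d ≡
      s₁ * z₁ * (s₂ * z₂ * (s₃ * z₃ * (s₄ * z₄ * (c * (z * d)))))
    rearrange = solve-∀

  ∑₄-by-state : ∀ n ψ →
    (∑ (spanningSubgraphs (G n)) λ H₁ → ∑ (spanningSubgraphs (G n)) λ H₂ →
     ∑ (spanningSubgraphs (G n)) λ H₃ → ∑ (spanningSubgraphs (G n)) λ H₄ →
       weight H₁ * (weight H₂ * (weight H₃ * (weight H₄ * ψ (joined H₁) (joined H₂) (joined H₃) (joined H₄))))) ≡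
    evaluate₄ (stateSum n true) (stateSum n false) ψ
  ∑₄-by-state n ψ = begin
    (∑ S λ H₁ → ∑ S λ H₂ → ∑ S λ H₃ → ∑ S λ H₄ →
       weight H₁ * (weight H₂ * (weight H₃ * (weight H₄ * ψ (joined H₁) (joined H₂) (joined H₃) (joined H₄)))))
      ≡⟨ (∑-cong S λ H₁ → ∑-cong S λ H₂ → ∑-cong S λ H₃ →
           trans (∑-* S (weight H₁) _) (cong (weight H₁ *_)
             (trans (∑-* S (weight H₂) _) (cong (weight H₂ *_)
               (trans (∑-* S (weight H₃) _) (cong (weight H₃ *_)
                 (∑-by-state n (ψ (joined H₁) (joined H₂) (joined H₃))))))))) ⟩
    (∑ S λ H₁ → ∑ S λ H₂ → ∑ S λ H₃ →
       weight H₁ * (weight H₂ * (weight H₃ * ev (ψ (joined H₁) (joined H₂) (joined H₃)))))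
      ≡⟨ (∑-cong S λ H₁ → ∑-cong S λ H₂ →
           trans (∑-* S (weight H₁) _) (cong (weight H₁ *_)
             (trans (∑-* S (weight H₂) _) (cong (weight H₂ *_)
               (∑-by-state n (λ s₃ → ev (ψ (joined H₁) (joined H₂) s₃))))))) ⟩
    (∑ S λ H₁ → ∑ S λ H₂ → weight H₁ * (weight H₂ * ev (λ s₃ → ev (ψ (joined H₁) (joined H₂) s₃))))
      ≡⟨ (∑-cong S λ H₁ → trans (∑-* S (weight H₁) _) (cong (weight H₁ *_)
           (∑-by-state n (λ s₂ → ev (λ s₃ → ev (ψ (joined H₁) s₂ s₃)))))) ⟩
    (∑ S λ H₁ → weight H₁ * ev (λ s₂ → ev (λ s₃ → ev (ψ (joined H₁) s₂ s₃))))
      ≡⟨ ∑-by-state n (λ s₁ → ev (λ s₂ → ev (λ s₃ → ev (ψ s₁ s₂ s₃)))) ⟩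
    evaluate₄ (stateSum n true) (stateSum n false) ψ ∎
    where
    open ≡-Reasoning
    S : List (Graph (2 ℕ.+ inner n))
    S = spanningSubgraphs (G n)
    ev : (Bool → ℤ) → ℤ
    ev = evaluate (stateSum n true) (stateSum n false)

  stateSum-suc : ∀ n j → stateSum (suc n) j ≡
    evaluate₄ (stateSum n true) (stateSum n false) (leaf j true) +
    evaluate₄ (stateSum n true) (stateSum n false) (leaf j false)
  stateSum-suc n j = trans (∑-copies n _) (cong₂ _+_ (branch true) (branch false))
    where
    S : List (Graph (2 ℕ.+ inner n))
    S = spanningSubgraphs (G n)
    branch : ∀ ch → ∑₄ n (λ H → weight (edge? ch (a , b) ++ H) * δ j (joined (edge? ch (a , b) ++ H))) ≡
                    evaluate₄ (stateSum n true) (stateSum n false) (leaf j ch)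
    branch ch = trans
      (∑-cong S λ H₁ → ∑-cong S λ H₂ → ∑-cong S λ H₃ → ∑-cong S λ H₄ → weight-assemble n j H₁ H₂ H₃ H₄ ch)
      (∑₄-by-state n (leaf j ch))

-- Exhaustive evaluation on the subgraphs of the diamond

every : (Bool → Bool) → Bool
every p = p true ∧ p false

every-sound : ∀ p → every p ≡ true → ∀ β → p β ≡ true
every-sound p eq β with p true in eq₁ | p false in eq₂ | β
... | true | true | true  = eq₁
... | true | true | false = eq₂

every₅-sound : ∀ (p : Bool → Bool → Bool → Bool → Bool → Bool) →
  every (λ β₁ → every λ β₂ → every λ β₃ → every λ β₄ → every (p β₁ β₂ β₃ β₄)) ≡ true →
  ∀ β₁ β₂ β₃ β₄ β₅ → p β₁ β₂ β₃ β₄ β₅ ≡ true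
every₅-sound p eq β₁ β₂ β₃ β₄ =
  every-sound (p β₁ β₂ β₃ β₄)
    (every-sound (λ β₄ → every (p β₁ β₂ β₃ β₄))
      (every-sound (λ β₃ → every λ β₄ → every (p β₁ β₂ β₃ β₄))
        (every-sound (λ β₂ → every λ β₃ → every λ β₄ → every (p β₁ β₂ β₃ β₄))
          (every-sound (λ β₁ → every λ β₂ → every λ β₃ → every λ β₄ → every (p β₁ β₂ β₃ β₄)) eq β₁) β₂) β₃) β₄)

-- All 32 cases are settled by one evaluation: on closed arguments the reachability algorithm
-- computes, and the hypothesis is then proved by `refl`.
tabulated : (f g : Bool → Bool → Bool → Bool → Bool → Bool) →
  every (λ β₁ → every λ β₂ → every λ β₃ → every λ β₄ → every λ β₅ →
    does (f β₁ β₂ β₃ β₄ β₅ Bool.≟ g β₁ β₂ β₃ β₄ β₅)) ≡ true →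
  ∀ β₁ β₂ β₃ β₄ β₅ → f β₁ β₂ β₃ β₄ β₅ ≡ g β₁ β₂ β₃ β₄ β₅
tabulated f g eq β₁ β₂ β₃ β₄ β₅
  with f β₁ β₂ β₃ β₄ β₅ Bool.≟ g β₁ β₂ β₃ β₄ β₅
     | every₅-sound (λ β₁ β₂ β₃ β₄ β₅ → does (f β₁ β₂ β₃ β₄ β₅ Bool.≟ g β₁ β₂ β₃ β₄ β₅)) eq β₁ β₂ β₃ β₄ β₅
... | yes f≡g | _ = f≡g

-- In the diamond: `X` is joined to `Y`; each of `a` and `b` is joined to `X` or `Y`; there is no
-- cycle. With the chord, one link attaches both `a` and `b`, and a link missing from each triangle
-- rules out the outer 4-cycle as well.
joining spanning acyclic : Bool → Bool → Bool → Bool → Bool → Bool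
joining ch s₁ s₂ s₃ s₄ = (s₁ ∧ s₃) ∨ (s₂ ∧ s₄) ∨ (ch ∧ (s₁ ∨ s₂) ∧ (s₃ ∨ s₄))
spanning ch s₁ s₂ s₃ s₄ = if ch then s₁ ∨ s₂ ∨ s₃ ∨ s₄ else (s₁ ∨ s₃) ∧ (s₂ ∨ s₄)
acyclic ch s₁ s₂ s₃ s₄ = if ch then not (s₁ ∧ s₂) ∧ not (s₃ ∧ s₄) else not (s₁ ∧ s₂ ∧ s₃ ∧ s₄)

joined≡ : ∀ {k} (H : Graph (2 ℕ.+ k)) → joined H ≡ does (connected? H X Y)
joined≡ H = does-≡ (joined? H) (connected? H X Y)

excess≡ : ∀ {k} (H : Graph (2 ℕ.+ k)) → excess H ≡ components H ℕ.+ bit (does (connected? H X Y)) ∸ 2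
excess≡ H = cong₂ (λ c j → c ℕ.+ bit j ∸ 2) (κ≡components H) (joined≡ H)

joined-diamond : ∀ ch s₁ s₂ s₃ s₄ → joined (diamond ch s₁ s₂ s₃ s₄) ≡ joining ch s₁ s₂ s₃ s₄
joined-diamond ch s₁ s₂ s₃ s₄ = trans (joined≡ (diamond ch s₁ s₂ s₃ s₄))
  (tabulated (λ ch s₁ s₂ s₃ s₄ → does (connected? (diamond ch s₁ s₂ s₃ s₄) X Y)) joining refl ch s₁ s₂ s₃ s₄)

0^≡bit : ∀ k → 0ℤ ^ k ≡ + bit (k ≡ᵇ 0)
0^≡bit zero    = refl
0^≡bit (suc k) = 0^suc k

0^excess-diamond : ∀ ch s₁ s₂ s₃ s₄ → 0ℤ ^ excess (diamond ch s₁ s₂ s₃ s₄) ≡ + bit (spanning ch s₁ s₂ s₃ s₄)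
0^excess-diamond ch s₁ s₂ s₃ s₄ = begin
  0ℤ ^ excess (diamond ch s₁ s₂ s₃ s₄)
    ≡⟨ cong (0ℤ ^_) (excess≡ (diamond ch s₁ s₂ s₃ s₄)) ⟩
  0ℤ ^ excess° ch s₁ s₂ s₃ s₄
    ≡⟨ 0^≡bit (excess° ch s₁ s₂ s₃ s₄) ⟩
  + bit (excess° ch s₁ s₂ s₃ s₄ ≡ᵇ 0)
    ≡⟨ cong (λ β → + bit β) (tabulated (λ ch s₁ s₂ s₃ s₄ → excess° ch s₁ s₂ s₃ s₄ ≡ᵇ 0) spanning refl ch s₁ s₂ s₃ s₄) ⟩
  + bit (spanning ch s₁ s₂ s₃ s₄) ∎
  where
  open ≡-Reasoning
  excess° : Bool → Bool → Bool → Bool → Bool → ℕ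
  excess° ch s₁ s₂ s₃ s₄ = components (diamond ch s₁ s₂ s₃ s₄) ℕ.+ bit (does (connected? (diamond ch s₁ s₂ s₃ s₄) X Y)) ∸ 2

0^ν-diamond : ∀ ch s₁ s₂ s₃ s₄ → 0ℤ ^ ν (diamond ch s₁ s₂ s₃ s₄) ≡ + bit (acyclic ch s₁ s₂ s₃ s₄)
0^ν-diamond ch s₁ s₂ s₃ s₄ = begin
  0ℤ ^ ν (diamond ch s₁ s₂ s₃ s₄)
    ≡⟨ cong (0ℤ ^_) (ν≡nullity (diamond ch s₁ s₂ s₃ s₄)) ⟩
  0ℤ ^ nullity (diamond ch s₁ s₂ s₃ s₄)
    ≡⟨ 0^≡bit (nullity (diamond ch s₁ s₂ s₃ s₄)) ⟩
  + bit (nullity (diamond ch s₁ s₂ s₃ s₄) ≡ᵇ 0)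
    ≡⟨ cong (λ β → + bit β) (tabulated (λ ch s₁ s₂ s₃ s₄ → nullity (diamond ch s₁ s₂ s₃ s₄) ≡ᵇ 0) acyclic refl ch s₁ s₂ s₃ s₄) ⟩
  + bit (acyclic ch s₁ s₂ s₃ s₄) ∎
  where open ≡-Reasoning

evaluate-cong : ∀ c d {χ χ′} → (∀ s → χ s ≡ χ′ s) → evaluate c d χ ≡ evaluate c d χ′
evaluate-cong c d eq = cong₂ (λ i j → c * i + d * j) (eq true) (eq false)

evaluate₄-cong : ∀ c d {ψ ψ′} → (∀ s₁ s₂ s₃ s₄ → ψ s₁ s₂ s₃ s₄ ≡ ψ′ s₁ s₂ s₃ s₄) → evaluate₄ c d ψ ≡ evaluate₄ c d ψ′
evaluate₄-cong c d eq = evaluate-cong c d λ s₁ → evaluate-cong c d λ s₂ → evaluate-cong c d λ s₃ →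
  evaluate-cong c d (eq s₁ s₂ s₃)

-- `leaf` with the Boolean tables in place of component counts, so that it reduces to a numeral and
-- can serve as a coefficient.
leaf° : (Bool → Bool → Bool → Bool → Bool → Bool) → Bool → Bool → Bool → Bool → Bool → Bool → ℤ
leaf° good j ch s₁ s₂ s₃ s₄ = sgn (bit ch) * (+ bit (good ch s₁ s₂ s₃ s₄) * δ j (joining ch s₁ s₂ s₃ s₄))

module Polynomial where
  open +-*-Solver

  evaluateₚ : ∀ {k} → Polynomial k → Polynomial k → (Bool → Polynomial k) → Polynomial k
  evaluateₚ c d χ = c :* χ true :+ d :* χ false

  -- The syntactic counterpart of `sum°`, which is its value by computation; the solver thus expands
  -- the sum over all 32 states at once.
  sumₚ : ∀ {k} → (Bool → Bool → Bool → Bool → Bool → Bool) → Bool → Polynomial k → Polynomial k → Polynomial k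
  sumₚ good j c d = branch true :+ branch false
    where
    branch : Bool → Polynomial _
    branch ch = evaluateₚ c d λ s₁ → evaluateₚ c d λ s₂ → evaluateₚ c d λ s₃ → evaluateₚ c d λ s₄ →
      con (leaf° good j ch s₁ s₂ s₃ s₄)

  sum° : (Bool → Bool → Bool → Bool → Bool → Bool) → Bool → ℤ → ℤ → ℤ
  sum° good j c d = evaluate₄ c d (leaf° good j true) + evaluate₄ c d (leaf° good j false)

  -- A state that is joined and spanning without the chord remains so with it, at the opposite sign.
  -- There remain the four states with one link at `X` and one at `Y`, which need the chord.
  spanning-true : ∀ c d → sum° spanning true c d ≡ - (+ 4 * (c * c * (d * d)))
  spanning-true = solve 2 (λ c d → sumₚ spanning true c d := :- (con (+ 4) :* (c :* c :* (d :* d)))) refl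

  spanning-false : ∀ c d → sum° spanning false c d ≡ + 2 * (c * c * (d * d)) - + 4 * (c * (d * (d * d)))
  spanning-false = solve 2 (λ c d →
    sumₚ spanning false c d := con (+ 2) :* (c :* c :* (d :* d)) :- con (+ 4) :* (c :* (d :* (d :* d)))) refl

  acyclic-true : ∀ c d → sum° acyclic true c d ≡ + 4 * (c * (c * (c * d))) - + 2 * (c * c * (d * d))
  acyclic-true = solve 2 (λ c d →
    sumₚ acyclic true c d := con (+ 4) :* (c :* (c :* (c :* d))) :- con (+ 2) :* (c :* c :* (d :* d))) refl

  -- A state with at most one link cancels against itself with the chord added. There remain four
  -- states with two links, in which the chord would close a triangle or join `X` to `Y`.
  acyclic-false : ∀ c d → sum° acyclic false c d ≡ + 4 * (c * c * (d * d))
  acyclic-false = solve 2 (λ c d → sumₚ acyclic false c d := con (+ 4) :* (c :* c :* (d :* d))) refl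

open Polynomial using (sum°; spanning-true; spanning-false; acyclic-true; acyclic-false)

-- The two counts as values of the Tutte polynomial

module _ {v : ℕ} {L : Graph v} (conn : components L ≡ 1) where

  #acyclicRootConnected-tutte : ∀ r → + #acyclicRootConnected L r ≡ tutte L 1ℤ 0ℤ
  #acyclicRootConnected-tutte r = trans (#acyclicRootConnected-sum L r) (sym (tutte-1-0 r conn))

  #stronglyConnectedIndegreeSequences-tutte : Fin v → All (λ (x , y) → x ≢ y) L →
    + #stronglyConnectedIndegreeSequences L ≡ tutte L 0ℤ 1ℤ
  #stronglyConnectedIndegreeSequences-tutte r loopless = trans
    (#stronglyConnectedIndegreeSequences-sum r L loopless (components≡1⇒connected conn))
    (sym (tutte-0-1 r conn))

-- The product formula

power : ℕ → ℕ → ℕ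
power n i = (i ℕ.+ 1) ℕ.^ (2 ℕ.* 4 ℕ.^ (n ∸ i))

-- Passing from n to n + 1 multiplies the exponent 2·4^(n-i) of each old factor by 4, and the new
-- factor n + 2 enters with exponent 2.
∏-suc : ∀ n → let P = ∏[0≤i≤ n ] (power n) in
        ∏[0≤i≤ suc n ] (power (suc n)) ≡ (n ℕ.+ 2) ℕ.* (n ℕ.+ 2) ℕ.* (P ℕ.* P ℕ.* (P ℕ.* P))
∏-suc n = begin
  product (map (power (suc n)) (upTo (suc (suc n))))
    ≡⟨ cong (λ is → product (map (power (suc n)) is)) (upTo-∷ʳ (suc n)) ⟨
  product (map (power (suc n)) (upTo (suc n) ∷ʳ suc n))
    ≡⟨ cong product (map-++ (power (suc n)) (upTo (suc n)) (suc n ∷ [])) ⟩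
  product (map (power (suc n)) (upTo (suc n)) ++ power (suc n) (suc n) ∷ [])
    ≡⟨ product-++ (map (power (suc n)) (upTo (suc n))) _ ⟩
  product (map (power (suc n)) (upTo (suc n))) ℕ.* (power (suc n) (suc n) ℕ.* 1)
    ≡⟨ cong₂ ℕ._*_ (fourth-power (upTo (suc n)) (All.tabulate (ℕ.≤-pred ∘ ∈-upTo⁻))) last ⟩
  P ℕ.* P ℕ.* (P ℕ.* P) ℕ.* ((n ℕ.+ 2) ℕ.* (n ℕ.+ 2))
    ≡⟨ ℕ.*-comm (P ℕ.* P ℕ.* (P ℕ.* P)) _ ⟩
  (n ℕ.+ 2) ℕ.* (n ℕ.+ 2) ℕ.* (P ℕ.* P ℕ.* (P ℕ.* P)) ∎
  where
  open ≡-Reasoning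
  P : ℕ
  P = ∏[0≤i≤ n ] (power n)
  last : power (suc n) (suc n) ℕ.* 1 ≡ (n ℕ.+ 2) ℕ.* (n ℕ.+ 2)
  last = trans (cong (λ k → suc (n ℕ.+ 1) ℕ.^ (2 ℕ.* 4 ℕ.^ k) ℕ.* 1) (ℕ.n∸n≡0 n)) (square n)
    where
    square : ∀ n → (1 ℕ.+ (n ℕ.+ 1)) ℕ.* ((1 ℕ.+ (n ℕ.+ 1)) ℕ.* 1) ℕ.* 1 ≡ (n ℕ.+ 2) ℕ.* (n ℕ.+ 2)
    square = solve-∀ᴺ
  step : ∀ i → i ℕ.≤ n → power (suc n) i ≡ power n i ℕ.* power n i ℕ.* (power n i ℕ.* power n i)
  step i i≤n = begin
    (i ℕ.+ 1) ℕ.^ (2 ℕ.* 4 ℕ.^ (suc n ∸ i))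
      ≡⟨ cong (λ k → (i ℕ.+ 1) ℕ.^ (2 ℕ.* 4 ℕ.^ k)) (ℕ.+-∸-assoc 1 i≤n) ⟩
    (i ℕ.+ 1) ℕ.^ (2 ℕ.* (4 ℕ.* 4 ℕ.^ (n ∸ i)))
      ≡⟨ cong ((i ℕ.+ 1) ℕ.^_) (exponent (4 ℕ.^ (n ∸ i))) ⟩
    (i ℕ.+ 1) ℕ.^ (2 ℕ.* 4 ℕ.^ (n ∸ i) ℕ.* 4)
      ≡⟨ ℕ.^-*-assoc (i ℕ.+ 1) (2 ℕ.* 4 ℕ.^ (n ∸ i)) 4 ⟨
    power n i ℕ.^ 4
      ≡⟨ fourth (power n i) ⟩
    power n i ℕ.* power n i ℕ.* (power n i ℕ.* power n i) ∎
    where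
    exponent : ∀ k → 2 ℕ.* (4 ℕ.* k) ≡ 2 ℕ.* k ℕ.* 4
    exponent = solve-∀ᴺ
    fourth : ∀ k → k ℕ.* (k ℕ.* (k ℕ.* (k ℕ.* 1))) ≡ k ℕ.* k ℕ.* (k ℕ.* k)
    fourth = solve-∀ᴺ
  fourth-power : ∀ is → All (ℕ._≤ n) is → product (map (power (suc n)) is) ≡
    product (map (power n) is) ℕ.* product (map (power n) is) ℕ.* (product (map (power n) is) ℕ.* product (map (power n) is))
  fourth-power []       []        = refl
  fourth-power (i ∷ is) (i≤n ∷ is≤n) = trans (cong₂ ℕ._*_ (step i i≤n) (fourth-power is is≤n))
    (interchange (power n i) (product (map (power n) is)))
    where
    interchange : ∀ j k → j ℕ.* j ℕ.* (j ℕ.* j) ℕ.* (k ℕ.* k ℕ.* (k ℕ.* k)) ≡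
                          j ℕ.* k ℕ.* (j ℕ.* k) ℕ.* (j ℕ.* k ℕ.* (j ℕ.* k))
    interchange = solve-∀ᴺ

-- Solution of the recurrences

module Spanning = StateSum excess Step.excess-assemble
module Forest   = StateSum ν Step.ν-assemble

Pℤ : ℕ → ℤ
Pℤ n = + ∏[0≤i≤ n ] (power n)

Pℤ-suc : ∀ n → Pℤ (suc n) ≡ + (n ℕ.+ 2) * + (n ℕ.+ 2) * (Pℤ n * Pℤ n * (Pℤ n * Pℤ n))
Pℤ-suc n = trans (cong +_ (∏-suc n)) (trans (ℤ.pos-* (k ℕ.* k) _)
  (cong₂ _*_ (ℤ.pos-* k k) (trans (ℤ.pos-* (P ℕ.* P) _) (cong₂ _*_ (ℤ.pos-* P P) (ℤ.pos-* P P)))))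
  where
  k P : ℕ
  k = n ℕ.+ 2
  P = ∏[0≤i≤ n ] (power n)

spanning-suc : ∀ n j → Spanning.stateSum (suc n) j ≡ sum° spanning j (Spanning.stateSum n true) (Spanning.stateSum n false)
spanning-suc n j = trans (Spanning.stateSum-suc n j) (cong₂ _+_ (branch true) (branch false))
  where
  c d : ℤ
  c = Spanning.stateSum n true
  d = Spanning.stateSum n false
  branch : ∀ ch → evaluate₄ c d (Spanning.leaf j ch) ≡ evaluate₄ c d (leaf° spanning j ch)
  branch ch = evaluate₄-cong c d {Spanning.leaf j ch} {leaf° spanning j ch} λ s₁ s₂ s₃ s₄ →
    cong₂ (λ z s → sgn (bit ch) * (z * δ j s))
    (0^excess-diamond ch s₁ s₂ s₃ s₄) (joined-diamond ch s₁ s₂ s₃ s₄)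

forest-suc : ∀ n j → Forest.stateSum (suc n) j ≡ sum° acyclic j (Forest.stateSum n true) (Forest.stateSum n false)
forest-suc n j = trans (Forest.stateSum-suc n j) (cong₂ _+_ (branch true) (branch false))
  where
  c d : ℤ
  c = Forest.stateSum n true
  d = Forest.stateSum n false
  branch : ∀ ch → evaluate₄ c d (Forest.leaf j ch) ≡ evaluate₄ c d (leaf° acyclic j ch)
  branch ch = evaluate₄-cong c d {Forest.leaf j ch} {leaf° acyclic j ch} λ s₁ s₂ s₃ s₄ →
    cong₂ (λ z s → sgn (bit ch) * (z * δ j s))
    (0^ν-diamond ch s₁ s₂ s₃ s₄) (joined-diamond ch s₁ s₂ s₃ s₄)

edge₀ empty₀ : Graph (2 ℕ.+ inner 0)
edge₀  = (X , Y) ∷ []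
empty₀ = []

spanning-zero : ∀ j → Spanning.stateSum 0 j ≡ - δ j true + δ j false
spanning-zero j = trans (cong₂ (λ i k → i + (k + 0ℤ))
  (cong₂ (λ e s → sgn 1 * 0ℤ ^ e * δ j s) (excess≡ edge₀) (joined≡ edge₀))
  (cong₂ (λ e s → sgn 0 * 0ℤ ^ e * δ j s) (excess≡ empty₀) (joined≡ empty₀)))
  (ring (δ j true) (δ j false))
  where
  ring : ∀ t f → -1ℤ * t + (1ℤ * f + 0ℤ) ≡ - t + f
  ring = solve-∀

forest-zero : ∀ j → Forest.stateSum 0 j ≡ - δ j true + δ j false
forest-zero j = trans (cong₂ (λ i k → i + (k + 0ℤ))
  (cong₂ (λ e s → sgn 1 * 0ℤ ^ e * δ j s) (ν≡nullity edge₀) (joined≡ edge₀))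
  (cong₂ (λ e s → sgn 0 * 0ℤ ^ e * δ j s) (ν≡nullity empty₀) (joined≡ empty₀)))
  (ring (δ j true) (δ j false))
  where
  ring : ∀ t f → -1ℤ * t + (1ℤ * f + 0ℤ) ≡ - t + f
  ring = solve-∀

-- The ratio r of the joined to the separated sum satisfies 1/r′ = 1/r - 1/2, and r = -1
-- at n = 0; hence 1/r = - (n + 2) / 2.
spanning-stateSum : ∀ n → Spanning.stateSum n true ≡ - Pℤ n ×
                          + 2 * Spanning.stateSum n false ≡ + (n ℕ.+ 2) * Pℤ n
spanning-stateSum zero    = spanning-zero true , cong (+ 2 *_) (spanning-zero false)
spanning-stateSum (suc n) with spanning-stateSum n
... | c≡ , 2d≡ = first , second
  where
  open ≡-Reasoning
  c d k p : ℤ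
  c = Spanning.stateSum n true
  d = Spanning.stateSum n false
  k = + (n ℕ.+ 2)
  p = Pℤ n
  first : Spanning.stateSum (suc n) true ≡ - Pℤ (suc n)
  first = begin
    Spanning.stateSum (suc n) true            ≡⟨ trans (spanning-suc n true) (spanning-true c d) ⟩
    - (+ 4 * (c * c * (d * d)))               ≡⟨ ring₁ c d ⟩
    - (c * c * ((+ 2 * d) * (+ 2 * d)))       ≡⟨ cong₂ (λ c e → - (c * c * (e * e))) c≡ 2d≡ ⟩
    - (- p * - p * (k * p * (k * p)))         ≡⟨ ring₂ k p ⟩
    - (k * k * (p * p * (p * p)))             ≡⟨ cong -_ (Pℤ-suc n) ⟨
    - Pℤ (suc n)                              ∎
    where
    ring₁ : ∀ c d → - (+ 4 * (c * c * (d * d))) ≡ - (c * c * ((+ 2 * d) * (+ 2 * d)))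
    ring₁ = solve-∀
    ring₂ : ∀ k p → - (- p * - p * (k * p * (k * p))) ≡ - (k * k * (p * p * (p * p)))
    ring₂ = solve-∀
  second : + 2 * Spanning.stateSum (suc n) false ≡ + (suc n ℕ.+ 2) * Pℤ (suc n)
  second = begin
    + 2 * Spanning.stateSum (suc n) false
      ≡⟨ cong (+ 2 *_) (trans (spanning-suc n false) (spanning-false c d)) ⟩
    + 2 * (+ 2 * (c * c * (d * d)) - + 4 * (c * (d * (d * d))))
      ≡⟨ ring₁ c d ⟩
    c * c * ((+ 2 * d) * (+ 2 * d)) - c * ((+ 2 * d) * ((+ 2 * d) * (+ 2 * d)))
      ≡⟨ cong₂ (λ c e → c * c * (e * e) - c * (e * (e * e))) c≡ 2d≡ ⟩
    - p * - p * (k * p * (k * p)) - - p * (k * p * (k * p * (k * p)))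
      ≡⟨ ring₂ k p ⟩
    (1ℤ + k) * (k * k * (p * p * (p * p)))
      ≡⟨ cong₂ _*_ (sym (ℤ.pos-+ 1 (n ℕ.+ 2))) (sym (Pℤ-suc n)) ⟩
    + (suc n ℕ.+ 2) * Pℤ (suc n) ∎
    where
    ring₁ : ∀ c d → + 2 * (+ 2 * (c * c * (d * d)) - + 4 * (c * (d * (d * d)))) ≡
                    c * c * ((+ 2 * d) * (+ 2 * d)) - c * ((+ 2 * d) * ((+ 2 * d) * (+ 2 * d)))
    ring₁ = solve-∀
    ring₂ : ∀ k p → - p * - p * (k * p * (k * p)) - - p * (k * p * (k * p * (k * p))) ≡
                    (1ℤ + k) * (k * k * (p * p * (p * p)))
    ring₂ = solve-∀

-- For forests it is the ratio r of the joined to the separated sum itself that satisfies r′ = r -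
-- 1/2, again starting from -1. The doubled sum keeps the statement within the integers.
forest-stateSum : ∀ n → + 2 * Forest.stateSum n true ≡ - (+ (n ℕ.+ 2) * Pℤ n) ×
                        Forest.stateSum n false ≡ Pℤ n
forest-stateSum zero    = cong (+ 2 *_) (forest-zero true) , forest-zero false
forest-stateSum (suc n) with forest-stateSum n
... | 2c≡ , d≡ = first , second
  where
  open ≡-Reasoning
  c d k p : ℤ
  c = Forest.stateSum n true
  d = Forest.stateSum n false
  k = + (n ℕ.+ 2)
  p = Pℤ n
  first : + 2 * Forest.stateSum (suc n) true ≡ - (+ (suc n ℕ.+ 2) * Pℤ (suc n))
  first = begin
    + 2 * Forest.stateSum (suc n) true
      ≡⟨ cong (+ 2 *_) (trans (forest-suc n true) (acyclic-true c d)) ⟩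
    + 2 * (+ 4 * (c * (c * (c * d))) - + 2 * (c * c * (d * d)))
      ≡⟨ ring₁ c d ⟩
    (+ 2 * c) * ((+ 2 * c) * (+ 2 * c)) * d - (+ 2 * c) * (+ 2 * c) * (d * d)
      ≡⟨ cong₂ (λ e d → e * (e * e) * d - e * e * (d * d)) 2c≡ d≡ ⟩
    - (k * p) * (- (k * p) * - (k * p)) * p - - (k * p) * - (k * p) * (p * p)
      ≡⟨ ring₂ k p ⟩
    - ((1ℤ + k) * (k * k * (p * p * (p * p))))
      ≡⟨ cong₂ (λ i j → - (i * j)) (sym (ℤ.pos-+ 1 (n ℕ.+ 2))) (sym (Pℤ-suc n)) ⟩
    - (+ (suc n ℕ.+ 2) * Pℤ (suc n)) ∎
    where
    ring₁ : ∀ c d → + 2 * (+ 4 * (c * (c * (c * d))) - + 2 * (c * c * (d * d))) ≡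
                    (+ 2 * c) * ((+ 2 * c) * (+ 2 * c)) * d - (+ 2 * c) * (+ 2 * c) * (d * d)
    ring₁ = solve-∀
    ring₂ : ∀ k p → - (k * p) * (- (k * p) * - (k * p)) * p - - (k * p) * - (k * p) * (p * p) ≡
                    - ((1ℤ + k) * (k * k * (p * p * (p * p))))
    ring₂ = solve-∀
  second : Forest.stateSum (suc n) false ≡ Pℤ (suc n)
  second = begin
    Forest.stateSum (suc n) false             ≡⟨ trans (forest-suc n false) (acyclic-false c d) ⟩
    + 4 * (c * c * (d * d))                   ≡⟨ ring₁ c d ⟩
    (+ 2 * c) * (+ 2 * c) * (d * d)           ≡⟨ cong₂ (λ e d → e * e * (d * d)) 2c≡ d≡ ⟩
    - (k * p) * - (k * p) * (p * p)           ≡⟨ ring₂ k p ⟩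
    k * k * (p * p * (p * p))                 ≡⟨ Pℤ-suc n ⟨
    Pℤ (suc n)                                ∎
    where
    ring₁ : ∀ c d → + 4 * (c * c * (d * d)) ≡ (+ 2 * c) * (+ 2 * c) * (d * d)
    ring₁ = solve-∀
    ring₂ : ∀ k p → - (k * p) * - (k * p) * (p * p) ≡ k * k * (p * p * (p * p))
    ring₂ = solve-∀

-- The Tutte polynomial of Gₙ at (1,0) and (0,1)

-- A graph has one component exactly if its special vertices are joined and no component avoids
-- them.
connectedSum-G : ∀ n → connectedSum [] (G n) ≡ Spanning.stateSum n true
connectedSum-G n = ∑-cong (spanningSubgraphs (G n)) λ H → trans
  (cong (λ k → sgn (length H) * 𝟙 (k ℕ.≟ 1)) (trans (cong components (++-identityʳ H)) (sym (κ≡components H))))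
  (trans (cong (sgn (length H) *_) (indicator (κ H) (joined H) (excess H) (2+excess H)))
         (sym (ℤ.*-assoc (sgn (length H)) (0ℤ ^ excess H) (δ true (joined H)))))
  where
  indicator : ∀ k j e → k ℕ.+ bit j ≡ 2 ℕ.+ e → 𝟙 (k ℕ.≟ 1) ≡ 0ℤ ^ e * δ true j
  indicator k true e eq with refl ← ℕ.suc-injective (trans (ℕ.+-comm 1 k) eq) = case e
    where
    case : ∀ e → 𝟙 (suc e ℕ.≟ 1) ≡ 0ℤ ^ e * 1ℤ
    case zero    = refl
    case (suc e) = sym (trans (ℤ.*-identityʳ (0ℤ ^ suc e)) (0^suc e))
  indicator k false e eq with refl ← trans (sym (ℕ.+-identityʳ k)) eq = sym (ℤ.*-zeroʳ (0ℤ ^ e))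

-- Forests count whether or not they join the special vertices. With P for the product, the two
-- parts are -(n + 2)P/2 and P; their sum -nP/2 is the origin of the factor n/2.
forestSum-G : ∀ n → forestSum [] (G n) ≡ Forest.stateSum n true + Forest.stateSum n false
forestSum-G n = trans
  (∑-cong (spanningSubgraphs (G n)) λ H → trans
    (cong (sgn (length H) *_) (trans (sym (0^nullity H)) (cong (0ℤ ^_) (sym (ν≡nullity H)))))
    (sym (ℤ.*-identityʳ (Forest.weight H))))
  (trans (Forest.∑-by-state n (λ _ → 1ℤ))
         (cong₂ _+_ (ℤ.*-identityʳ (Forest.stateSum n true)) (ℤ.*-identityʳ (Forest.stateSum n false))))

-- Connectedness of Gₙ in the form that passes through `assemble`: `G (suc n)` is assembled from
-- four full copies and the chord, so only the full diamond has to be examined.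
G-tight : ∀ n → excess (G n) ≡ 0 × joined (G n) ≡ true
G-tight zero    = excess≡ edge₀ , joined≡ edge₀
G-tight (suc n) with G-tight n
... | e≡0 , j≡true =
  trans (Step.excess-assemble n (G n) (G n) (G n) (G n) true)
    (trans (cong₂ (λ j e → excess (diamond true j j j j) ℕ.+ (e ℕ.+ e ℕ.+ e ℕ.+ e)) j≡true e≡0)
    (trans (ℕ.+-identityʳ _) (excess≡ (diamond true true true true true)))) ,
  trans (Step.joined-assemble n (G n) (G n) (G n) (G n) true)
    (trans (cong (λ j → joined (diamond true j j j j)) j≡true) (joined-diamond true true true true true))

components-G : ∀ n → components (G n) ≡ 1
components-G n with G-tight n
... | e≡0 , j≡true = trans (sym (κ≡components (G n))) (tight (2+excess (G n)) e≡0 j≡true)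
  where
  tight : ∀ {k j e} → k ℕ.+ bit j ≡ 2 ℕ.+ e → e ≡ 0 → j ≡ true → k ≡ 1
  tight {k} eq refl refl = ℕ.suc-injective (trans (ℕ.+-comm 1 k) eq)

G-loopless : ∀ n → All (λ (x , y) → x ≢ y) (G n)
G-loopless zero    = (λ ()) ∷ []
G-loopless (suc n) = (λ ()) ∷
  All.++⁺ (copy copy₁) (All.++⁺ (copy copy₂) (All.++⁺ (copy copy₃) (All.++⁺ (copy copy₄) [])))
  where
  copy : ∀ i → All (λ (x , y) → x ≢ y) (mapEdges (glue n i) (G n))
  copy i = All.map⁺ (All.map (λ x≢y eq → x≢y (Step.glue-injective n i eq)) (G-loopless n))

-- The number of vertices of Gₙ is even, and the sign in front of both sums is therefore -1.
sgn-inner : ∀ n → sgn (inner n) ≡ 1ℤ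
sgn-inner zero    = refl
sgn-inner (suc n) = trans (double-negation (sgn (4 ℕ.* inner n)))
  (trans (sym (ℤ.^-*-assoc -1ℤ 4 (inner n))) (ℤ.^-zeroˡ (inner n)))
  where
  double-negation : ∀ i → -1ℤ * (-1ℤ * i) ≡ i
  double-negation = solve-∀

sgn-vertices : ∀ n → sgn (suc (2 ℕ.+ inner n)) ≡ -1ℤ
sgn-vertices n = trans (ring (sgn (inner n))) (cong (-1ℤ *_) (sgn-inner n))
  where
  ring : ∀ i → -1ℤ * (-1ℤ * (-1ℤ * i)) ≡ -1ℤ * i
  ring = solve-∀

tutte-G-1-0 : ∀ n → tutte (G n) 1ℤ 0ℤ ≡ Pℤ n
tutte-G-1-0 n = begin
  tutte (G n) 1ℤ 0ℤ
    ≡⟨ tutte-1-0 {L = G n} X (components-G n) ⟩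
  sgn (suc (2 ℕ.+ inner n)) * connectedSum [] (G n)
    ≡⟨ cong₂ _*_ (sgn-vertices n) (trans (connectedSum-G n) (spanning-stateSum n .proj₁)) ⟩
  -1ℤ * - Pℤ n
    ≡⟨ ring (Pℤ n) ⟩
  Pℤ n ∎
  where
  open ≡-Reasoning
  ring : ∀ i → -1ℤ * - i ≡ i
  ring = solve-∀

tutte-G-0-1 : ∀ n → + 2 * tutte (G n) 0ℤ 1ℤ ≡ + n * Pℤ n
tutte-G-0-1 n = begin
  + 2 * tutte (G n) 0ℤ 1ℤ
    ≡⟨ cong (+ 2 *_) (tutte-0-1 {L = G n} X (components-G n)) ⟩
  + 2 * (sgn (suc (2 ℕ.+ inner n)) * forestSum [] (G n))
    ≡⟨ cong₂ (λ s t → + 2 * (s * t)) (sgn-vertices n) (forestSum-G n) ⟩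
  + 2 * (-1ℤ * (Forest.stateSum n true + Forest.stateSum n false))
    ≡⟨ distribute (Forest.stateSum n true) (Forest.stateSum n false) ⟩
  - (+ 2 * Forest.stateSum n true) - + 2 * Forest.stateSum n false
    ≡⟨ cong₂ (λ i j → - i - + 2 * j) (forest-stateSum n .proj₁) (forest-stateSum n .proj₂) ⟩
  - - (+ (n ℕ.+ 2) * Pℤ n) - + 2 * Pℤ n
    ≡⟨ cong (λ k → - - (k * Pℤ n) - + 2 * Pℤ n) (ℤ.pos-+ n 2) ⟩
  - - ((+ n + + 2) * Pℤ n) - + 2 * Pℤ n
    ≡⟨ cancel (+ n) (Pℤ n) ⟩
  + n * Pℤ n ∎
  where
  open ≡-Reasoning
  distribute : ∀ i j → + 2 * (-1ℤ * (i + j)) ≡ - (+ 2 * i) - + 2 * j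
  distribute = solve-∀
  cancel : ∀ i p → - - ((i + + 2) * p) - + 2 * p ≡ i * p
  cancel = solve-∀

halve : ∀ (t i p : ℤ) → + 2 * t ≡ i * p → t / 1 ≡ (i / 2) ℚ.* (p / 1)
halve t i p eq = ℚ.toℚᵘ-injective (begin
  ℚ.toℚᵘ (t / 1)                        ≈⟨ ℚ.toℚᵘ-fromℚᵘ (mkℚᵘ t 0) ⟩
  mkℚᵘ t 0                              ≈⟨ *≡* (trans (ℤ.*-comm t (+ 2)) (trans eq (sym (ℤ.*-identityʳ (i * p))))) ⟩
  mkℚᵘ i 1 ℚᵘ.* mkℚᵘ p 0                ≈⟨ ℚᵘ.*-cong (ℚ.toℚᵘ-fromℚᵘ (mkℚᵘ i 1)) (ℚ.toℚᵘ-fromℚᵘ (mkℚᵘ p 0)) ⟨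
  ℚ.toℚᵘ (i / 2) ℚᵘ.* ℚ.toℚᵘ (p / 1)    ≈⟨ ℚ.toℚᵘ-homo-* (i / 2) (p / 1) ⟨
  ℚ.toℚᵘ ((i / 2) ℚ.* (p / 1))          ∎)
  where open ℚᵘ.≃-Reasoning

theorem3 : (n : ℕ) →
    let P = ∏[0≤i≤ n ] (λ i → (i ℕ.+ 1) ℕ.^ (2 ℕ.* 4 ℕ.^ (n ∸ i))) in
    ( ((r : Vertex n) → + #acyclicRootConnected (G n) r ≡ tutte (G n) 1ℤ 0ℤ)
    × tutte (G n) 1ℤ 0ℤ ≡ + P )
    ×
    ( + #stronglyConnectedIndegreeSequences (G n) ≡ tutte (G n) 0ℤ 1ℤ
    × tutte (G n) 0ℤ 1ℤ / 1 ≡ (+ n / 2) ℚ.* (+ P / 1) )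
theorem3 n =
  ( #acyclicRootConnected-tutte {L = G n} (components-G n)
  , tutte-G-1-0 n )
  ,
  ( #stronglyConnectedIndegreeSequences-tutte {L = G n} (components-G n) X (G-loopless n)
  , halve (tutte (G n) 0ℤ 1ℤ) (+ n) (Pℤ n) (tutte-G-0-1 n) )
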